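{- For every fixed integer $d\ge 2$, $\beta(n,d) = \Omega\!\left((n\log n)^{1/d}\right)$: there is a constant $c=c(d)>0$ such that every set $\mathcal{H}$ of $n$ hyperplanes in $\mathbb{R}^d$ (for $n$ sufficiently large) contains a subset $S\subseteq\mathcal{H}$ with $|S|\ge c(n\log n)^{1/d}$ such that no cell of the arrangement of $\mathcal{H}$ is bounded by hyperplanes of $S$ only.
   Context: For a finite set $\mathcal{H}$ of hyperplanes in $\mathbb{R}^d$, the cells of its arrangement are the connected components of $\mathbb{R}^d\setminus\bigcup_{h\in\mathcal{H}}h$. Let $G(\mathcal{H})$ be the hypergraph with vertex set $\mathcal{H}$ in which, for each cell of the arrangement, the set of hyperplanes containing the facets of that cell forms a hyperedge. A subset $S\subseteq\mathcal{H}$ is independent if it is an independent set of $G(\mathcal{H})$, i.e. no cell of the arrangement has all its facet-supporting hyperplanes in $S$ ("no cell is bounded by hyperplanes of $S$ only"). $\beta(\mathcal{H})$ is the maximum size of an independent subset of $\mathcal{H}$, and $\beta(n,d)=\min\{\beta(\mathcal{H}): \mathcal{H} \text{ a set of } n \text{ hyperplanes in } \mathbb{R}^d\}$. -}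

module Defs where

open import Data.Nat using (ℕ; zero; suc)
open import Data.Fin using (Fin; zero; suc)
open import Data.Fin.Subset using (Subset; _∈_)
open import Data.Product using (Σ; ∃; _×_; _,_)
open import Data.Sum using (_⊎_)
open import Data.Empty using (⊥)
open import Relation.Nullary using (¬_)
open import Relation.Binary.PropositionalEquality using (_≡_; _≢_)
open import Function.Bundles using (_⇔_)

-- The real numbers, axiomatised as a Dedekind-complete ordered field
-- (classically unique up to isomorphism, i.e. this is ℝ).

record RealField : Set₁ where
  infixl 6 _+_
  infixl 7 _*_
  infix 4 _<_
  field
    Carrier : Set
    _+_ _*_ : Carrier → Carrier → Carrier
    -_      : Carrier → Carrier
    0# 1#   : Carrier
    _<_     : Carrier → Carrier → Set
    +-assoc    : ∀ x y z → (x + y) + z ≡ x + (y + z)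
    +-comm     : ∀ x y → x + y ≡ y + x
    +-identity : ∀ x → 0# + x ≡ x
    +-inverse  : ∀ x → x + (- x) ≡ 0#
    *-assoc    : ∀ x y z → (x * y) * z ≡ x * (y * z)
    *-comm     : ∀ x y → x * y ≡ y * x
    *-identity : ∀ x → 1# * x ≡ x
    distrib    : ∀ x y z → x * (y + z) ≡ (x * y) + (x * z)
    0≢1        : 0# ≢ 1#
    *-inverse  : ∀ x → x ≢ 0# → ∃ λ y → x * y ≡ 1#
    <-irrefl   : ∀ x → ¬ (x < x)
    <-trans    : ∀ x y z → x < y → y < z → x < z
    <-trichotomy : ∀ x y → (x < y) ⊎ ((x ≡ y) ⊎ (y < x))
    +-mono-<   : ∀ x y z → x < y → x + z < y + z
    *-pos      : ∀ x y → 0# < x → 0# < y → 0# < x * y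
    complete   : (P : Carrier → Set) → (∃ λ x → P x) →
                 (∃ λ u → ∀ x → P x → ¬ (u < x)) →
                 ∃ λ s → (∀ x → P x → ¬ (s < x)) ×
                         (∀ u → (∀ x → P x → ¬ (u < x)) → ¬ (u < s))

module Geometry (R : RealField) where
  open RealField R

  Point : ℕ → Set
  Point d = Fin d → Carrier

  dot : ∀ {d} → (Fin d → Carrier) → (Fin d → Carrier) → Carrier
  dot {zero}  a x = 0#
  dot {suc d} a x = (a zero * x zero) + dot (λ k → a (suc k)) (λ k → x (suc k))

  record Hyperplane (d : ℕ) : Set where
    constructor hyp
    field
      normal  : Fin d → Carrier
      offset  : Carrier
      nonzero : ¬ (∀ k → normal k ≡ 0#)

  open Hyperplane public

  value : ∀ {d} → Hyperplane d → Point d → Carrier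
  value h x = dot (normal h) x + (- offset h)

  On : ∀ {d} → Hyperplane d → Point d → Set
  On h x = value h x ≡ 0#

  SameStrictSide : ∀ {d} → Hyperplane d → Point d → Point d → Set
  SameStrictSide h x y =
    ((0# < value h x) × (0# < value h y)) ⊎ ((value h x < 0#) × (value h y < 0#))

  Distinct : ∀ {n d} → (Fin n → Hyperplane d) → Set
  Distinct {n} {d} H = ∀ i j → i ≢ j → ¬ (∀ (y : Point d) → (On (H i) y ⇔ On (H j) y))

  -- x lies in the union of no hyperplane: it belongs to a cell of the
  -- arrangement (cells = connected components of the complement; the cell
  -- of x is the set of points on the same strict side of every H i as x)
  Generic : ∀ {n d} → (Fin n → Hyperplane d) → Point d → Set
  Generic H x = ∀ i → ¬ On (H i) x

  -- H i contains a facet of the cell containing x: some point y of H i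
  -- lies strictly on x's side of every other hyperplane (so the cell's
  -- closure meets H i in a (d-1)-dimensional face).
  FacetOf : ∀ {n d} → (Fin n → Hyperplane d) → Point d → Fin n → Set
  FacetOf {n} {d} H x i =
    ∃ λ (y : Point d) → On (H i) y × (∀ j → j ≢ i → SameStrictSide (H j) x y)

  Independent : ∀ {n d} → (Fin n → Hyperplane d) → Subset n → Set
  Independent {n} {d} H S =
    ∀ (x : Point d) → Generic H x → ¬ (∀ i → FacetOf H x i → i ∈ S)

{-# OPTIONS --safe #-}
-- Let a cell be good if it is a simplex (d + 1 facets) inside a large box. A good cell is determined by d of its facets and
-- its signs there, so the facet sets of good cells form a (d + 1)-uniform hypergraph in which every d-set lies in at most
-- 2 ^ d edges. By the Sauer–Shelah lemma there are O(n ^ d) cells, of which only O(n ^ (d - 1)) meet the box.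
--
-- Choose hyperplanes one at a time, m = n ^ (1/d + small) in all, so that the chosen set M never contains d facets of a cell
-- meeting the box, d + 2 facets of any cell, two edges with two common vertices, or a triangle of edges. At this density each
-- kind of obstacle is rare enough that a weighted count of obstacles lets most choices through. An independent set of the
-- linear triangle-free hypergraph induced on M is then independent in the arrangement.
--
-- If all independent sets had o((n log n) ^ (1/d)) elements, then among the admissible choices of a new vertex v there would
-- always be one with few links inside a typical independent set I ⊆ M. Removing from I all the links of v that it contains is
-- at most 2 ^ g to one, where g is the number of links that can be added to the result, and g is small on average. Hence a
-- 2 ^ -(j + 1) fraction of the independent sets can be extended by v, for j = c log n, and after m steps the number of
-- independent sets exceeds the number of all small sets.
--
-- If some cell has fewer than d facets, all normals are orthogonal to a common direction and the dimension drops; in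
-- dimension ρ < d the obstacles alone are so rare that the greedily chosen M itself is independent.
module Submission where

open import Defs
open import Data.Nat
open import Data.Nat.Properties
open import Data.Nat.Logarithm using (⌊log₂_⌋; ⌊log₂⌊n/2⌋⌋≡⌊log₂n⌋∸1; ⌊log₂[2^n]⌋≡n; ⌊log₂⌋-mono-≤)
open import Data.Fin using (Fin; zero; suc; punchIn; punchOut)
open import Data.Fin.Subset using (Subset; ∣_∣; _∪_; _∩_)
open import Data.Fin.Subset.Properties using (∣p∣≤n)
open import Data.Bool using (Bool; true; false; _∧_; _∨_; not; if_then_else_)
open import Data.Vec using (Vec; []; _∷_; lookup; _[_]≔_; zipWith; replicate; tabulate)
open import Data.Vec.Properties
  using (lookup-zipWith; lookup∘updateAt; lookup∘updateAt′; lookup∘tabulate; lookup-replicate; ≡-dec; ∷-injectiveʳ; []=⇒lookup)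
open import Data.List using (List; []; _∷_; _++_; map; concatMap; length; filter)
open import Data.List.Properties using (length-++; length-map)
open import Data.List.Membership.Propositional using () renaming (_∈_ to _∈ᴸ_)
open import Data.List.Membership.Propositional.Properties
  using (∈-++⁺ˡ; ∈-++⁺ʳ; ∈-++⁻; ∈-map⁺; ∈-map⁻; ∈-filter⁺; ∈-filter⁻)
open import Data.List.Relation.Unary.Any using (here; there)
open import Data.List.Relation.Unary.Unique.Propositional using (Unique)
open import Data.List.Relation.Unary.All as All using ([]; _∷_)
open import Data.List.Relation.Unary.AllPairs using ([]; _∷_)
open import Data.Product using (∃; _×_; _,_; proj₁; proj₂)
open import Data.Sum using (_⊎_; inj₁; inj₂; [_,_]′; map₂)
open import Data.Empty using (⊥; ⊥-elim)
open import Data.Unit using (⊤; tt)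
open import Relation.Nullary using (¬_; Dec; yes; no; does)
open import Relation.Binary.PropositionalEquality hiding (J)
open import Function using (_∘_; id; case_of_; mk⇔; module Equivalence)
open import Data.Nat.Tactic.RingSolver using (solve-∀)

-- The logarithm comes from averaging over all `n` vertices and not only over those of `M`: an
-- independent set with at most `s` elements has at most `s ^ d` subsets of size `d`, each completed
-- to an edge in at most `2 ^ d` ways, so an average vertex sees about `s ^ d / n` links inside it.
-- While this stays below `j = c log n`, the fraction lost is a small negative power of `n`, and `m`
-- exceeds `n ^ (1/d)` by a larger power. Linearity makes the links of `v` disjoint, and without
-- triangles the removal of one link leaves the freeness of the others unchanged, so links are
-- cleared one at a time at the price of a factor 2 for each free one. All counting is in natural
-- numbers: expectations at density `μ / n` are multiplied by `n ^ K`, and growth factors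
-- `1 + 1 / Q` by `Q`. Emptiness of a cell is never decided outright: the main argument ends in a
-- contradiction, where finitely many cases of excluded middle may be assumed. The set `S` is then
-- found by searching all subsets, because independence is a negative statement, and completeness of
-- ℝ decides those.

-- Finite sums and indicators

module _ {A : Set} where

  ∑ : List A → (A → ℕ) → ℕ
  ∑ []       f = 0
  ∑ (x ∷ xs) f = f x + ∑ xs f

  ∑-mono∈ : ∀ xs {f g : A → ℕ} → (∀ x → x ∈ᴸ xs → f x ≤ g x) → ∑ xs f ≤ ∑ xs g
  ∑-mono∈ []       h = z≤n
  ∑-mono∈ (x ∷ xs) h = +-mono-≤ (h x (here refl)) (∑-mono∈ xs (λ y → h y ∘ there))

  ∑-mono : ∀ xs {f g : A → ℕ} → (∀ x → f x ≤ g x) → ∑ xs f ≤ ∑ xs g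
  ∑-mono xs h = ∑-mono∈ xs (λ x _ → h x)

  ∑-cong : ∀ xs {f g : A → ℕ} → (∀ x → f x ≡ g x) → ∑ xs f ≡ ∑ xs g
  ∑-cong xs h = ≤-antisym (∑-mono xs (≤-reflexive ∘ h)) (∑-mono xs (≤-reflexive ∘ sym ∘ h))

  ∑-++ : ∀ xs ys (f : A → ℕ) → ∑ (xs ++ ys) f ≡ ∑ xs f + ∑ ys f
  ∑-++ []       ys f = refl
  ∑-++ (x ∷ xs) ys f = trans (cong (f x +_) (∑-++ xs ys f)) (sym (+-assoc (f x) _ _))

  ∑-0 : ∀ xs → ∑ xs (λ _ → 0) ≡ 0
  ∑-0 []       = refl
  ∑-0 (x ∷ xs) = ∑-0 xs

  ∑-+ : ∀ xs (f g : A → ℕ) → ∑ xs (λ x → f x + g x) ≡ ∑ xs f + ∑ xs g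
  ∑-+ []       f g = refl
  ∑-+ (x ∷ xs) f g rewrite ∑-+ xs f g = lemma (f x) (g x) (∑ xs f) (∑ xs g)
    where lemma : ∀ a b c d → a + b + (c + d) ≡ a + c + (b + d)
          lemma = solve-∀

  ∑-* : ∀ xs c (f : A → ℕ) → ∑ xs (λ x → c * f x) ≡ c * ∑ xs f
  ∑-* []       c f = sym (*-zeroʳ c)
  ∑-* (x ∷ xs) c f rewrite ∑-* xs c f = sym (*-distribˡ-+ c (f x) _)

  ∑-const : ∀ xs c → ∑ xs (λ _ → c) ≡ length xs * c
  ∑-const []       c = refl
  ∑-const (x ∷ xs) c = cong (c +_) (∑-const xs c)

  ∑-∈ : ∀ {xs x} (f : A → ℕ) → x ∈ᴸ xs → f x ≤ ∑ xs f
  ∑-∈ f (here refl) = m≤m+n _ _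
  ∑-∈ f (there p)   = ≤-trans (∑-∈ f p) (m≤n+m _ _)

  ∑-zero : ∀ {xs x} (f : A → ℕ) → x ∈ᴸ xs → ∑ xs f ≡ 0 → f x ≡ 0
  ∑-zero f p e = n≤0⇒n≡0 (≤-trans (∑-∈ f p) (≤-reflexive e))

  -- The first moment method: failures are counted by naturals, so an average below 1 leaves a
  -- choice with no failure at all.
  below-average : ∀ xs (f : A → ℕ) → ∑ xs f < length xs → ∃ λ x → x ∈ᴸ xs × f x ≡ 0
  below-average (x ∷ xs) f lt with f x in eq
  ... | zero  = x , here refl , eq
  ... | suc k with below-average xs f (≤-pred (≤-trans (s≤s (s≤s (m≤n+m _ k))) lt))
  ... | y , p , e = y , there p , e

∑-swap : ∀ {A B : Set} (xs : List A) (ys : List B) (f : A → B → ℕ) →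
         ∑ xs (λ x → ∑ ys (f x)) ≡ ∑ ys (λ y → ∑ xs (λ x → f x y))
∑-swap []       ys f = sym (∑-0 ys)
∑-swap (x ∷ xs) ys f = trans (cong (∑ ys (f x) +_) (∑-swap xs ys f)) (sym (∑-+ ys (f x) _))

∑-map : ∀ {A B : Set} (g : A → B) xs (f : B → ℕ) → ∑ (map g xs) f ≡ ∑ xs (f ∘ g)
∑-map g []       f = refl
∑-map g (x ∷ xs) f = cong (f (g x) +_) (∑-map g xs f)

∑-concatMap : ∀ {A B : Set} (g : A → List B) xs (f : B → ℕ) →
              ∑ (concatMap g xs) f ≡ ∑ xs (λ x → ∑ (g x) f)
∑-concatMap g []       f = refl
∑-concatMap g (x ∷ xs) f =
  trans (∑-++ (g x) (concatMap g xs) f) (cong (∑ (g x) f +_) (∑-concatMap g xs f))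

⟦_⟧ : Bool → ℕ
⟦ true ⟧  = 1
⟦ false ⟧ = 0

⟦⟧≤1 : ∀ b → ⟦ b ⟧ ≤ 1
⟦⟧≤1 true  = ≤-refl
⟦⟧≤1 false = z≤n

∧-true : ∀ {a b} → a ∧ b ≡ true → a ≡ true × b ≡ true
∧-true {true} {true} refl = refl , refl

true-∧ : ∀ {a b} → a ≡ true → b ≡ true → a ∧ b ≡ true
true-∧ refl refl = refl

not-both : ∀ {b} → b ≡ true → b ≡ false → ⊥
not-both refl ()

≢true : ∀ {b} → ¬ b ≡ true → b ≡ false
≢true {true}  h = ⊥-elim (h refl)
≢true {false} h = refl

⟦⟧-mono : ∀ {a b} → (a ≡ true → b ≡ true) → ⟦ a ⟧ ≤ ⟦ b ⟧
⟦⟧-mono {true}  h rewrite h refl = ≤-refl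
⟦⟧-mono {false} h = z≤n

when : ∀ b {f g} → (b ≡ true → f ≤ g) → ⟦ b ⟧ * f ≤ g
when true  h = ≤-trans (≤-reflexive (+-identityʳ _)) (h refl)
when false h = z≤n

⟦⟧* : ∀ {b} f → b ≡ true → ⟦ b ⟧ * f ≡ f
⟦⟧* f refl = +-identityʳ f

select : ∀ {A : Set} → (A → Bool) → List A → List A
select P = filter (λ x → P x Data.Bool.≟ true)

∑-select : ∀ {A : Set} (P : A → Bool) xs (f : A → ℕ) → ∑ (select P xs) f ≡ ∑ xs (λ x → ⟦ P x ⟧ * f x)
∑-select P []       f = refl
∑-select P (x ∷ xs) f with P x
... | true  = cong₂ _+_ (sym (+-identityʳ (f x))) (∑-select P xs f)
... | false = ∑-select P xs f

-- Enumeration of Boolean vectors and of indices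

vecs : ∀ n → List (Vec Bool n)
vecs zero    = [] ∷ []
vecs (suc n) = map (true ∷_) (vecs n) ++ map (false ∷_) (vecs n)

∈-vecs : ∀ {n} (v : Vec Bool n) → v ∈ᴸ vecs n
∈-vecs []          = here refl
∈-vecs (true ∷ v)  = ∈-++⁺ˡ (∈-map⁺ _ (∈-vecs v))
∈-vecs {suc n} (false ∷ v) = ∈-++⁺ʳ (map (true ∷_) (vecs n)) (∈-map⁺ _ (∈-vecs v))

∑-vecs : ∀ n (f : Vec Bool (suc n) → ℕ) →
         ∑ (vecs (suc n)) f ≡ ∑ (vecs n) (f ∘ (true ∷_)) + ∑ (vecs n) (f ∘ (false ∷_))
∑-vecs n f = trans (∑-++ (map (true ∷_) (vecs n)) _ f)
                   (cong₂ _+_ (∑-map (true ∷_) (vecs n) f) (∑-map (false ∷_) (vecs n) f))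

vecs-unique : ∀ n → Unique (vecs n)
vecs-unique zero    = [] ∷ []
vecs-unique (suc n) = ++⁺ (map⁺ (λ { refl → refl }) (vecs-unique n))
                          (map⁺ (λ { refl → refl }) (vecs-unique n)) disjoint
  where
  open import Data.List.Relation.Unary.Unique.Propositional.Properties using (++⁺; map⁺)
  disjoint : ∀ {v} → ¬ (v ∈ᴸ map (true ∷_) (vecs n) × v ∈ᴸ map (false ∷_) (vecs n))
  disjoint (p , q) with ∈-map⁻ (true ∷_) p | ∈-map⁻ (false ∷_) q
  ... | _ , _ , refl | _ , _ , ()

fins : ∀ n → List (Fin n)
fins zero    = []
fins (suc n) = zero ∷ map suc (fins n)

∈-fins : ∀ {n} (i : Fin n) → i ∈ᴸ fins n
∈-fins zero    = here refl
∈-fins (suc i) = there (∈-map⁺ suc (∈-fins i))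

length-fins : ∀ n → length (fins n) ≡ n
length-fins zero    = refl
length-fins (suc n) = cong suc (trans (length-map suc (fins n)) (length-fins n))

∑-fins : ∀ n (f : Fin (suc n) → ℕ) → ∑ (fins (suc n)) f ≡ f zero + ∑ (fins n) (f ∘ suc)
∑-fins n f = cong (f zero +_) (∑-map suc (fins n) f)

-- Subsets

infix 4 _∋_ _⊑_
infixl 6 _∖_

record _∋_ {n} (p : Subset n) (i : Fin n) : Set where
  constructor mem
  field look : lookup p i ≡ true

open _∋_ public

up : ∀ {n a} {p : Subset n} {i} → p ∋ i → (a ∷ p) ∋ suc i
up (mem h) = mem h

down : ∀ {n a} {p : Subset n} {i} → (a ∷ p) ∋ suc i → p ∋ i
down (mem h) = mem h

_⊑_ : ∀ {n} → Subset n → Subset n → Set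
p ⊑ q = ∀ i → p ∋ i → q ∋ i

_∖_ : ∀ {n} → Subset n → Subset n → Subset n
p ∖ q = zipWith (λ a b → a ∧ not b) p q

_≟ˢ_ : ∀ {n} (p q : Subset n) → Dec (p ≡ q)
_≟ˢ_ = ≡-dec Data.Bool._≟_

∅ : ∀ {n} → Subset n
∅ {n} = replicate n false

add : ∀ {n} → Fin n → Subset n → Subset n
add v p = p [ v ]≔ true

del : ∀ {n} → Fin n → Subset n → Subset n
del v p = p [ v ]≔ false

∉∅ : ∀ {n} (i : Fin n) → ¬ ∅ ∋ i
∉∅ i (mem h) with trans (sym h) (lookup-replicate i false)
... | ()

sub : ∀ {n} → Subset n → Subset n → Bool
sub []      []      = true
sub (a ∷ p) (b ∷ q) = (not a ∨ b) ∧ sub p q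

sub⇒⊑ : ∀ {n} (p q : Subset n) → sub p q ≡ true → p ⊑ q
sub⇒⊑ (true ∷ p) (true ∷ q) h zero    _ = mem refl
sub⇒⊑ (a ∷ p)    (b ∷ q)    h (suc i) e = up (sub⇒⊑ p q (proj₂ (∧-true {not a ∨ b} h)) i (down e))

⊑-tail : ∀ {n a b} {p q : Subset n} → (a ∷ p) ⊑ (b ∷ q) → p ⊑ q
⊑-tail h i = down ∘ h (suc i) ∘ up

⊑⇒sub : ∀ {n} (p q : Subset n) → p ⊑ q → sub p q ≡ true
⊑⇒sub []      []      h = refl
⊑⇒sub (a ∷ p) (b ∷ q) h = true-∧ (head a b (look ∘ h zero ∘ mem)) (⊑⇒sub p q (⊑-tail h))
  where head : ∀ a b → (a ≡ true → b ≡ true) → not a ∨ b ≡ true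
        head true  b h = h refl
        head false b h = refl

⊑-trans : ∀ {n} {p q r : Subset n} → p ⊑ q → q ⊑ r → p ⊑ r
⊑-trans f g i = g i ∘ f i

subset-ext : ∀ {n} {p q : Vec Bool n} → (∀ i → lookup p i ≡ lookup q i) → p ≡ q
subset-ext {p = []}    {[]}    h = refl
subset-ext {p = a ∷ p} {b ∷ q} h = cong₂ _∷_ (h zero) (subset-ext (h ∘ suc))

bool-ext : ∀ {a b} → (a ≡ true → b ≡ true) → (b ≡ true → a ≡ true) → a ≡ b
bool-ext {true}  {b}     f g = sym (f refl)
bool-ext {false} {true}  f g = g refl
bool-ext {false} {false} f g = refl

⊑-antisym : ∀ {n} {p q : Subset n} → p ⊑ q → q ⊑ p → p ≡ q
⊑-antisym f g = subset-ext (λ i → bool-ext (look ∘ f i ∘ mem) (look ∘ g i ∘ mem))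

∪-∋ : ∀ {n} (p q : Subset n) {i} → p ∪ q ∋ i → p ∋ i ⊎ q ∋ i
∪-∋ p q {i} (mem h) with lookup p i in eq | lookup q i in eq′
... | true  | _    = inj₁ (mem eq)
... | false | true = inj₂ (mem eq′)
... | false | false = case trans (sym h) (trans (lookup-zipWith _∨_ i p q) (cong₂ _∨_ eq eq′)) of λ ()

∋-∪ˡ : ∀ {n} (p q : Subset n) → p ⊑ p ∪ q
∋-∪ˡ p q i (mem h) = mem (trans (lookup-zipWith _∨_ i p q) (cong (_∨ lookup q i) h))

∋-∪ʳ : ∀ {n} (p q : Subset n) → q ⊑ p ∪ q
∋-∪ʳ p q i (mem h) = mem (trans (lookup-zipWith _∨_ i p q) (trans (cong (lookup p i ∨_) h) (∨-zeroʳ _)))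
  where open import Data.Bool.Properties using (∨-zeroʳ)

∪-⊑ : ∀ {n} {p q r : Subset n} → p ⊑ r → q ⊑ r → p ∪ q ⊑ r
∪-⊑ {p = p} {q} f g i h = [ f i , g i ]′ (∪-∋ p q h)

∩-∋ : ∀ {n} (p q : Subset n) {i} → p ∩ q ∋ i → p ∋ i × q ∋ i
∩-∋ p q {i} (mem h) = let a , b = ∧-true (trans (sym (lookup-zipWith _∧_ i p q)) h) in mem a , mem b

∋-∩ : ∀ {n} (p q : Subset n) {i} → p ∋ i → q ∋ i → p ∩ q ∋ i
∋-∩ p q {i} (mem h) (mem k) = mem (trans (lookup-zipWith _∧_ i p q) (true-∧ h k))

∖-∋ : ∀ {n} (p q : Subset n) {i} → p ∖ q ∋ i → p ∋ i × ¬ q ∋ i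
∖-∋ p q {i} (mem h) = let a , b = ∧-true (trans (sym (lookup-zipWith (λ a b → a ∧ not b) i p q)) h) in
  mem a , λ { (mem k) → case trans (sym b) (cong not k) of λ () }

∋-∖ : ∀ {n} (p q : Subset n) {i} → p ∋ i → ¬ q ∋ i → p ∖ q ∋ i
∋-∖ p q {i} (mem h) k = mem (trans (lookup-zipWith (λ a b → a ∧ not b) i p q) (true-∧ h (cong not (≢true (k ∘ mem)))))

∋-add : ∀ {n} v (p : Subset n) → add v p ∋ v
∋-add v p = mem (lookup∘updateAt v p)

⊑-add : ∀ {n} v (p : Subset n) → p ⊑ add v p
⊑-add v p i h with v Data.Fin.≟ i
... | yes refl = ∋-add v p
... | no  ne   = mem (trans (lookup∘updateAt′ i v (ne ∘ sym) p) (look h))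

add-∋ : ∀ {n} v (p : Subset n) {i} → add v p ∋ i → v ≡ i ⊎ p ∋ i
add-∋ v p {i} h with v Data.Fin.≟ i
... | yes e  = inj₁ e
... | no  ne = inj₂ (mem (trans (sym (lookup∘updateAt′ i v (ne ∘ sym) p)) (look h)))

add-⊑ : ∀ {n} v {p q : Subset n} → q ∋ v → p ⊑ q → add v p ⊑ q
add-⊑ v {p} h f i e with add-∋ v p e
... | inj₁ refl = h
... | inj₂ e′   = f i e′

∌-del : ∀ {n} v (p : Subset n) → ¬ del v p ∋ v
∌-del v p (mem h) = not-both h (lookup∘updateAt v p)

del-∋ : ∀ {n} v (p : Subset n) {i} → del v p ∋ i → v ≢ i × p ∋ i
del-∋ v p {i} h with v Data.Fin.≟ i
... | yes refl = ⊥-elim (∌-del v p h)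
... | no  ne   = ne , mem (trans (sym (lookup∘updateAt′ i v (ne ∘ sym) p)) (look h))

∋-del : ∀ {n} v (p : Subset n) {i} → v ≢ i → p ∋ i → del v p ∋ i
∋-del v p {i} ne (mem h) = mem (trans (lookup∘updateAt′ i v (ne ∘ sym) p) h)

-- Cardinalities

∣∷∣ : ∀ {n} a (p : Subset n) → ∣ a ∷ p ∣ ≡ ⟦ a ⟧ + ∣ p ∣
∣∷∣ true  p = refl
∣∷∣ false p = refl

∣∅∣ : ∀ n → ∣ ∅ {n} ∣ ≡ 0
∣∅∣ zero    = refl
∣∅∣ (suc n) = ∣∅∣ n

∑-∋ : ∀ {n} (p : Subset n) → ∑ (fins n) (λ v → ⟦ lookup p v ⟧) ≡ ∣ p ∣
∑-∋ []      = refl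
∑-∋ {suc n} (a ∷ p) = trans (∑-fins n (λ v → ⟦ lookup (a ∷ p) v ⟧)) (trans (cong (⟦ a ⟧ +_) (∑-∋ p)) (sym (∣∷∣ a p)))

∣add∣ : ∀ {n} v (p : Subset n) → ¬ p ∋ v → ∣ add v p ∣ ≡ suc ∣ p ∣
∣add∣ zero    (true ∷ p)  h = ⊥-elim (h (mem refl))
∣add∣ zero    (false ∷ p) h = refl
∣add∣ (suc v) (true ∷ p)  h = cong suc (∣add∣ v p (h ∘ up))
∣add∣ (suc v) (false ∷ p) h = ∣add∣ v p (h ∘ up)

∣del∣ : ∀ {n} v (p : Subset n) → p ∋ v → suc ∣ del v p ∣ ≡ ∣ p ∣
∣del∣ zero    (true ∷ p)  h = refl
∣del∣ (suc v) (true ∷ p)  h = cong suc (∣del∣ v p (down h))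
∣del∣ (suc v) (false ∷ p) h = ∣del∣ v p (down h)

∣⊑∣ : ∀ {n} (p q : Subset n) → p ⊑ q → ∣ p ∣ ≤ ∣ q ∣
∣⊑∣ [] [] h = z≤n
∣⊑∣ (a ∷ p) (b ∷ q) h = subst₂ _≤_ (sym (∣∷∣ a p)) (sym (∣∷∣ b q)) (+-mono-≤ (⟦⟧-mono (look ∘ h zero ∘ mem)) (∣⊑∣ p q (⊑-tail h)))

⊑-∣≡∣ : ∀ {n} (p q : Subset n) → p ⊑ q → ∣ q ∣ ≤ ∣ p ∣ → p ≡ q
⊑-∣≡∣ [] [] h le = refl
⊑-∣≡∣ (true ∷ p)  (true ∷ q)  h le = cong (true ∷_) (⊑-∣≡∣ p q (⊑-tail h) (≤-pred le))
⊑-∣≡∣ (true ∷ p)  (false ∷ q) h le with h zero (mem refl)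
... | mem ()
⊑-∣≡∣ (false ∷ p) (true ∷ q)  h le = ⊥-elim (1+n≰n (≤-trans le (∣⊑∣ p q (⊑-tail h))))
⊑-∣≡∣ (false ∷ p) (false ∷ q) h le = cong (false ∷_) (⊑-∣≡∣ p q (⊑-tail h) le)

∣∪∩∣ : ∀ {n} (p q : Subset n) → ∣ p ∪ q ∣ + ∣ p ∩ q ∣ ≡ ∣ p ∣ + ∣ q ∣
∣∪∩∣ [] [] = refl
∣∪∩∣ (true ∷ p)  (true ∷ q)  = cong suc (trans (+-suc _ _) (trans (cong suc (∣∪∩∣ p q)) (sym (+-suc ∣ p ∣ _))))
∣∪∩∣ (true ∷ p)  (false ∷ q) = cong suc (∣∪∩∣ p q)
∣∪∩∣ (false ∷ p) (true ∷ q)  = trans (cong suc (∣∪∩∣ p q)) (sym (+-suc ∣ p ∣ _))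
∣∪∩∣ (false ∷ p) (false ∷ q) = ∣∪∩∣ p q

∣∣≡0 : ∀ {n} (p : Subset n) → ∣ p ∣ ≡ 0 → ∀ i → ¬ p ∋ i
∣∣≡0 (false ∷ p) e zero    (mem ())
∣∣≡0 (false ∷ p) e (suc i) h = ∣∣≡0 p e i (down h)

some : ∀ {n} (p : Subset n) → 0 < ∣ p ∣ → ∃ λ i → p ∋ i
some (true ∷ p)  _ = zero , mem refl
some (false ∷ p) h with some p h
... | i , e = suc i , up e

∣∖∣≡0 : ∀ {n} (p q : Subset n) → ∣ p ∖ q ∣ ≡ 0 → p ⊑ q
∣∖∣≡0 p q e i h with lookup q i in eq
... | true  = mem eq
... | false = ⊥-elim (∣∣≡0 (p ∖ q) e i (∋-∖ p q h (λ k → not-both (look k) eq)))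

⊑⇒∣∖∣≡0 : ∀ {n} (p q : Subset n) → p ⊑ q → ∣ p ∖ q ∣ ≡ 0
⊑⇒∣∖∣≡0 p q h with ∣ p ∖ q ∣ in eq
... | zero  = refl
... | suc k with some (p ∖ q) (subst (0 <_) (sym eq) z<s)
... | i , e with ∖-∋ p q e
... | a , b = ⊥-elim (b (h i a))

bigger-has-more : ∀ {n} (p q : Subset n) → ∣ q ∣ < ∣ p ∣ → ∃ λ i → p ∋ i × ¬ q ∋ i
bigger-has-more p q lt with ∣ p ∖ q ∣ in eq
... | zero  = ⊥-elim (<⇒≱ lt (∣⊑∣ p q (∣∖∣≡0 p q eq)))
... | suc k with some (p ∖ q) (subst (0 <_) (sym eq) z<s)
... | i , e = i , ∖-∋ p q e

trim : ∀ {n} k (p : Subset n) → k ≤ ∣ p ∣ → ∃ λ q → q ⊑ p × ∣ q ∣ ≡ k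
trim {n} zero p _ = ∅ , (λ i h → ⊥-elim (∉∅ i h)) , ∣∅∣ n
trim (suc k) (true ∷ p) h with trim k p (≤-pred h)
... | q , s , e = true ∷ q , (λ { zero _ → mem refl ; (suc i) x → up (s i (down x)) }) , cong suc e
trim (suc k) (false ∷ p) h with trim (suc k) p h
... | q , s , e = false ∷ q , (λ { zero (mem ()) ; (suc i) x → up (s i (down x)) }) , e

two : ∀ {n} (p : Subset n) → 2 ≤ ∣ p ∣ → ∃ λ x → ∃ λ y → x ≢ y × p ∋ x × p ∋ y
two p h with some p (<⇒≤ h)
... | x , px with some (del x p) (≤-pred (subst (2 ≤_) (sym (∣del∣ x p px)) h))
... | y , py with del-∋ x p py
... | ne , py′ = x , y , ne , px , py′

card≥2 : ∀ {n} (p : Subset n) {x y} → x ≢ y → p ∋ x → p ∋ y → 2 ≤ ∣ p ∣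
card≥2 p {x} {y} ne px py = subst (2 ≤_) (trans (cong suc (∣del∣ y (del x p) (∋-del x p ne py))) (∣del∣ x p px)) (s≤s (s≤s z≤n))

T⇒≡ : ∀ {b} → Data.Bool.T b → b ≡ true
T⇒≡ {true} _ = refl

≡⇒T : ∀ {b} → b ≡ true → Data.Bool.T b
≡⇒T refl = tt

≡ᵇ-intro : ∀ {a b} → a ≡ b → (a ≡ᵇ b) ≡ true
≡ᵇ-intro {a} {b} e = T⇒≡ (≡⇒≡ᵇ a b e)

≡ᵇ-elim : ∀ {a b} → (a ≡ᵇ b) ≡ true → a ≡ b
≡ᵇ-elim {a} {b} e = ≡ᵇ⇒≡ a b (≡⇒T e)

≤ᵇ-intro : ∀ {a b} → a ≤ b → (a ≤ᵇ b) ≡ true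
≤ᵇ-intro e = T⇒≡ (≤⇒≤ᵇ e)

≤ᵇ-elim : ∀ {a b} → (a ≤ᵇ b) ≡ true → a ≤ b
≤ᵇ-elim {a} {b} e = ≤ᵇ⇒≤ a b (≡⇒T e)

∑≤0 : ∀ {A : Set} (xs : List A) {f : A → ℕ} {c} → (∀ x → f x ≡ 0) → ∑ xs f ≤ c
∑≤0 xs h = ≤-trans (≤-reflexive (trans (∑-cong xs h) (∑-0 xs))) z≤n

⟦⟧-false : ∀ {b} → (b ≡ true → ⊥) → ⟦ b ⟧ ≡ 0
⟦⟧-false {true}  h = ⊥-elim (h refl)
⟦⟧-false {false} h = refl

⟦⟧-true : ∀ {b} → b ≡ true → ⟦ b ⟧ ≡ 1
⟦⟧-true refl = refl

⟦⟧*-false : ∀ {b} c → (b ≡ true → ⊥) → ⟦ b ⟧ * c ≡ 0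
⟦⟧*-false c h = cong (_* c) (⟦⟧-false h)

∧-⟦⟧ : ∀ a b → ⟦ a ∧ b ⟧ ≡ ⟦ a ⟧ * ⟦ b ⟧
∧-⟦⟧ true  b = sym (+-identityʳ _)
∧-⟦⟧ false b = refl

∷-⊑ : ∀ {n a b} {p q : Subset n} → (a ≡ true → b ≡ true) → p ⊑ q → (a ∷ p) ⊑ (b ∷ q)
∷-⊑ h f zero    = mem ∘ h ∘ look
∷-⊑ h f (suc i) = up ∘ f i ∘ down

-- Double counting over all subsets

-- `I ↦ I ∖ e` is injective on the supersets of `e`, so each value of `h` is charged at most once.
sum-remove : ∀ {n} (e : Subset n) (f h : Subset n → ℕ) → (∀ I → e ⊑ I → f I ≤ h (I ∖ e)) →
             ∑ (vecs n) (λ I → ⟦ sub e I ⟧ * f I) ≤ ∑ (vecs n) h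
sum-remove [] f h H = +-monoˡ-≤ 0 (≤-trans (≤-reflexive (+-identityʳ _)) (H [] (λ ())))
sum-remove {suc n} (true ∷ e) f h H rewrite ∑-vecs n h | ∑-vecs n (λ I → ⟦ sub (true ∷ e) I ⟧ * f I) = begin
  ∑ (vecs n) (λ I → ⟦ sub e I ⟧ * f (true ∷ I)) + ∑ (vecs n) (λ I → 0)
    ≡⟨ trans (cong (∑ (vecs n) (λ I → ⟦ sub e I ⟧ * f (true ∷ I)) +_) (∑-0 (vecs n))) (+-identityʳ _) ⟩
  ∑ (vecs n) (λ I → ⟦ sub e I ⟧ * f (true ∷ I))
    ≤⟨ sum-remove e (f ∘ (true ∷_)) (h ∘ (false ∷_)) (λ I s → H (true ∷ I) (∷-⊑ id s)) ⟩
  ∑ (vecs n) (h ∘ (false ∷_)) ≤⟨ m≤n+m _ _ ⟩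
  ∑ (vecs n) (h ∘ (true ∷_)) + ∑ (vecs n) (h ∘ (false ∷_)) ∎
  where open ≤-Reasoning
sum-remove {suc n} (false ∷ e) f h H rewrite ∑-vecs n h | ∑-vecs n (λ I → ⟦ sub (false ∷ e) I ⟧ * f I) =
  +-mono-≤ (sum-remove e _ _ (λ I s → H (true ∷ I) (∷-⊑ (λ _ → refl) s)))
           (sum-remove e _ _ (λ I s → H (false ∷ I) (∷-⊑ id s)))

-- `I ↦ I ∪ e` forgets only the coordinates in `e`, so it is at most `2 ^ ∣ e ∣` to one.
sum-add : ∀ {n} (e : Subset n) (f h : Subset n → ℕ) → (∀ I → f I ≤ h (I ∪ e)) →
          ∑ (vecs n) f ≤ 2 ^ ∣ e ∣ * ∑ (vecs n) h
sum-add [] f h H = ≤-trans (+-monoˡ-≤ 0 (H [])) (≤-reflexive (sym (+-identityʳ _)))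
sum-add {suc n} (true ∷ e) f h H rewrite ∑-vecs n h | ∑-vecs n f = begin
  ∑ (vecs n) (f ∘ (true ∷_)) + ∑ (vecs n) (f ∘ (false ∷_))
    ≤⟨ +-mono-≤ (sum-add e _ (h ∘ (true ∷_)) (λ I → H (true ∷ I)))
                (sum-add e _ (h ∘ (true ∷_)) (λ I → H (false ∷ I))) ⟩
  2 ^ ∣ e ∣ * X + 2 ^ ∣ e ∣ * X ≡⟨ lemma (2 ^ ∣ e ∣) X ⟩
  2 * 2 ^ ∣ e ∣ * X ≤⟨ *-monoʳ-≤ (2 * 2 ^ ∣ e ∣) (m≤m+n X _) ⟩
  2 * 2 ^ ∣ e ∣ * (X + ∑ (vecs n) (h ∘ (false ∷_))) ∎
  where open ≤-Reasoning
        X = ∑ (vecs n) (h ∘ (true ∷_))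
        lemma : ∀ a x → a * x + a * x ≡ 2 * a * x
        lemma = solve-∀
sum-add {suc n} (false ∷ e) f h H rewrite ∑-vecs n h | ∑-vecs n f =
  ≤-trans (+-mono-≤ (sum-add e _ (h ∘ (true ∷_)) (λ I → subst (λ b → f (true ∷ I) ≤ h (b ∷ (I ∪ e))) refl (H (true ∷ I))))
                    (sum-add e _ (h ∘ (false ∷_)) (λ I → H (false ∷ I))))
          (≤-reflexive (sym (*-distribˡ-+ (2 ^ ∣ e ∣) _ _)))

-- For `I` without `v`, the sets `I` and `add v I` are all distinct, so the charges of `f` and of
-- `g` never meet.
sum-insert : ∀ {n} v (f g F : Subset n → ℕ) → (∀ I → ¬ I ∋ v → f I ≤ F I) → (∀ I → ¬ I ∋ v → g I ≤ F (add v I)) →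
             (∀ I → I ∋ v → f I ≡ 0) → (∀ I → I ∋ v → g I ≡ 0) →
             ∑ (vecs n) f + ∑ (vecs n) g ≤ ∑ (vecs n) F
sum-insert {suc n} zero f g F hf hg f0 g0 rewrite ∑-vecs n f | ∑-vecs n g | ∑-vecs n F
  | trans (∑-cong (vecs n) (λ I → f0 (true ∷ I) (mem refl))) (∑-0 (vecs n))
  | trans (∑-cong (vecs n) (λ I → g0 (true ∷ I) (mem refl))) (∑-0 (vecs n)) =
  ≤-trans (+-mono-≤ (∑-mono (vecs n) (λ I → hf (false ∷ I) λ { (mem ()) })) (∑-mono (vecs n) (λ I → hg (false ∷ I) λ { (mem ()) })))
          (≤-reflexive (+-comm (∑ (vecs n) (F ∘ (false ∷_))) _))
sum-insert {suc n} (suc v) f g F hf hg f0 g0 rewrite ∑-vecs n f | ∑-vecs n g | ∑-vecs n F =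
  ≤-trans (≤-reflexive (lemma (∑ (vecs n) (f ∘ (true ∷_))) _ (∑ (vecs n) (g ∘ (true ∷_))) _))
          (+-mono-≤ (half true) (half false))
  where
  lemma : ∀ a b c d → a + b + (c + d) ≡ a + c + (b + d)
  lemma = solve-∀
  half : ∀ b → ∑ (vecs n) (f ∘ (b ∷_)) + ∑ (vecs n) (g ∘ (b ∷_)) ≤ ∑ (vecs n) (F ∘ (b ∷_))
  half b = sum-insert v _ _ _ (λ I h → hf (b ∷ I) (h ∘ down)) (λ I h → hg (b ∷ I) (h ∘ down))
                          (λ I → f0 (b ∷ I) ∘ up) (λ I → g0 (b ∷ I) ∘ up)

-- The form of Pascal's rule that powers satisfy; it carries the induction in both counts below.
suc-^ : ∀ k d → k ^ d + k ^ suc d ≤ suc k ^ suc d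
suc-^ k d = *-monoʳ-≤ (suc k) (^-monoˡ-≤ d (n≤1+n k))

count-subsets : ∀ {n} d (I : Subset n) → ∑ (vecs n) (λ D → ⟦ (∣ D ∣ ≡ᵇ d) ∧ sub D I ⟧) ≤ ∣ I ∣ ^ d
count-subsets zero    [] = ≤-refl
count-subsets (suc d) [] = z≤n
count-subsets {suc n} zero (true ∷ I) rewrite ∑-vecs n (λ D → ⟦ (∣ D ∣ ≡ᵇ 0) ∧ sub D (true ∷ I) ⟧) =
  +-mono-≤ (∑≤0 (vecs n) {c = 0} (λ _ → refl)) (count-subsets 0 I)
count-subsets {suc n} (suc d) (true ∷ I) rewrite ∑-vecs n (λ D → ⟦ (∣ D ∣ ≡ᵇ suc d) ∧ sub D (true ∷ I) ⟧) =
  ≤-trans (+-mono-≤ (count-subsets d I) (count-subsets (suc d) I)) (suc-^ ∣ I ∣ d)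
count-subsets {suc n} d (false ∷ I) rewrite ∑-vecs n (λ D → ⟦ (∣ D ∣ ≡ᵇ d) ∧ sub D (false ∷ I) ⟧) =
  +-mono-≤ (∑≤0 (vecs n) {c = 0} (λ D → ⟦⟧-false (λ h → case proj₂ (∧-true {∣ true ∷ D ∣ ≡ᵇ d} {false} h) of λ ()))) (count-subsets d I)

≤ᵇ-suc : ∀ a b → (suc a ≤ᵇ suc b) ≡ (a ≤ᵇ b)
≤ᵇ-suc zero    b = refl
≤ᵇ-suc (suc a) b = refl

count-small : ∀ n s → ∑ (vecs n) (λ I → ⟦ ∣ I ∣ ≤ᵇ s ⟧) ≤ suc n ^ s
count-small zero    s = ≤-reflexive (sym (^-zeroˡ s))
count-small (suc n) zero rewrite ∑-vecs n (λ I → ⟦ ∣ I ∣ ≤ᵇ 0 ⟧) =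
  +-mono-≤ (∑≤0 (vecs n) {c = 0} (λ _ → refl)) (count-small n 0)
count-small (suc n) (suc s) rewrite ∑-vecs n (λ I → ⟦ ∣ I ∣ ≤ᵇ suc s ⟧) =
  ≤-trans (+-mono-≤ (≤-trans (≤-reflexive (∑-cong (vecs n) (λ I → cong ⟦_⟧ (≤ᵇ-suc ∣ I ∣ s)))) (count-small n s)) (count-small n (suc s)))
          (suc-^ (suc n) s)

∑-2^ : ∀ {n} (p : Subset n) → ∑ (vecs n) (λ D → ⟦ sub D p ⟧) ≡ 2 ^ ∣ p ∣
∑-2^ [] = refl
∑-2^ {suc n} (true ∷ p) rewrite ∑-vecs n (λ D → ⟦ sub D (true ∷ p) ⟧) | ∑-2^ p = cong (2 ^ ∣ p ∣ +_) (sym (+-identityʳ _))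
∑-2^ {suc n} (false ∷ p) rewrite ∑-vecs n (λ D → ⟦ sub D (false ∷ p) ⟧) | ∑-0 (vecs n) = ∑-2^ p

-- v ↦ f ∖ {v} is injective on f.
shadow : ∀ {n} (f I : Subset n) →
         ∑ (fins n) (λ v → ⟦ lookup f v ∧ sub (del v f) I ⟧) ≤
         ∑ (vecs n) (λ D → ⟦ (suc ∣ D ∣ ≡ᵇ ∣ f ∣) ∧ (sub D f ∧ sub D I) ⟧)
shadow [] [] = z≤n
shadow {suc n} (true ∷ f) (c ∷ I)
  rewrite ∑-vecs n (λ D → ⟦ (suc ∣ D ∣ ≡ᵇ suc ∣ f ∣) ∧ (sub D (true ∷ f) ∧ sub D (c ∷ I)) ⟧)
        | ∑-map suc (fins n) (λ v → ⟦ lookup (true ∷ f) v ∧ sub (del v (true ∷ f)) (c ∷ I) ⟧) =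
  ≤-trans (≤-reflexive (+-comm ⟦ sub f I ⟧ _)) (+-mono-≤ (tail c) here′)
  where
  tail : ∀ c → ∑ (fins n) (λ v → ⟦ lookup f v ∧ (c ∧ sub (del v f) I) ⟧) ≤
               ∑ (vecs n) (λ D → ⟦ (suc ∣ D ∣ ≡ᵇ ∣ f ∣) ∧ (sub D f ∧ (c ∧ sub D I)) ⟧)
  tail true  = shadow f I
  tail false = ∑≤0 (fins n) (λ v → ⟦⟧-false {lookup f v ∧ false} (λ h → case proj₂ (∧-true {lookup f v} {false} h) of λ ()))
  here′ : ⟦ sub f I ⟧ ≤ ∑ (vecs n) (λ D → ⟦ (∣ D ∣ ≡ᵇ ∣ f ∣) ∧ (sub D f ∧ sub D I) ⟧)
  here′ = ≤-trans (⟦⟧-mono (λ h → true-∧ (≡ᵇ-intro {∣ f ∣} refl)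
                                         (true-∧ (⊑⇒sub f f (λ i x → x)) h)))
                  (∑-∈ _ (∈-vecs f))
shadow {suc n} (false ∷ f) (c ∷ I)
  rewrite ∑-vecs n (λ D → ⟦ (suc ∣ D ∣ ≡ᵇ ∣ f ∣) ∧ (sub D (false ∷ f) ∧ sub D (c ∷ I)) ⟧)
        | ∑-map suc (fins n) (λ v → ⟦ lookup (false ∷ f) v ∧ sub (del v (false ∷ f)) (c ∷ I) ⟧) =
  ≤-trans (shadow f I) (m≤n+m _ _)

-- Greedy choice of vertices avoiding obstacles

markov : ∀ {A : Set} (xs : List A) (X : A → ℕ) c → ∑ xs (λ x → ⟦ c <ᵇ X x ⟧) * suc c ≤ ∑ xs X
markov xs X c = begin
  ∑ xs (λ x → ⟦ c <ᵇ X x ⟧) * suc c       ≡⟨ *-comm (∑ xs (λ x → ⟦ c <ᵇ X x ⟧)) (suc c) ⟩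
  suc c * ∑ xs (λ x → ⟦ c <ᵇ X x ⟧)       ≡⟨ ∑-* xs (suc c) _ ⟨
  ∑ xs (λ x → suc c * ⟦ c <ᵇ X x ⟧)       ≤⟨ ∑-mono xs (λ x → ≤-trans (≤-reflexive (*-comm (suc c) ⟦ c <ᵇ X x ⟧))
                                                              (when (c <ᵇ X x) (λ h → <ᵇ⇒< c (X x) (≡⇒T h)))) ⟩
  ∑ xs X ∎
  where open ≤-Reasoning

not-above : ∀ {c x} → ⟦ c <ᵇ x ⟧ ≡ 0 → x ≤ c
not-above {c} {x} e with x ≤? c
... | yes p = p
... | no  p with trans (sym e) (cong ⟦_⟧ (T⇒≡ (<⇒<ᵇ (≰⇒> p))))
... | ()

sum-zero : ∀ {a b} → a + b ≡ 0 → a ≡ 0 × b ≡ 0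
sum-zero {zero} {zero} _ = refl , refl

-- Here `a` counts unsuitable vertices, each of weight at least `k` in a total of `S`. Four kinds of
-- unsuitability, each with fewer than `n / 4` vertices, leave a suitable one.
quarter : ∀ {n} a S k → a * k ≤ S → 4 * S < n * k → 4 * a < n
quarter {n} a S k h lt = *-cancelʳ-< _ _ n (begin-strict
  4 * a * k   ≡⟨ *-assoc 4 a k ⟩
  4 * (a * k) ≤⟨ *-monoʳ-≤ 4 h ⟩
  4 * S       <⟨ lt ⟩
  n * k ∎)
  where open ≤-Reasoning

module Potential {n : ℕ} (K μ : ℕ) (Os : List (Subset n)) where

  -- n ^ K times (μ / n) ^ a, the probability that a given vertices are all chosen at density μ / n.
  term : ℕ → ℕ
  term a = μ ^ a * n ^ (K ∸ a)

  weight : Subset n → Subset n → ℕ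
  weight M O = term ∣ O ∖ M ∣

  Φ : Subset n → ℕ
  Φ M = ∑ Os (weight M)

  Free : Subset n → Set
  Free M = ∀ O → O ∈ᴸ Os → ¬ O ⊑ M

  -- Bounds the increase of the weight of `O` from above: the old weight is not subtracted, so no
  -- truncated difference arises.
  gain : Subset n → Fin n → Subset n → ℕ
  gain M v O = ⟦ lookup (O ∖ M) v ⟧ * term (pred ∣ O ∖ M ∣)

  ∖-add-∈ : ∀ (M : Subset n) v (O : Subset n) → O ∖ M ∋ v → suc ∣ O ∖ add v M ∣ ≡ ∣ O ∖ M ∣
  ∖-add-∈ M v O h = trans (cong (λ p → suc ∣ p ∣) eq) (∣del∣ v (O ∖ M) h)
    where
    eq : O ∖ add v M ≡ del v (O ∖ M)
    eq = ⊑-antisym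
      (λ i x → let a , b = ∖-∋ O (add v M) x in
         ∋-del v (O ∖ M) (λ { refl → b (∋-add v M) }) (∋-∖ O M a (b ∘ ⊑-add v M i)))
      (λ i x → let ne , y = del-∋ v (O ∖ M) x ; a , b = ∖-∋ O M y in
         ∋-∖ O (add v M) a (λ k → [ ne , b ]′ (add-∋ v M k)))

  ∖-add-∉ : ∀ (M : Subset n) v (O : Subset n) → ¬ O ∖ M ∋ v → O ∖ add v M ≡ O ∖ M
  ∖-add-∉ M v O h = ⊑-antisym
      (λ i x → let a , b = ∖-∋ O (add v M) x in ∋-∖ O M a (b ∘ ⊑-add v M i))
      (λ i x → let a , b = ∖-∋ O M x in
         ∋-∖ O (add v M) a (λ k → [ (λ { refl → h x }) , b ]′ (add-∋ v M k)))

  weight-add : ∀ (M : Subset n) v (O : Subset n) → weight (add v M) O ≤ weight M O + gain M v O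
  weight-add M v O with lookup (O ∖ M) v in eq
  ... | true  = ≤-trans (≤-reflexive (trans (cong (term ∘ pred) (∖-add-∈ M v O (mem eq))) (sym (+-identityʳ _)))) (m≤n+m _ (weight M O))
  ... | false = ≤-trans (≤-reflexive (cong (λ p → term ∣ p ∣) (∖-add-∉ M v O (λ h → not-both (look h) eq)))) (m≤m+n _ _)

  Φ-add : ∀ M v → Φ (add v M) ≤ Φ M + ∑ Os (gain M v)
  Φ-add M v = ≤-trans (∑-mono Os (weight-add M v)) (≤-reflexive (∑-+ Os _ _))

  bad : Subset n → Fin n → Subset n → ℕ
  bad M v O = ⟦ ∣ O ∖ M ∣ ≡ᵇ 1 ⟧ * ⟦ lookup (O ∖ M) v ⟧

  Free-add : ∀ M v → Free M → ∑ Os (bad M v) ≡ 0 → Free (add v M)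
  Free-add M v free e O O∈ s with lookup (O ∖ M) v in eq
  ... | false = free O O∈ (∣∖∣≡0 O M (trans (sym (cong ∣_∣ (∖-add-∉ M v O (λ h → not-both (look h) eq))))
                                              (⊑⇒∣∖∣≡0 O (add v M) s)))
  ... | true  with trans (sym (∑-zero (bad M v) O∈ e)) one
    where
    one : bad M v O ≡ 1
    one = cong₂ (λ a b → ⟦ a ≡ᵇ 1 ⟧ * ⟦ b ⟧)
            (trans (sym (∖-add-∈ M v O (mem eq))) (cong suc (⊑⇒∣∖∣≡0 O (add v M) s))) eq
  ... | ()

  -- An obstacle that lacks one vertex is bad for that vertex alone, and it contributes `term 1` to
  -- the potential.
  ∑-bad : ∀ M → ∑ (fins n) (λ v → ∑ Os (bad M v)) * term 1 ≤ Φ M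
  ∑-bad M = begin
    ∑ (fins n) (λ v → ∑ Os (bad M v)) * term 1       ≡⟨ cong (_* term 1) (∑-swap (fins n) Os (bad M)) ⟩
    ∑ Os (λ O → ∑ (fins n) (λ v → bad M v O)) * term 1 ≡⟨ *-comm _ (term 1) ⟩
    term 1 * ∑ Os (λ O → ∑ (fins n) (λ v → bad M v O)) ≡⟨ ∑-* Os (term 1) _ ⟨
    ∑ Os (λ O → term 1 * ∑ (fins n) (λ v → bad M v O)) ≤⟨ ∑-mono Os each ⟩
    Φ M ∎
    where
    open ≤-Reasoning
    each : ∀ O → term 1 * ∑ (fins n) (λ v → bad M v O) ≤ weight M O
    each O rewrite ∑-* (fins n) ⟦ ∣ O ∖ M ∣ ≡ᵇ 1 ⟧ (λ v → ⟦ lookup (O ∖ M) v ⟧) | ∑-∋ (O ∖ M) =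
      ≤-trans (≤-reflexive (*-comm (term 1) _)) (≤-trans (≤-reflexive (*-assoc ⟦ ∣ O ∖ M ∣ ≡ᵇ 1 ⟧ _ _))
        (when (∣ O ∖ M ∣ ≡ᵇ 1) (λ h → subst (λ a → a * term 1 ≤ term a) (sym (≡ᵇ-elim {∣ O ∖ M ∣} {1} h)) (≤-reflexive (+-identityʳ _)))))

  module _ (small : ∀ O → O ∈ᴸ Os → ∣ O ∣ ≤ K) where

    -- Gaining a vertex replaces one factor `μ` of the weight by `n`, and an obstacle has at most
    -- `K` missing vertices at which this can happen. The factor `μ` on the left clears the quotient
    -- `n / μ`.
    ∑-gain : ∀ M → ∑ (fins n) (λ v → μ * ∑ Os (gain M v)) ≤ K * n * Φ M
    ∑-gain M = begin
      ∑ (fins n) (λ v → μ * ∑ Os (gain M v))           ≡⟨ ∑-* (fins n) μ _ ⟩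
      μ * ∑ (fins n) (λ v → ∑ Os (gain M v))           ≡⟨ cong (μ *_) (∑-swap (fins n) Os (gain M)) ⟩
      μ * ∑ Os (λ O → ∑ (fins n) (λ v → gain M v O))   ≡⟨ ∑-* Os μ _ ⟨
      ∑ Os (λ O → μ * ∑ (fins n) (λ v → gain M v O))   ≤⟨ ∑-mono∈ Os each ⟩
      ∑ Os (λ O → K * n * weight M O)                  ≡⟨ ∑-* Os (K * n) _ ⟩
      K * n * Φ M ∎
      where
      open ≤-Reasoning
      powers : ∀ a → a ≤ K → μ * (term (pred a) * a) ≤ K * n * term a
      powers zero    _ = ≤-trans (≤-reflexive (trans (cong (μ *_) (*-zeroʳ (term 0))) (*-zeroʳ μ))) z≤n
      powers (suc a) h = begin
        μ * (μ ^ a * n ^ (K ∸ a) * suc a)               ≤⟨ *-monoʳ-≤ μ (*-monoʳ-≤ (μ ^ a * n ^ (K ∸ a)) h) ⟩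
        μ * (μ ^ a * n ^ (K ∸ a) * K)                   ≡⟨ cong (λ z → μ * (μ ^ a * n ^ z * K)) (sym (suc-pred-∸ K a h)) ⟩
        μ * (μ ^ a * (n * n ^ (K ∸ suc a)) * K)         ≡⟨ lemma μ (μ ^ a) n (n ^ (K ∸ suc a)) K ⟩
        K * n * (μ * μ ^ a * n ^ (K ∸ suc a)) ∎
        where
        lemma : ∀ μ p n q K → μ * (p * (n * q) * K) ≡ K * n * (μ * p * q)
        lemma = solve-∀
        suc-pred-∸ : ∀ K a → a < K → suc (K ∸ suc a) ≡ K ∸ a
        suc-pred-∸ (suc K) zero    _ = refl
        suc-pred-∸ (suc K) (suc a) h = suc-pred-∸ K a (≤-pred h)
      each : ∀ O → O ∈ᴸ Os → μ * ∑ (fins n) (λ v → gain M v O) ≤ K * n * weight M O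
      each O O∈ = begin
        μ * ∑ (fins n) (λ v → gain M v O) ≡⟨ cong (μ *_) (∑-cong (fins n) (λ v → *-comm ⟦ lookup (O ∖ M) v ⟧ _)) ⟩
        μ * ∑ (fins n) (λ v → term (pred ∣ O ∖ M ∣) * ⟦ lookup (O ∖ M) v ⟧)
          ≡⟨ cong (μ *_) (trans (∑-* (fins n) (term (pred ∣ O ∖ M ∣)) _) (cong (term (pred ∣ O ∖ M ∣) *_) (∑-∋ (O ∖ M)))) ⟩
        μ * (term (pred ∣ O ∖ M ∣) * ∣ O ∖ M ∣)
          ≤⟨ powers ∣ O ∖ M ∣ (≤-trans (∣⊑∣ (O ∖ M) O (λ i → proj₁ ∘ ∖-∋ O M)) (small O O∈)) ⟩
        K * n * weight M O ∎

    -- Each of four demands on `v` fails for fewer than `n / 4` vertices: to lie outside `M`, to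
    -- complete no obstacle, to raise the potential by at most four times the bound for the average,
    -- and to keep `X v` small. The failures summed over all `v` therefore number fewer than `n`.
    extend : ∀ M B (X : Fin n → ℕ) c → Free M → Φ M ≤ B → 4 * ∣ M ∣ < n → 4 * B < n * term 1 →
             4 * ∑ (fins n) X < n * suc c →
             ∃ λ v → ¬ M ∋ v × X v ≤ c × Free (add v M) × μ * Φ (add v M) ≤ μ * Φ M + 4 * K * B
    extend M B X c free ΦM≤B M-small B-small X-small =
      let v , _ , e = below-average (fins n) f ∑f<n
          e₁ , e₂ = sum-zero e
          e₃ , e₄ = sum-zero e₂
          e₅ , e₆ = sum-zero {⟦ 4 * K * B <ᵇ μ * ∑ Os (gain M v) ⟧} e₄
      in v , (λ h → case trans (sym (cong ⟦_⟧ (look h))) e₁ of λ ()) , not-above e₆ , Free-add M v free e₃ ,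
         (begin
          μ * Φ (add v M) ≤⟨ *-monoʳ-≤ μ (Φ-add M v) ⟩
          μ * (Φ M + ∑ Os (gain M v)) ≡⟨ *-distribˡ-+ μ (Φ M) _ ⟩
          μ * Φ M + μ * ∑ Os (gain M v) ≤⟨ +-monoʳ-≤ (μ * Φ M) (not-above e₅) ⟩
          μ * Φ M + 4 * K * B ∎)
      where
      open ≤-Reasoning
      g₁ g₂ g₃ g₄ f : Fin n → ℕ
      g₁ v = ⟦ lookup M v ⟧
      g₂ v = ∑ Os (bad M v)
      g₃ v = ⟦ 4 * K * B <ᵇ μ * ∑ Os (gain M v) ⟧
      g₄ v = ⟦ c <ᵇ X v ⟧
      f v = g₁ v + (g₂ v + (g₃ v + g₄ v))
      n>0 : 0 < n
      n>0 = ≤-<-trans z≤n M-small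
      c₂ : 4 * ∑ (fins n) g₂ < n
      c₂ = quarter (∑ (fins n) g₂) B (term 1) (≤-trans (∑-bad M) ΦM≤B) B-small
      c₃ : 4 * ∑ (fins n) g₃ < n
      c₃ = quarter (∑ (fins n) g₃) (K * n * B) (suc (4 * K * B))
             (≤-trans (markov (fins n) _ (4 * K * B)) (≤-trans (∑-gain M) (*-monoʳ-≤ (K * n) ΦM≤B)))
             (≤-trans (s≤s (≤-reflexive (lemma K n B))) (subst (_< n * suc (4 * K * B)) refl
               (*-monoʳ-< n {{>-nonZero n>0}} (n<1+n (4 * K * B)))))
        where lemma : ∀ K n B → 4 * (K * n * B) ≡ n * (4 * K * B)
              lemma = solve-∀
      c₄ : 4 * ∑ (fins n) g₄ < n
      c₄ = quarter (∑ (fins n) g₄) (∑ (fins n) X) (suc c) (markov (fins n) X c) X-small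
      ∑f<n : ∑ (fins n) f < length (fins n)
      ∑f<n = *-cancelˡ-< 4 _ _ (begin-strict
        4 * ∑ (fins n) f ≡⟨ cong (4 *_) (trans (∑-+ (fins n) g₁ _) (cong₂ _+_ (∑-∋ M)
                              (trans (∑-+ (fins n) g₂ _) (cong (∑ (fins n) g₂ +_) (∑-+ (fins n) g₃ g₄))))) ⟩
        4 * (∣ M ∣ + (∑ (fins n) g₂ + (∑ (fins n) g₃ + ∑ (fins n) g₄)))
          ≡⟨ lemma ∣ M ∣ (∑ (fins n) g₂) (∑ (fins n) g₃) (∑ (fins n) g₄) ⟩
        4 * ∣ M ∣ + (4 * ∑ (fins n) g₂ + (4 * ∑ (fins n) g₃ + 4 * ∑ (fins n) g₄))
          <⟨ +-mono-<-≤ M-small (+-mono-≤ (<⇒≤ c₂) (+-mono-≤ (<⇒≤ c₃) (<⇒≤ c₄))) ⟩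
        n + (n + (n + n)) ≡⟨ lemma′ n ⟩
        4 * n ≡⟨ cong (4 *_) (length-fins n) ⟨
        4 * length (fins n) ∎)
        where lemma : ∀ a b c d → 4 * (a + (b + (c + d))) ≡ 4 * a + (4 * b + (4 * c + 4 * d))
              lemma = solve-∀
              lemma′ : ∀ n → n + (n + (n + n)) ≡ 4 * n
              lemma′ = solve-∀

-- Growth of the number of independent sets

not-⊑ : ∀ {n} (p q : Subset n) → ¬ p ⊑ q → ∃ λ i → p ∋ i × ¬ q ∋ i
not-⊑ p q h with ∣ p ∖ q ∣ in eq
... | zero  = ⊥-elim (h (∣∖∣≡0 p q eq))
... | suc k with some (p ∖ q) (subst (0 <_) (sym eq) z<s)
... | i , e = i , ∖-∋ p q e

∖-∪ : ∀ {n} (I e : Subset n) → e ⊑ I → (I ∖ e) ∪ e ≡ I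
∖-∪ I e h = ⊑-antisym (∪-⊑ (λ i → proj₁ ∘ ∖-∋ I e) h) back
  where
  back : I ⊑ (I ∖ e) ∪ e
  back i x with lookup e i in eq
  ... | true  = ∋-∪ʳ (I ∖ e) e i (mem eq)
  ... | false = ∋-∪ˡ (I ∖ e) e i (∋-∖ I e x (λ y → not-both (look y) eq))

∈-select⁺ : ∀ {A : Set} (P : A → Bool) {xs x} → x ∈ᴸ xs → P x ≡ true → x ∈ᴸ select P xs
∈-select⁺ P = ∈-filter⁺ (λ x → P x Data.Bool.≟ true)

∈-select⁻ : ∀ {A : Set} (P : A → Bool) {xs x} → x ∈ᴸ select P xs → x ∈ᴸ xs × P x ≡ true
∈-select⁻ P {xs} = ∈-filter⁻ (λ x → P x Data.Bool.≟ true) {xs = xs}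

module Growth {n : ℕ} (E : Subset n → Bool) where

  edges-in : Subset n → ℕ
  edges-in I = ∑ (vecs n) (λ f → ⟦ E f ∧ sub f I ⟧)

  ind : Subset n → Bool
  ind I = edges-in I ≡ᵇ 0

  ind-elim : ∀ I f → ind I ≡ true → E f ≡ true → f ⊑ I → ⊥
  ind-elim I f i e s with trans (sym (∑-zero (λ f → ⟦ E f ∧ sub f I ⟧) (∈-vecs f) (≡ᵇ-elim {edges-in I} i)))
                               (⟦⟧-true (true-∧ e (⊑⇒sub f I s)))
  ... | ()

  ind-intro : ∀ I → (∀ f → E f ≡ true → f ⊑ I → ⊥) → ind I ≡ true
  ind-intro I h = ≡ᵇ-intro {edges-in I} (trans (∑-cong (vecs n) (λ f → ⟦⟧-false (λ x →
    let a , b = ∧-true x in h f a (sub⇒⊑ f I b)))) (∑-0 (vecs n)))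

  ind-mono : ∀ I J → I ⊑ J → ind J ≡ true → ind I ≡ true
  ind-mono I J s i = ind-intro I (λ f e t → ind-elim J f i e (⊑-trans t s))

  A : Subset n → Subset n → Bool
  A M I = sub I M ∧ ind I

  Z : Subset n → ℕ
  Z M = ∑ (vecs n) (λ I → ⟦ A M I ⟧)

  -- Counts pairs of an independent `I ⊑ M` and an edge at `v` whose other vertices all lie in `I`;
  -- such an edge prevents `v` from joining `I`.
  X : Subset n → Fin n → ℕ
  X M v = ∑ (vecs n) (λ I → ⟦ A M I ⟧ * ∑ (vecs n) (λ f → ⟦ E f ∧ (lookup f v ∧ sub (del v f) I) ⟧))

  module _ {d C s : ℕ} (size : ∀ f → E f ≡ true → ∣ f ∣ ≡ suc d)
           (codegree : ∀ D → ∣ D ∣ ≡ d → ∑ (vecs n) (λ f → ⟦ E f ∧ sub D f ⟧) ≤ C) where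

    -- A link inside `I` is a `d`-subset of `I`, of which there are at most `∣ I ∣ ^ d`, and the
    -- codegree bounds the edges that it comes from. The parameter `s` bounds this power and not the
    -- size of `I`.
    ∑-X : ∀ M → (∀ I → I ⊑ M → ind I ≡ true → ∣ I ∣ ^ d ≤ s) → ∑ (fins n) (X M) ≤ C * s * Z M
    ∑-X M bound = begin
      ∑ (fins n) (X M) ≡⟨ ∑-swap (fins n) (vecs n) (λ v I → ⟦ A M I ⟧ * k v I) ⟩
      ∑ (vecs n) (λ I → ∑ (fins n) (λ v → ⟦ A M I ⟧ * k v I)) ≤⟨ ∑-mono (vecs n) each ⟩
      ∑ (vecs n) (λ I → C * s * ⟦ A M I ⟧) ≡⟨ ∑-* (vecs n) (C * s) _ ⟩
      C * s * Z M ∎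
      where
      open ≤-Reasoning
      k : Fin n → Subset n → ℕ
      k v I = ∑ (vecs n) (λ f → ⟦ E f ∧ (lookup f v ∧ sub (del v f) I) ⟧)
      links : ∀ I → ∑ (fins n) (λ v → k v I) ≤ C * ∣ I ∣ ^ d
      links I = begin
        ∑ (fins n) (λ v → k v I)
          ≡⟨ ∑-swap (fins n) (vecs n) (λ v f → ⟦ E f ∧ (lookup f v ∧ sub (del v f) I) ⟧) ⟩
        ∑ (vecs n) (λ f → ∑ (fins n) (λ v → ⟦ E f ∧ (lookup f v ∧ sub (del v f) I) ⟧))
          ≡⟨ ∑-cong (vecs n) (λ f → trans (∑-cong (fins n) (λ v → ∧-⟦⟧ (E f) _)) (∑-* (fins n) ⟦ E f ⟧ _)) ⟩
        ∑ (vecs n) (λ f → ⟦ E f ⟧ * ∑ (fins n) (λ v → ⟦ lookup f v ∧ sub (del v f) I ⟧))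
          ≤⟨ ∑-mono (vecs n) (λ f → when (E f) (λ e → ≤-trans (shadow f I) (≤-trans (∑-mono (vecs n) (pointwise f e))
               (≤-reflexive (∑-cong (vecs n) (λ D → sym (⟦⟧* _ e))))))) ⟩
        ∑ (vecs n) (λ f → ∑ (vecs n) (λ D → ⟦ E f ⟧ * (⟦ (∣ D ∣ ≡ᵇ d) ∧ sub D I ⟧ * ⟦ E f ∧ sub D f ⟧)))
          ≡⟨ ∑-swap (vecs n) (vecs n) _ ⟩
        ∑ (vecs n) (λ D → ∑ (vecs n) (λ f → ⟦ E f ⟧ * (⟦ (∣ D ∣ ≡ᵇ d) ∧ sub D I ⟧ * ⟦ E f ∧ sub D f ⟧)))
          ≤⟨ ∑-mono (vecs n) perD ⟩
        ∑ (vecs n) (λ D → C * ⟦ (∣ D ∣ ≡ᵇ d) ∧ sub D I ⟧)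
          ≡⟨ ∑-* (vecs n) C _ ⟩
        C * ∑ (vecs n) (λ D → ⟦ (∣ D ∣ ≡ᵇ d) ∧ sub D I ⟧) ≤⟨ *-monoʳ-≤ C (count-subsets d I) ⟩
        C * ∣ I ∣ ^ d ∎
        where
        pointwise : ∀ f → E f ≡ true → ∀ D → ⟦ (suc ∣ D ∣ ≡ᵇ ∣ f ∣) ∧ (sub D f ∧ sub D I) ⟧ ≤
                    ⟦ (∣ D ∣ ≡ᵇ d) ∧ sub D I ⟧ * ⟦ E f ∧ sub D f ⟧
        pointwise f e D = ≤-trans (⟦⟧-mono {b = ((∣ D ∣ ≡ᵇ d) ∧ sub D I) ∧ (E f ∧ sub D f)} (λ h →
            let a , b = ∧-true {suc ∣ D ∣ ≡ᵇ ∣ f ∣} h ; c , c′ = ∧-true b in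
            true-∧ (true-∧ (≡ᵇ-intro {∣ D ∣} (suc-injective (trans (≡ᵇ-elim {suc ∣ D ∣} a) (size f e)))) c′) (true-∧ e c)))
          (≤-reflexive (∧-⟦⟧ ((∣ D ∣ ≡ᵇ d) ∧ sub D I) _))
        perD : ∀ D → ∑ (vecs n) (λ f → ⟦ E f ⟧ * (⟦ (∣ D ∣ ≡ᵇ d) ∧ sub D I ⟧ * ⟦ E f ∧ sub D f ⟧)) ≤
                     C * ⟦ (∣ D ∣ ≡ᵇ d) ∧ sub D I ⟧
        perD D = ≤-trans (∑-mono (vecs n) (λ f → ≤-trans (*-monoˡ-≤ _ (⟦⟧≤1 (E f))) (≤-reflexive (+-identityʳ _))))
          (≤-trans (≤-reflexive (∑-* (vecs n) ⟦ (∣ D ∣ ≡ᵇ d) ∧ sub D I ⟧ _))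
            (≤-trans (when ((∣ D ∣ ≡ᵇ d) ∧ sub D I) {g = C * ⟦ (∣ D ∣ ≡ᵇ d) ∧ sub D I ⟧} (λ h →
                ≤-trans (codegree D (≡ᵇ-elim {∣ D ∣} (proj₁ (∧-true h))))
                        (≤-reflexive (sym (trans (cong (C *_) (⟦⟧-true h)) (*-identityʳ C))))))
              ≤-refl))
      each : ∀ I → ∑ (fins n) (λ v → ⟦ A M I ⟧ * k v I) ≤ C * s * ⟦ A M I ⟧
      each I = ≤-trans (≤-reflexive (∑-* (fins n) ⟦ A M I ⟧ _)) (when (A M I) (λ h →
        let a , b = ∧-true h in
        ≤-trans (links I) (≤-trans (*-monoʳ-≤ C (bound I (sub⇒⊑ I M a) b))
          (≤-reflexive (sym (trans (cong (C * s *_) (⟦⟧-true h)) (*-identityʳ (C * s))))))))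

  Linear : Subset n → Set
  Linear M = ∀ f g → E f ≡ true → E g ≡ true → f ⊑ M → g ⊑ M →
             ∀ x y → x ≢ y → f ∋ x → f ∋ y → g ∋ x → g ∋ y → f ≡ g

  TriangleFree : Subset n → Set
  TriangleFree M = ∀ f g h → E f ≡ true → E g ≡ true → E h ≡ true → f ⊑ M → g ⊑ M → h ⊑ M →
    f ≢ g → g ≢ h → f ≢ h → ∀ x y z → x ≢ y → y ≢ z → x ≢ z →
    f ∋ x → g ∋ x → g ∋ y → h ∋ y → f ∋ z → h ∋ z → ⊥

  -- The uniformity is written `suc (suc d)`, so that links have `suc d` elements and none is empty.
  module Step {d : ℕ} (size : ∀ f → E f ≡ true → ∣ f ∣ ≡ suc (suc d)) (j : ℕ)
              (M : Subset n) (v : Fin n) (v∉M : ¬ M ∋ v)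
              (linear : Linear (add v M)) (triangle-free : TriangleFree (add v M)) where

    isLink : Subset n → Bool
    isLink f = E f ∧ (lookup f v ∧ sub f (add v M))

    L : List (Subset n)
    L = select isLink (vecs n)

    link : Subset n → Subset n
    link f = del v f

    -- A link is free for `I` if `I` stays an independent subset of `M` after receiving it. Links
    -- contained in an independent `I` are free; `g` counts the free links, `full` the contained
    -- ones.
    fr : Subset n → Subset n → Bool
    fr f I = A M (I ∪ link f)

    g : Subset n → ℕ
    g I = ∑ L (λ f → ⟦ fr f I ⟧)

    full : Subset n → ℕ
    full I = ∑ L (λ f → ⟦ sub (link f) I ⟧)

    G : Subset n → Bool
    G I = g I <ᵇ j

    L-edge : ∀ {f} → f ∈ᴸ L → E f ≡ true
    L-edge m = proj₁ (∧-true (proj₂ (∈-select⁻ isLink {vecs n} m)))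

    L-v : ∀ {f} → f ∈ᴸ L → f ∋ v
    L-v {f} m = mem (proj₁ (∧-true {lookup f v} (proj₂ (∧-true {E f} (proj₂ (∈-select⁻ isLink {vecs n} m))))))

    L-sub : ∀ {f} → f ∈ᴸ L → f ⊑ add v M
    L-sub {f} m = sub⇒⊑ f _ (proj₂ (∧-true {lookup f v} (proj₂ (∧-true {E f} (proj₂ (∈-select⁻ isLink {vecs n} m))))))

    link⊑M : ∀ {f} → f ∈ᴸ L → link f ⊑ M
    link⊑M {f} m i h with del-∋ v f h
    ... | ne , h′ = [ ⊥-elim ∘ ne , id ]′ (add-∋ v M (L-sub m i h′))

    disjoint : ∀ {f f′} → f ∈ᴸ L → f′ ∈ᴸ L → f ≢ f′ → ∀ i → link f ∋ i → ¬ link f′ ∋ i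
    disjoint {f} {f′} m m′ ne i h h′ with del-∋ v f h | del-∋ v f′ h′
    ... | v≢i , a | _ , b =
      ne (linear f f′ (L-edge m) (L-edge m′) (L-sub m) (L-sub m′) v i v≢i (L-v m) a (L-v m′) b)

    A-parts : ∀ {M I} → A M I ≡ true → I ⊑ M × ind I ≡ true
    A-parts {M} {I} h = let a , b = ∧-true h in sub⇒⊑ I M a , b

    A-mono : ∀ I J → I ⊑ J → A M J ≡ true → A M I ≡ true
    A-mono I J s h = let a , b = A-parts {M} {J} h in
      true-∧ (⊑⇒sub I M (⊑-trans s a)) (ind-mono I J s b)

    module _ {I f} (A-I : A M I ≡ true) (f∈L : f ∈ᴸ L) (f⊑I : link f ⊑ I) where

      I⁻ : Subset n
      I⁻ = I ∖ link f

      I⁻⊑I : I⁻ ⊑ I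
      I⁻⊑I i = proj₁ ∘ ∖-∋ I (link f)

      fr-self : fr f I ≡ true
      fr-self = subst (λ J → A M J ≡ true) (⊑-antisym (∋-∪ˡ I (link f)) (∪-⊑ (λ i x → x) f⊑I)) A-I

      fr-self⁻ : fr f I⁻ ≡ true
      fr-self⁻ = subst (λ J → A M J ≡ true) (sym (∖-∪ I (link f) f⊑I)) A-I

      -- An edge inside I ∪ link f′ that is not inside I⁻ ∪ link f′ would form a triangle with f and f′.
      fr-other : ∀ {f′} → f′ ∈ᴸ L → f′ ≢ f → fr f′ I⁻ ≡ fr f′ I
      fr-other {f′} m ne = bool-ext forth
        (A-mono _ _ (∪-⊑ (⊑-trans I⁻⊑I (∋-∪ˡ I (link f′))) (∋-∪ʳ I (link f′))))
        where
        forth : fr f′ I⁻ ≡ true → fr f′ I ≡ true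
        forth a = true-∧ (⊑⇒sub (I ∪ link f′) M J⊑M) (ind-intro _ no-edge)
          where
          J⊑M : I ∪ link f′ ⊑ M
          J⊑M = ∪-⊑ (proj₁ (A-parts {M} {I} A-I)) (link⊑M m)
          no-edge : ∀ h → E h ≡ true → h ⊑ I ∪ link f′ → ⊥
          no-edge h Eh s
            with not-⊑ h I (ind-elim I h (proj₂ (A-parts {M} {I} A-I)) Eh)
               | not-⊑ h (I⁻ ∪ link f′) (ind-elim _ h (proj₂ (A-parts {M} {I⁻ ∪ link f′} a)) Eh)
          ... | x , hx , x∉I | y , hy , y∉ =
            triangle-free f f′ h (L-edge f∈L) (L-edge m) Eh (L-sub f∈L) (L-sub m) (⊑-trans h⊑M (⊑-add v M))
              (ne ∘ sym) (h-new m) (h-new f∈L) v x y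
              (v≢ hx) (λ { refl → x∉I y∈I }) (v≢ hy)
              (L-v f∈L) (L-v m) (proj₂ (del-∋ v f′ x∈f′)) hx (proj₂ (del-∋ v f y∈f)) hy
            where
            h⊑M : h ⊑ M
            h⊑M = ⊑-trans s J⊑M
            v≢ : ∀ {i} → h ∋ i → v ≢ i
            v≢ hi refl = v∉M (h⊑M v hi)
            h-new : ∀ {e} → e ∈ᴸ L → e ≢ h
            h-new m refl = v≢ (L-v m) refl
            x∈f′ : link f′ ∋ x
            x∈f′ = [ ⊥-elim ∘ x∉I , id ]′ (∪-∋ I (link f′) (s x hx))
            y∈I : I ∋ y
            y∈I = [ id , ⊥-elim ∘ y∉ ∘ ∋-∪ʳ I⁻ (link f′) y ]′ (∪-∋ I (link f′) (s y hy))
            y∈f : link f ∋ y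
            y∈f with lookup (link f) y in eq
            ... | true  = mem eq
            ... | false = ⊥-elim (y∉ (∋-∪ˡ I⁻ (link f′) y (∋-∖ I (link f) y∈I (λ z → not-both (look z) eq))))

      -- This invariance lets the cap `g I < j` survive while the contained links are removed one
      -- after the other.
      g-same : g I⁻ ≡ g I
      g-same = ≤-antisym (∑-mono∈ L (λ f′ m → ≤-reflexive (cong ⟦_⟧ (same f′ m))))
                         (∑-mono∈ L (λ f′ m → ≤-reflexive (cong ⟦_⟧ (sym (same f′ m)))))
        where
        same : ∀ f′ → f′ ∈ᴸ L → fr f′ I⁻ ≡ fr f′ I
        same f′ m with f′ ≟ˢ f
        ... | yes refl = trans fr-self⁻ (sym fr-self)
        ... | no ne    = fr-other m ne

      sub-other : ∀ {f′} → f′ ∈ᴸ L → f′ ≢ f → sub (link f′) I⁻ ≡ sub (link f′) I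
      sub-other {f′} m ne = bool-ext (λ h → ⊑⇒sub (link f′) I (⊑-trans (sub⇒⊑ (link f′) I⁻ h) I⁻⊑I))
        (λ h → ⊑⇒sub (link f′) I⁻ (λ i x → ∋-∖ I (link f) (sub⇒⊑ (link f′) I h i x) (disjoint m f∈L ne i x)))

    -- Interpolates between the independent sets with fewer than `j` free links, at `[]`, and a
    -- weight at `L` that lives on sets containing no link at all and is at most `2 ^ g I` there.
    T : List (Subset n) → Subset n → ℕ
    T []      I = ⟦ A M I ∧ G I ⟧
    T (f ∷ Q) I = ⟦ not (sub (link f) I) ⟧ * (2 ^ ⟦ fr f I ⟧ * T Q I)

    T-zero : ∀ Q {I} → A M I ≡ false → T Q I ≡ 0
    T-zero [] {I} e = cong (λ a → ⟦ a ∧ G I ⟧) e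
    T-zero (f ∷ Q) {I} e rewrite T-zero Q {I} e | *-zeroʳ (2 ^ ⟦ fr f I ⟧) = *-zeroʳ ⟦ not (sub (link f) I) ⟧

    T-same : ∀ {I f} Q (a : A M I ≡ true) (m : f ∈ᴸ L) (s : link f ⊑ I) → (∀ {f′} → f′ ∈ᴸ Q → f′ ∈ᴸ L × f′ ≢ f) →
             T Q (I ∖ link f) ≡ T Q I
    T-same {I} {f} [] a m s sep = cong ⟦_⟧ (cong₂ _∧_
      (trans (A-mono _ I (I⁻⊑I {I} {f} a m s) a) (sym a)) (cong (_<ᵇ j) (g-same {I} {f} a m s)))
    T-same {I} {f} (f′ ∷ Q) a m s sep = cong₂ (λ b c → ⟦ not b ⟧ * c)
      (sub-other {I} {f} a m s (proj₁ (sep (here refl))) (proj₂ (sep (here refl))))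
      (cong₂ (λ b c → 2 ^ ⟦ b ⟧ * c) (fr-other {I} {f} a m s (proj₁ (sep (here refl))) (proj₂ (sep (here refl))))
             (T-same {I} {f} Q a m s (sep ∘ there)))

    -- I ↦ I ∖ link f is injective on the sets containing link f, and link f is free in the image:
    -- the factor 2 that T (f ∷ Q) has there pays for the sets removed.
    T-step : ∀ f Q → f ∈ᴸ L → (∀ {f′} → f′ ∈ᴸ Q → f′ ∈ᴸ L × f′ ≢ f) → ∑ (vecs n) (T Q) ≤ ∑ (vecs n) (T (f ∷ Q))
    T-step f Q m sep = begin
      ∑ (vecs n) (T Q)
        ≡⟨ trans (∑-cong (vecs n) split) (∑-+ (vecs n) _ _) ⟩
      ∑ (vecs n) (λ I → ⟦ not (sub (link f) I) ⟧ * T Q I) + ∑ (vecs n) (λ I → ⟦ sub (link f) I ⟧ * T Q I)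
        ≤⟨ +-monoʳ-≤ (∑ (vecs n) (λ I → ⟦ not (sub (link f) I) ⟧ * T Q I)) (sum-remove (link f) (T Q) H moved) ⟩
      ∑ (vecs n) (λ I → ⟦ not (sub (link f) I) ⟧ * T Q I) + ∑ (vecs n) H
        ≡⟨ trans (sym (∑-+ (vecs n) _ _)) (∑-cong (vecs n) join) ⟩
      ∑ (vecs n) (T (f ∷ Q)) ∎
      where
      open ≤-Reasoning
      H : Subset n → ℕ
      H I = ⟦ not (sub (link f) I) ⟧ * (⟦ fr f I ⟧ * T Q I)
      split : ∀ I → T Q I ≡ ⟦ not (sub (link f) I) ⟧ * T Q I + ⟦ sub (link f) I ⟧ * T Q I
      split I with sub (link f) I
      ... | true  = sym (+-identityʳ _)
      ... | false = sym (trans (+-identityʳ _) (+-identityʳ _))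
      join : ∀ I → ⟦ not (sub (link f) I) ⟧ * T Q I + H I ≡ T (f ∷ Q) I
      join I = trans (sym (*-distribˡ-+ ⟦ not (sub (link f) I) ⟧ (T Q I) _))
                     (cong (⟦ not (sub (link f) I) ⟧ *_) (pow (fr f I)))
        where pow : ∀ b → T Q I + ⟦ b ⟧ * T Q I ≡ 2 ^ ⟦ b ⟧ * T Q I
              pow true  = refl
              pow false = refl
      moved : ∀ I → link f ⊑ I → T Q I ≤ H (I ∖ link f)
      moved I s with A M I in eq
      ... | false = ≤-trans (≤-reflexive (T-zero Q {I} eq)) z≤n
      ... | true  = ≤-reflexive (sym (trans (⟦⟧* _ (cong not not-sub))
                      (trans (⟦⟧* _ (fr-self⁻ {I} {f} eq m s)) (T-same {I} {f} Q eq m s sep))))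
        where
        not-sub : sub (link f) (I ∖ link f) ≡ false
        not-sub = ≢true (λ h →
          let i , x = some (link f) (subst (0 <_) (sym (suc-injective (trans (∣del∣ v f (L-v m)) (size f (L-edge m))))) z<s)
          in proj₂ (∖-∋ I (link f) (sub⇒⊑ (link f) _ h i x)) x)

    T-all : ∀ Q → Unique Q → (∀ {f} → f ∈ᴸ Q → f ∈ᴸ L) → ∑ (vecs n) (T []) ≤ ∑ (vecs n) (T Q)
    T-all [] u h = ≤-refl
    T-all (f ∷ Q) (ne ∷ u) h = ≤-trans (T-all Q u (h ∘ there))
      (T-step f Q (h (here refl)) (λ m → h (there m) , λ { refl → All.lookup ne m refl }))

    T-bound : ∀ Q I → T Q I ≤ 2 ^ ∑ Q (λ f → ⟦ fr f I ⟧) * (⟦ A M I ∧ G I ⟧ * ⟦ ∑ Q (λ f → ⟦ sub (link f) I ⟧) ≡ᵇ 0 ⟧)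
    T-bound [] I = ≤-reflexive (sym (trans (+-identityʳ _) (*-identityʳ _)))
    T-bound (f ∷ Q) I with sub (link f) I
    ... | true  = z≤n
    ... | false = ≤-trans (≤-reflexive (+-identityʳ _)) (≤-trans (*-monoʳ-≤ (2 ^ ⟦ fr f I ⟧) (T-bound Q I))
      (≤-reflexive (trans (sym (*-assoc (2 ^ ⟦ fr f I ⟧) _ _)) (cong (_* (⟦ A M I ∧ G I ⟧ * _)) (sym (^-distribˡ-+-* 2 ⟦ fr f I ⟧ _))))))

    b : Subset n → ℕ
    b I = ⟦ A M I ∧ (full I ≡ᵇ 0) ⟧

    few-free : ∑ (vecs n) (λ I → ⟦ A M I ∧ G I ⟧) ≤ 2 ^ j * ∑ (vecs n) b
    few-free = begin
      ∑ (vecs n) (T [])       ≤⟨ T-all L (filter⁺ (λ x → isLink x Data.Bool.≟ true) (vecs-unique n)) id ⟩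
      ∑ (vecs n) (T L)        ≤⟨ ∑-mono (vecs n) (λ I → ≤-trans (T-bound L I) (capped I)) ⟩
      ∑ (vecs n) (λ I → 2 ^ j * b I) ≡⟨ ∑-* (vecs n) (2 ^ j) b ⟩
      2 ^ j * ∑ (vecs n) b ∎
      where
      open ≤-Reasoning
      open import Data.List.Relation.Unary.Unique.Propositional.Properties using (filter⁺)
      capped : ∀ I → 2 ^ g I * (⟦ A M I ∧ G I ⟧ * ⟦ full I ≡ᵇ 0 ⟧) ≤ 2 ^ j * b I
      capped I with A M I | G I in eq
      ... | false | _     = ≤-trans (≤-reflexive (*-zeroʳ (2 ^ g I))) z≤n
      ... | true  | false = ≤-trans (≤-reflexive (*-zeroʳ (2 ^ g I))) z≤n
      ... | true  | true  = *-mono-≤ (^-monoʳ-≤ 2 (<⇒≤ (<ᵇ⇒< (g I) j (≡⇒T eq)))) (≤-reflexive (+-identityʳ _))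

    -- If `link f` is free for `I`, then `I ∪ link f` is an independent set that contains the link,
    -- hence a pair counted by `X`; each such pair arises from at most `2 ^ suc d` sets `I`.
    total-free : ∑ (vecs n) (λ I → ⟦ A M I ⟧ * g I) ≤ 2 ^ suc d * X M v
    total-free = begin
      ∑ (vecs n) (λ I → ⟦ A M I ⟧ * g I)
        ≡⟨ ∑-cong (vecs n) (λ I → sym (∑-* L ⟦ A M I ⟧ _)) ⟩
      ∑ (vecs n) (λ I → ∑ L (λ f → ⟦ A M I ⟧ * ⟦ fr f I ⟧)) ≡⟨ ∑-swap (vecs n) L _ ⟩
      ∑ L (λ f → ∑ (vecs n) (λ I → ⟦ A M I ⟧ * ⟦ fr f I ⟧)) ≤⟨ ∑-mono∈ L each ⟩
      ∑ L (λ f → 2 ^ suc d * ∑ (vecs n) (λ J → ⟦ A M J ⟧ * ⟦ sub (link f) J ⟧)) ≡⟨ ∑-* L (2 ^ suc d) _ ⟩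
      2 ^ suc d * ∑ L (λ f → ∑ (vecs n) (λ J → ⟦ A M J ⟧ * ⟦ sub (link f) J ⟧))
        ≡⟨ cong (2 ^ suc d *_) (∑-swap L (vecs n) _) ⟩
      2 ^ suc d * ∑ (vecs n) (λ J → ∑ L (λ f → ⟦ A M J ⟧ * ⟦ sub (link f) J ⟧))
        ≡⟨ cong (2 ^ suc d *_) (∑-cong (vecs n) (λ J → ∑-* L ⟦ A M J ⟧ _)) ⟩
      2 ^ suc d * ∑ (vecs n) (λ J → ⟦ A M J ⟧ * full J)
        ≤⟨ *-monoʳ-≤ (2 ^ suc d) (∑-mono (vecs n) (λ J → *-monoʳ-≤ ⟦ A M J ⟧ (full≤ J))) ⟩
      2 ^ suc d * X M v ∎
      where
      open ≤-Reasoning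
      full≤ : ∀ J → full J ≤ ∑ (vecs n) (λ f → ⟦ E f ∧ (lookup f v ∧ sub (del v f) J) ⟧)
      full≤ J = ≤-trans (≤-reflexive (∑-select isLink (vecs n) _)) (∑-mono (vecs n) (λ f → when (isLink f) (λ h →
        let e , r = ∧-true {E f} h in ⟦⟧-mono (λ s → true-∧ e (true-∧ (proj₁ (∧-true {lookup f v} r)) s)))))
      each : ∀ f → f ∈ᴸ L → ∑ (vecs n) (λ I → ⟦ A M I ⟧ * ⟦ fr f I ⟧) ≤
                             2 ^ suc d * ∑ (vecs n) (λ J → ⟦ A M J ⟧ * ⟦ sub (link f) J ⟧)
      each f m = subst (λ k → ∑ (vecs n) (λ I → ⟦ A M I ⟧ * ⟦ fr f I ⟧) ≤
                               2 ^ k * ∑ (vecs n) (λ J → ⟦ A M J ⟧ * ⟦ sub (link f) J ⟧))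
        (suc-injective (trans (∣del∣ v f (L-v m)) (size f (L-edge m))))
        (sum-add (link f) _ _ (λ I → ≤-trans (≤-trans (*-monoˡ-≤ ⟦ fr f I ⟧ (⟦⟧≤1 (A M I))) (≤-reflexive (+-identityʳ _)))
          (≤-reflexive (sym (trans (cong (⟦ fr f I ⟧ *_) (⟦⟧-true (⊑⇒sub (link f) _ (∋-∪ʳ I (link f))))) (*-identityʳ _))))))

    -- No edge at `v` fits into `add v I` when `full I` vanishes, so the sets counted by `b` yield
    -- new independent sets containing `v`.
    Z-add : Z M + ∑ (vecs n) b ≤ Z (add v M)
    Z-add = sum-insert v _ b _
      (λ I _ → ⟦⟧-mono (λ h → let s , i = A-parts {M} {I} h in
        true-∧ (⊑⇒sub I (add v M) (⊑-trans s (⊑-add v M))) i))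
      (λ I _ → ⟦⟧-mono (added I))
      (λ I h → ⟦⟧-false (λ a → v∉M (proj₁ (A-parts {M} {I} a) v h)))
      (λ I h → ⟦⟧-false (λ a → v∉M (proj₁ (A-parts {M} {I} (proj₁ (∧-true a))) v h)))
      where
      added : ∀ I → A M I ∧ (full I ≡ᵇ 0) ≡ true → A (add v M) (add v I) ≡ true
      added I h = true-∧ (⊑⇒sub (add v I) (add v M) sub⁺) (ind-intro _ no-edge)
        where
        I⊑M : I ⊑ M
        I⊑M = proj₁ (A-parts {M} {I} (proj₁ (∧-true h)))
        sub⁺ : add v I ⊑ add v M
        sub⁺ = add-⊑ v (∋-add v M) (⊑-trans I⊑M (⊑-add v M))
        no-edge : ∀ f → E f ≡ true → f ⊑ add v I → ⊥
        no-edge f e s with lookup f v in eq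
        ... | false = ind-elim I f (proj₂ (A-parts {M} {I} (proj₁ (∧-true h)))) e
                        (λ i x → [ (λ { refl → ⊥-elim (not-both (look x) eq) }) , id ]′ (add-∋ v I (s i x)))
        ... | true  with trans (sym (∑-zero (λ f → ⟦ sub (link f) I ⟧)
                          (∈-select⁺ isLink (∈-vecs f) (true-∧ e (true-∧ eq (⊑⇒sub f _ (⊑-trans s sub⁺)))))
                          (≡ᵇ-elim {full I} (proj₂ (∧-true {A M I} h)))))
                          (⟦⟧-true (⊑⇒sub (link f) I (λ i x → let ne , y = del-∋ v f x in
                            [ ⊥-elim ∘ ne , id ]′ (add-∋ v I (s i y)))))
        ... | ()

    -- By `total-free` the second premise makes the average of `g` at most `j / 2`, so at least half
    -- of the independent sets have `g I < j`. By `few-free` these come from at least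
    -- `Z M / 2 ^ suc j` sets to which `v` can be added.
    Z-grows : 0 < j → 2 ^ suc (suc d) * X M v ≤ j * Z M → suc (2 ^ suc j) * Z M ≤ 2 ^ suc j * Z (add v M)
    Z-grows j>0 few = begin
      suc (2 ^ suc j) * Z M                              ≡⟨⟩
      Z M + 2 ^ suc j * Z M                              ≤⟨ +-monoˡ-≤ (2 ^ suc j * Z M) Z≤ ⟩
      2 ^ suc j * ∑ (vecs n) b + 2 ^ suc j * Z M         ≡⟨ lemma (2 ^ suc j) _ _ ⟩
      2 ^ suc j * (Z M + ∑ (vecs n) b)                   ≤⟨ *-monoʳ-≤ (2 ^ suc j) Z-add ⟩
      2 ^ suc j * Z (add v M) ∎
      where
      open ≤-Reasoning
      lemma : ∀ q b z → q * b + q * z ≡ q * (z + b)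
      lemma = solve-∀
      B = ∑ (vecs n) b
      jZ : j * Z M ≤ j * (2 ^ j * B) + 2 ^ suc d * X M v
      jZ = begin
        j * Z M ≡⟨ ∑-* (vecs n) j _ ⟨
        ∑ (vecs n) (λ I → j * ⟦ A M I ⟧) ≤⟨ ∑-mono (vecs n) cases ⟩
        ∑ (vecs n) (λ I → j * ⟦ A M I ∧ G I ⟧ + ⟦ A M I ⟧ * g I) ≡⟨ trans (∑-+ (vecs n) _ _) (cong (_+ ∑ (vecs n) (λ I → ⟦ A M I ⟧ * g I)) (∑-* (vecs n) j _)) ⟩
        j * ∑ (vecs n) (λ I → ⟦ A M I ∧ G I ⟧) + ∑ (vecs n) (λ I → ⟦ A M I ⟧ * g I)
          ≤⟨ +-mono-≤ (*-monoʳ-≤ j few-free) total-free ⟩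
        j * (2 ^ j * B) + 2 ^ suc d * X M v ∎
        where
        cases : ∀ I → j * ⟦ A M I ⟧ ≤ j * ⟦ A M I ∧ G I ⟧ + ⟦ A M I ⟧ * g I
        cases I with A M I | G I in eq
        ... | false | _     = ≤-trans (≤-reflexive (*-zeroʳ j)) z≤n
        ... | true  | true  = m≤m+n _ _
        ... | true  | false = ≤-trans (≤-reflexive (*-identityʳ j))
              (≤-trans (≮⇒≥ (λ lt → not-both (T⇒≡ (<⇒<ᵇ lt)) eq)) (≤-trans (≤-reflexive (sym (+-identityʳ _))) (m≤n+m _ (j * 0))))
      Z≤ : Z M ≤ 2 ^ suc j * B
      Z≤ = *-cancelˡ-≤ j {{>-nonZero j>0}} (+-cancelʳ-≤ (j * Z M) _ _ (begin
        j * Z M + j * Z M                                ≡⟨ double (j * Z M) ⟩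
        2 * (j * Z M)                                    ≤⟨ *-monoʳ-≤ 2 jZ ⟩
        2 * (j * (2 ^ j * B) + 2 ^ suc d * X M v)        ≡⟨ regroup j (2 ^ j) B (2 ^ suc d) (X M v) ⟩
        j * (2 * 2 ^ j * B) + 2 * 2 ^ suc d * X M v      ≤⟨ +-monoʳ-≤ (j * (2 * 2 ^ j * B)) few ⟩
        j * (2 ^ suc j * B) + j * Z M ∎))
        where
        double : ∀ x → x + x ≡ 2 * x
        double = solve-∀
        regroup : ∀ j p B q x → 2 * (j * (p * B) + q * x) ≡ j * (2 * p * B) + 2 * q * x
        regroup = solve-∀

-- Intersecting pairs and triangles of edges

guard : ∀ {A : Set} → Bool → A → List A
guard true  x = x ∷ []
guard false x = []

∑-guard : ∀ {A : Set} b (x : A) (f : A → ℕ) → ∑ (guard b x) f ≡ ⟦ b ⟧ * f x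
∑-guard true  x f = refl
∑-guard false x f = refl

∈-guard⁺ : ∀ {A : Set} {b} {x : A} → b ≡ true → x ∈ᴸ guard b x
∈-guard⁺ refl = here refl

∈-guard⁻ : ∀ {A : Set} {b} {x y : A} → y ∈ᴸ guard b x → b ≡ true × y ≡ x
∈-guard⁻ {b = true} (here e) = refl , e

module _ {A B : Set} where

  ∈-bind⁺ : (g : A → List B) {xs : List A} {x : A} {y : B} → x ∈ᴸ xs → y ∈ᴸ g x → y ∈ᴸ concatMap g xs
  ∈-bind⁺ g {x ∷ xs} (here refl) q = ∈-++⁺ˡ q
  ∈-bind⁺ g {x ∷ xs} (there p)   q = ∈-++⁺ʳ (g x) (∈-bind⁺ g p q)

  ∈-bind⁻ : (g : A → List B) (xs : List A) {y : B} → y ∈ᴸ concatMap g xs → ∃ λ x → x ∈ᴸ xs × y ∈ᴸ g x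
  ∈-bind⁻ g (x ∷ xs) m with ∈-++⁻ (g x) m
  ... | inj₁ h = x , here refl , h
  ... | inj₂ h = let y , p , q = ∈-bind⁻ g xs h in y , there p , q

∩-⊑ˡ : ∀ {n} (p q : Subset n) → p ∩ q ⊑ p
∩-⊑ˡ p q i = proj₁ ∘ ∩-∋ p q

∩-⊑ʳ : ∀ {n} (p q : Subset n) → p ∩ q ⊑ q
∩-⊑ʳ p q i = proj₂ ∘ ∩-∋ p q

module Cycles {n d C : ℕ} (E : Subset n → Bool) (size : ∀ f → E f ≡ true → ∣ f ∣ ≡ suc d)
              (codegree : ∀ D → ∣ D ∣ ≡ d → ∑ (vecs n) (λ f → ⟦ E f ∧ sub D f ⟧) ≤ C) where
  open Growth E using (Linear; TriangleFree)

  edges : List (Subset n)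
  edges = select E (vecs n)

  ∈-edges : ∀ {f} → E f ≡ true → f ∈ᴸ edges
  ∈-edges {f} = ∈-select⁺ E (∈-vecs f)

  edge : ∀ {f} → f ∈ᴸ edges → E f ≡ true
  edge = proj₂ ∘ ∈-select⁻ E {vecs n}

  -- An edge containing `D` has a further vertex, for which there are at most `n` choices; after `i`
  -- of them the codegree bound applies.
  extensions : ∀ i (D : Subset n) → ∣ D ∣ + i ≡ d → ∑ edges (λ f → ⟦ sub D f ⟧) ≤ C * n ^ i
  extensions zero D e = ≤-trans (≤-reflexive (trans (∑-select E (vecs n) _) (∑-cong (vecs n) (λ f → sym (∧-⟦⟧ (E f) _)))))
    (≤-trans (codegree D (trans (sym (+-identityʳ _)) e)) (≤-reflexive (sym (*-identityʳ C))))
  extensions (suc i) D e = begin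
    ∑ edges (λ f → ⟦ sub D f ⟧)
      ≤⟨ ∑-mono∈ edges bigger ⟩
    ∑ edges (λ f → ∑ (fins n) (λ v → ⟦ not (lookup D v) ⟧ * ⟦ sub (add v D) f ⟧)) ≡⟨ ∑-swap edges (fins n) _ ⟩
    ∑ (fins n) (λ v → ∑ edges (λ f → ⟦ not (lookup D v) ⟧ * ⟦ sub (add v D) f ⟧))
      ≤⟨ ∑-mono (fins n) (λ v → ≤-trans (≤-reflexive (∑-* edges ⟦ not (lookup D v) ⟧ _)) (when _ (extended v))) ⟩
    ∑ (fins n) (λ v → C * n ^ i) ≡⟨ trans (∑-const (fins n) _) (cong (_* (C * n ^ i)) (length-fins n)) ⟩
    n * (C * n ^ i) ≡⟨ lemma n C (n ^ i) ⟩
    C * (n * n ^ i) ∎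
    where
    open ≤-Reasoning
    lemma : ∀ n C x → n * (C * x) ≡ C * (n * x)
    lemma = solve-∀
    extended : ∀ v → not (lookup D v) ≡ true → ∑ edges (λ f → ⟦ sub (add v D) f ⟧) ≤ C * n ^ i
    extended v h = extensions i (add v D) (trans (cong (_+ i) (∣add∣ v D (λ { (mem k) → case trans (sym h) (cong not k) of λ () })))
      (trans (sym (+-suc _ i)) e))
    bigger : ∀ f → f ∈ᴸ edges → ⟦ sub D f ⟧ ≤ ∑ (fins n) (λ v → ⟦ not (lookup D v) ⟧ * ⟦ sub (add v D) f ⟧)
    bigger f m with sub D f in s
    ... | false = z≤n
    ... | true with bigger-has-more f D (subst (∣ D ∣ <_) (trans (cong suc e) (sym (size f (edge m))))
                                          (s≤s (m≤m+n ∣ D ∣ (suc i))))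
    ... | v , v∈f , v∉D = ≤-trans (≤-reflexive (sym (cong₂ (λ a b → ⟦ not a ⟧ * ⟦ b ⟧) (≢true (v∉D ∘ mem))
            (⊑⇒sub (add v D) f (add-⊑ v v∈f (sub⇒⊑ D f s)))))) (∑-∈ _ (∈-fins v))

  ∑-edges : ∑ edges (λ _ → 1) ≤ C * n ^ d
  ∑-edges = ≤-trans (∑-mono edges (λ f → ≤-reflexive (sym (⟦⟧-true (⊑⇒sub ∅ f (λ i → ⊥-elim ∘ ∉∅ i))))))
                    (extensions d ∅ (cong (_+ d) (∣∅∣ n)))

  -- Split the edges g according to their trace D = p ∩ g.
  by-trace : ∀ (p : Subset n) (φ : ℕ → ℕ) W → (∀ i j → j + i ≡ d → φ j * (C * n ^ i) ≤ W) →
             (∀ j → d < j → φ j ≡ 0) → ∑ edges (λ g → φ ∣ p ∩ g ∣) ≤ 2 ^ ∣ p ∣ * W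
  by-trace p φ W small large = begin
    ∑ edges (λ g → φ ∣ p ∩ g ∣) ≤⟨ ∑-mono edges trace ⟩
    ∑ edges (λ g → ∑ (vecs n) (λ D → ⟦ sub D p ⟧ * (φ ∣ D ∣ * ⟦ sub D g ⟧))) ≡⟨ ∑-swap edges (vecs n) _ ⟩
    ∑ (vecs n) (λ D → ∑ edges (λ g → ⟦ sub D p ⟧ * (φ ∣ D ∣ * ⟦ sub D g ⟧)))
      ≡⟨ ∑-cong (vecs n) (λ D → trans (∑-* edges ⟦ sub D p ⟧ _) (cong (⟦ sub D p ⟧ *_) (∑-* edges (φ ∣ D ∣) _))) ⟩
    ∑ (vecs n) (λ D → ⟦ sub D p ⟧ * (φ ∣ D ∣ * ∑ edges (λ g → ⟦ sub D g ⟧)))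
      ≤⟨ ∑-mono (vecs n) (λ D → *-monoʳ-≤ ⟦ sub D p ⟧ (perD D)) ⟩
    ∑ (vecs n) (λ D → ⟦ sub D p ⟧ * W) ≡⟨ trans (∑-cong (vecs n) (λ D → *-comm ⟦ sub D p ⟧ W)) (∑-* (vecs n) W _) ⟩
    W * ∑ (vecs n) (λ D → ⟦ sub D p ⟧) ≡⟨ trans (cong (W *_) (∑-2^ p)) (*-comm W _) ⟩
    2 ^ ∣ p ∣ * W ∎
    where
    open ≤-Reasoning
    trace : ∀ g → φ ∣ p ∩ g ∣ ≤ ∑ (vecs n) (λ D → ⟦ sub D p ⟧ * (φ ∣ D ∣ * ⟦ sub D g ⟧))
    trace g = ≤-trans (≤-reflexive (sym (trans (⟦⟧* _ (⊑⇒sub (p ∩ g) p (∩-⊑ˡ p g)))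
        (trans (cong (φ ∣ p ∩ g ∣ *_) (⟦⟧-true (⊑⇒sub (p ∩ g) g (∩-⊑ʳ p g)))) (*-identityʳ _)))))
      (∑-∈ (λ D → ⟦ sub D p ⟧ * (φ ∣ D ∣ * ⟦ sub D g ⟧)) (∈-vecs (p ∩ g)))
    perD : ∀ D → φ ∣ D ∣ * ∑ edges (λ g → ⟦ sub D g ⟧) ≤ W
    perD D with ∣ D ∣ ≤? d
    ... | yes le = ≤-trans (*-monoʳ-≤ (φ ∣ D ∣) (extensions (d ∸ ∣ D ∣) D (m+[n∸m]≡n le))) (small _ _ (m+[n∸m]≡n le))
    ... | no  nl rewrite large ∣ D ∣ (≰⇒> nl) = z≤n

  -- The upper bound excludes a pair of equal edges, which would meet in `suc d` vertices.
  twins : ℕ → Bool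
  twins j = (2 ≤ᵇ j) ∧ (j ≤ᵇ d)

  pairs : List (Subset n)
  pairs = concatMap (λ f → concatMap (λ g → guard (twins ∣ f ∩ g ∣) (f ∪ g)) edges) edges

  -- The two conditions are what linearity forces on the edges of a triangle. They fix the size of
  -- the union at `3 * d`, so that all triangles have the same weight.
  triangles : List (Subset n)
  triangles = concatMap (λ f → concatMap (λ g → concatMap (λ h →
    guard ((∣ f ∩ g ∣ ≡ᵇ 1) ∧ (∣ (f ∪ g) ∩ h ∣ ≡ᵇ 2)) ((f ∪ g) ∪ h)) edges) edges) edges

  ∣pair∣ : ∀ {f g} → E f ≡ true → E g ≡ true → ∣ f ∪ g ∣ + ∣ f ∩ g ∣ ≡ 2 + (d + d)
  ∣pair∣ {f} {g} e e′ = trans (∣∪∩∣ f g) (trans (cong₂ _+_ (size f e) (size g e′)) (cong suc (+-suc d d)))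

  ∣triangle∣ : ∀ {f g h} → E f ≡ true → E g ≡ true → E h ≡ true → ∣ f ∩ g ∣ ≡ 1 → ∣ (f ∪ g) ∩ h ∣ ≡ 2 →
               ∣ (f ∪ g) ∪ h ∣ ≡ d + (d + d)
  ∣triangle∣ {f} {g} {h} e e′ e″ one two =
    +-cancelʳ-≡ 2 _ _ (trans (trans (sym (cong (∣ (f ∪ g) ∪ h ∣ +_) two)) (∣∪∩∣ (f ∪ g) h))
      (trans (cong₂ _+_ (+-cancelʳ-≡ 1 ∣ f ∪ g ∣ (1 + (d + d)) (trans (trans (sym (cong (∣ f ∪ g ∣ +_) one)) (∣pair∣ {f} {g} e e′)) (lemma d))) (size h e″)) (lemma′ d)))
    where
    lemma : ∀ d → 2 + (d + d) ≡ (1 + (d + d)) + 1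
    lemma = solve-∀
    lemma′ : ∀ d → (1 + (d + d)) + suc d ≡ d + (d + d) + 2
    lemma′ = solve-∀

  pairs-small : ∀ O → O ∈ᴸ pairs → ∣ O ∣ ≤ 2 + (d + d)
  pairs-small O m with ∈-bind⁻ _ edges m
  ... | f , fm , m′ with ∈-bind⁻ _ edges m′
  ... | g , gm , m″ with ∈-guard⁻ m″
  ... | _ , refl = ≤-trans (m≤m+n _ _) (≤-reflexive (∣pair∣ {f} {g} (edge fm) (edge gm)))

  pairs-nonempty : ∀ O → O ∈ᴸ pairs → 0 < ∣ O ∣
  pairs-nonempty O m with ∈-bind⁻ _ edges m
  ... | f , fm , m′ with ∈-bind⁻ _ edges m′
  ... | g , gm , m″ with ∈-guard⁻ m″
  ... | _ , refl = ≤-trans (subst (0 <_) (sym (size f (edge fm))) z<s) (∣⊑∣ f (f ∪ g) (∋-∪ˡ f g))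

  triangles-size : ∀ O → O ∈ᴸ triangles → ∣ O ∣ ≡ d + (d + d)
  triangles-size O m with ∈-bind⁻ _ edges m
  ... | f , fm , m′ with ∈-bind⁻ _ edges m′
  ... | g , gm , m″ with ∈-bind⁻ _ edges m″
  ... | h , hm , m‴ with ∈-guard⁻ m‴
  ... | c , refl = let a , b = ∧-true {∣ f ∩ g ∣ ≡ᵇ 1} c in
    ∣triangle∣ {f} {g} {h} (edge fm) (edge gm) (edge hm) (≡ᵇ-elim {∣ f ∩ g ∣} a) (≡ᵇ-elim {∣ (f ∪ g) ∩ h ∣} b)

  private
    ∑-≤-const : ∀ {xs : List (Subset n)} {f : Subset n → ℕ} {c} → (∀ x → x ∈ᴸ xs → f x ≤ c) → ∑ xs f ≤ c * ∑ xs (λ _ → 1)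
    ∑-≤-const {xs} {f} {c} h = ≤-trans (∑-mono∈ xs (λ x m → ≤-trans (h x m) (≤-reflexive (sym (*-identityʳ c)))))
                                      (≤-reflexive (∑-* xs c _))

  -- For a fixed `f`, a trace of size `j` on `f` leaves at most `C * n ^ i` edges `g`, and each
  -- union then has `2 + (d + d) ∸ j` vertices. There are `2 ^ suc d` possible traces.
  pairs-load : ∀ (wt : ℕ → ℕ) W → (∀ i j → j + i ≡ d → 2 ≤ j → n ^ i * wt (2 + (d + d) ∸ j) ≤ W) →
               ∑ pairs (λ O → wt ∣ O ∣) ≤ 2 ^ suc d * (C * W) * (C * n ^ d)
  pairs-load wt W hW = begin
    ∑ pairs (λ O → wt ∣ O ∣) ≡⟨ ∑-concatMap _ edges _ ⟩
    ∑ edges (λ f → ∑ (concatMap (λ g → guard (twins ∣ f ∩ g ∣) (f ∪ g)) edges) (λ O → wt ∣ O ∣))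
      ≤⟨ ∑-≤-const {edges} each ⟩
    2 ^ suc d * (C * W) * ∑ edges (λ _ → 1) ≤⟨ *-monoʳ-≤ (2 ^ suc d * (C * W)) ∑-edges ⟩
    2 ^ suc d * (C * W) * (C * n ^ d) ∎
    where
    open ≤-Reasoning
    φ : ℕ → ℕ
    φ j = ⟦ twins j ⟧ * wt (2 + (d + d) ∸ j)
    bound : ∀ i j → j + i ≡ d → φ j * (C * n ^ i) ≤ C * W
    bound i j e = ≤-trans (≤-reflexive (*-assoc ⟦ twins j ⟧ _ _)) (when (twins j) (λ h →
      ≤-trans (≤-reflexive (lemma (wt (2 + (d + d) ∸ j)) C (n ^ i))) (*-monoʳ-≤ C (hW i j e (≤ᵇ-elim (proj₁ (∧-true h)))))))
      where lemma : ∀ w C x → w * (C * x) ≡ C * (x * w)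
            lemma = solve-∀
    large : ∀ j → d < j → φ j ≡ 0
    large j lt = ⟦⟧*-false {twins j} _ (λ h → <⇒≱ lt (≤ᵇ-elim (proj₂ (∧-true {2 ≤ᵇ j} h))))
    each : ∀ f → f ∈ᴸ edges → ∑ (concatMap (λ g → guard (twins ∣ f ∩ g ∣) (f ∪ g)) edges) (λ O → wt ∣ O ∣) ≤ 2 ^ suc d * (C * W)
    each f m = begin
      ∑ (concatMap (λ g → guard (twins ∣ f ∩ g ∣) (f ∪ g)) edges) (λ O → wt ∣ O ∣) ≡⟨ ∑-concatMap _ edges _ ⟩
      ∑ edges (λ g → ∑ (guard (twins ∣ f ∩ g ∣) (f ∪ g)) (λ O → wt ∣ O ∣))
        ≤⟨ ∑-mono∈ edges (λ g m′ → ≤-reflexive (trans (∑-guard (twins ∣ f ∩ g ∣) _ _)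
             (cong (λ z → ⟦ twins ∣ f ∩ g ∣ ⟧ * wt z) (trans (sym (m+n∸n≡m ∣ f ∪ g ∣ ∣ f ∩ g ∣))
               (cong (_∸ ∣ f ∩ g ∣) (∣pair∣ {f} {g} (edge m) (edge m′))))))) ⟩
      ∑ edges (λ g → φ ∣ f ∩ g ∣) ≤⟨ by-trace f φ (C * W) bound large ⟩
      2 ^ ∣ f ∣ * (C * W) ≡⟨ cong (λ z → 2 ^ z * (C * W)) (size f (edge m)) ⟩
      2 ^ suc d * (C * W) ∎

  -- The three powers of `n` belong to an edge `f`, to an edge `g` through a given vertex of `f`,
  -- and to an edge `h` through two given vertices of `f ∪ g`.
  triangles-length : ∀ e → d ≡ suc (suc e) →
    length triangles ≤ 2 ^ suc d * (2 ^ (2 + (d + d)) * (C * n ^ e) * (C * n ^ suc e)) * (C * n ^ d)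
  triangles-length e refl = begin
    length triangles ≡⟨ sym (trans (∑-const triangles 1) (*-identityʳ _)) ⟩
    ∑ triangles (λ _ → 1) ≡⟨ ∑-concatMap _ edges _ ⟩
    ∑ edges (λ f → ∑ (fs f) (λ _ → 1)) ≤⟨ ∑-≤-const {edges} eachf ⟩
    2 ^ suc d * (2 ^ (2 + (d + d)) * (C * n ^ e) * (C * n ^ suc e)) * ∑ edges (λ _ → 1)
      ≤⟨ *-monoʳ-≤ (2 ^ suc d * (2 ^ (2 + (d + d)) * (C * n ^ e) * (C * n ^ suc e))) ∑-edges ⟩
    2 ^ suc d * (2 ^ (2 + (d + d)) * (C * n ^ e) * (C * n ^ suc e)) * (C * n ^ d) ∎
    where
    open ≤-Reasoning
    fgs : Subset n → Subset n → List (Subset n)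
    fgs f g = concatMap (λ h → guard ((∣ f ∩ g ∣ ≡ᵇ 1) ∧ (∣ (f ∪ g) ∩ h ∣ ≡ᵇ 2)) ((f ∪ g) ∪ h)) edges
    fs : Subset n → List (Subset n)
    fs f = concatMap (fgs f) edges
    V = 2 ^ (2 + (d + d)) * (C * n ^ e)
    eachfg : ∀ f g → f ∈ᴸ edges → g ∈ᴸ edges → ∑ (fgs f g) (λ _ → 1) ≤ ⟦ ∣ f ∩ g ∣ ≡ᵇ 1 ⟧ * V
    eachfg f g m m′ = begin
      ∑ (fgs f g) (λ _ → 1) ≡⟨ ∑-concatMap _ edges _ ⟩
      ∑ edges (λ h → ∑ (guard ((∣ f ∩ g ∣ ≡ᵇ 1) ∧ (∣ (f ∪ g) ∩ h ∣ ≡ᵇ 2)) ((f ∪ g) ∪ h)) (λ _ → 1))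
        ≡⟨ ∑-cong edges (λ h → trans (∑-guard ((∣ f ∩ g ∣ ≡ᵇ 1) ∧ (∣ (f ∪ g) ∩ h ∣ ≡ᵇ 2)) ((f ∪ g) ∪ h) _)
             (trans (*-identityʳ _) (∧-⟦⟧ (∣ f ∩ g ∣ ≡ᵇ 1) _))) ⟩
      ∑ edges (λ h → ⟦ ∣ f ∩ g ∣ ≡ᵇ 1 ⟧ * ⟦ ∣ (f ∪ g) ∩ h ∣ ≡ᵇ 2 ⟧) ≡⟨ ∑-* edges ⟦ ∣ f ∩ g ∣ ≡ᵇ 1 ⟧ _ ⟩
      ⟦ ∣ f ∩ g ∣ ≡ᵇ 1 ⟧ * ∑ edges (λ h → ⟦ ∣ (f ∪ g) ∩ h ∣ ≡ᵇ 2 ⟧)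
        ≤⟨ *-monoʳ-≤ ⟦ ∣ f ∩ g ∣ ≡ᵇ 1 ⟧ (≤-trans (by-trace (f ∪ g) (λ j → ⟦ j ≡ᵇ 2 ⟧) (C * n ^ e)
             (λ i j h → when (j ≡ᵇ 2) (λ t → ≤-reflexive (cong (λ k → C * n ^ k) (+-cancelˡ-≡ 2 i e (trans (cong (_+ i) (sym (≡ᵇ-elim {j} t))) h)))))
             (λ j lt → ⟦⟧-false (λ t → <⇒≱ lt (≤-trans (≤-reflexive (≡ᵇ-elim {j} t)) (s≤s (s≤s z≤n))))))
           (*-monoˡ-≤ (C * n ^ e) (^-monoʳ-≤ 2 (≤-trans (m≤m+n ∣ f ∪ g ∣ _) (≤-reflexive (∣pair∣ {f} {g} (edge m) (edge m′))))))) ⟩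
      ⟦ ∣ f ∩ g ∣ ≡ᵇ 1 ⟧ * V ∎
    eachf : ∀ f → f ∈ᴸ edges → ∑ (fs f) (λ _ → 1) ≤ 2 ^ suc d * (V * (C * n ^ suc e))
    eachf f m = begin
      ∑ (fs f) (λ _ → 1) ≡⟨ ∑-concatMap (fgs f) edges _ ⟩
      ∑ edges (λ g → ∑ (fgs f g) (λ _ → 1)) ≤⟨ ∑-mono∈ edges (λ g m′ → eachfg f g m m′) ⟩
      ∑ edges (λ g → ⟦ ∣ f ∩ g ∣ ≡ᵇ 1 ⟧ * V)
        ≤⟨ by-trace f (λ j → ⟦ j ≡ᵇ 1 ⟧ * V) (V * (C * n ^ suc e))
             (λ i j h → ≤-trans (≤-reflexive (*-assoc ⟦ j ≡ᵇ 1 ⟧ V _)) (when (j ≡ᵇ 1) (λ t → ≤-reflexive (cong (λ k → V * (C * n ^ k))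
               (+-cancelˡ-≡ 1 i (suc e) (trans (cong (_+ i) (sym (≡ᵇ-elim {j} t))) h))))))
             (λ j lt → ⟦⟧*-false {j ≡ᵇ 1} V (λ t → <⇒≱ lt (≤-trans (≤-reflexive (≡ᵇ-elim {j} t)) (s≤s z≤n)))) ⟩
      2 ^ ∣ f ∣ * (V * (C * n ^ suc e)) ≡⟨ cong (λ z → 2 ^ z * (V * (C * n ^ suc e))) (size f (edge m)) ⟩
      2 ^ suc d * (V * (C * n ^ suc e)) ∎

  linear : ∀ M → (∀ O → O ∈ᴸ pairs → ¬ O ⊑ M) → Linear M
  linear M free f g Ef Eg f⊑ g⊑ x y ne fx fy gx gy with f ≟ˢ g
  ... | yes e = e
  ... | no  f≢g = ⊥-elim (free (f ∪ g) (∈-bind⁺ _ (∈-edges {f} Ef) (∈-bind⁺ _ (∈-edges {g} Eg)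
                    (∈-guard⁺ (true-∧ (≤ᵇ-intro many) (≤ᵇ-intro few))))) (∪-⊑ f⊑ g⊑))
    where
    many : 2 ≤ ∣ f ∩ g ∣
    many = card≥2 (f ∩ g) ne (∋-∩ f g fx gx) (∋-∩ f g fy gy)
    few : ∣ f ∩ g ∣ ≤ d
    few with ∣ f ∩ g ∣ ≤? d
    ... | yes p = p
    ... | no  p = ⊥-elim (f≢g (trans (sym (⊑-∣≡∣ (f ∩ g) f (∩-⊑ˡ f g) (≤-trans (≤-reflexive (size f Ef)) (≰⇒> p))))
                                     (⊑-∣≡∣ (f ∩ g) g (∩-⊑ʳ f g) (≤-trans (≤-reflexive (size g Eg)) (≰⇒> p)))))

  triangle-free : ∀ M → Linear M → (∀ O → O ∈ᴸ triangles → ¬ O ⊑ M) → TriangleFree M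
  triangle-free M lin free f g h Ef Eg Eh f⊑ g⊑ h⊑ f≢g g≢h f≢h x y z x≢y y≢z x≢z fx gx gy hy fz hz =
    free ((f ∪ g) ∪ h) (∈-bind⁺ _ (∈-edges {f} Ef) (∈-bind⁺ _ (∈-edges {g} Eg) (∈-bind⁺ _ (∈-edges {h} Eh)
      (∈-guard⁺ (true-∧ (≡ᵇ-intro {∣ f ∩ g ∣} one) (≡ᵇ-intro {∣ (f ∪ g) ∩ h ∣} two′)))))) (∪-⊑ (∪-⊑ f⊑ g⊑) h⊑)
    where
    meet : ∀ {p q i k} → E p ≡ true → E q ≡ true → p ⊑ M → q ⊑ M → p ≢ q → p ∋ i → q ∋ i → p ∋ k → q ∋ k → i ≡ k
    meet {p} {q} {i} {k} ep eq p⊑ q⊑ ne pi qi pk qk with i Data.Fin.≟ k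
    ... | yes e = e
    ... | no  c = ⊥-elim (ne (lin p q ep eq p⊑ q⊑ i k c pi pk qi qk))
    one : ∣ f ∩ g ∣ ≡ 1
    one = ≤-antisym
      (≤-trans (∣⊑∣ (f ∩ g) (add x ∅) (λ i k → let a , b = ∩-∋ f g k in
          subst (add x ∅ ∋_) (meet Ef Eg f⊑ g⊑ f≢g fx gx a b) (∋-add x ∅)))
        (≤-reflexive (trans (∣add∣ x ∅ (∉∅ x)) (cong suc (∣∅∣ n)))))
      (≤-trans (≤-reflexive (sym (trans (∣add∣ x ∅ (∉∅ x)) (cong suc (∣∅∣ n)))))
        (∣⊑∣ (add x ∅) (f ∩ g) (add-⊑ x (∋-∩ f g fx gx) (λ i → ⊥-elim ∘ ∉∅ i))))
    two′ : ∣ (f ∪ g) ∩ h ∣ ≡ 2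
    two′ = ≤-antisym
      (≤-trans (∣⊑∣ ((f ∪ g) ∩ h) (add y (add z ∅)) inside)
        (≤-reflexive (trans (∣add∣ y (add z ∅) (λ k → [ y≢z ∘ sym , ∉∅ y ]′ (add-∋ z ∅ k)))
          (cong suc (trans (∣add∣ z ∅ (∉∅ z)) (cong suc (∣∅∣ n)))))))
      (card≥2 ((f ∪ g) ∩ h) y≢z (∋-∩ (f ∪ g) h (∋-∪ʳ f g y gy) hy) (∋-∩ (f ∪ g) h (∋-∪ˡ f g z fz) hz))
      where
      inside : (f ∪ g) ∩ h ⊑ add y (add z ∅)
      inside i k with ∩-∋ (f ∪ g) h k
      ... | a , hi with ∪-∋ f g a
      ... | inj₁ fi = subst (add y (add z ∅) ∋_) (meet Ef Eh f⊑ h⊑ f≢h fz hz fi hi) (⊑-add y (add z ∅) z (∋-add z ∅))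
      ... | inj₂ gi = subst (add y (add z ∅) ∋_) (meet Eg Eh g⊑ h⊑ g≢h gy hy gi hi) (∋-add y (add z ∅))

-- Choice of the parameters

^-distribʳ-* : ∀ x y k → (x * y) ^ k ≡ x ^ k * y ^ k
^-distribʳ-* x y zero    = refl
^-distribʳ-* x y (suc k) = trans (cong (x * y *_) (^-distribʳ-* x y k)) (ex x y (x ^ k) (y ^ k))
  where ex : ∀ a b c d → a * b * (c * d) ≡ a * c * (b * d)
        ex = solve-∀

n<2^n : ∀ n → n < 2 ^ n
n<2^n zero    = s≤s z≤n
n<2^n (suc n) = ≤-trans (s≤s (n<2^n n)) (≤-trans (+-monoˡ-≤ (2 ^ n) (m^n>0 2 n)) (≤-reflexive (cong (2 ^ n +_) (sym (+-identityʳ _)))))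

2^⌊log₂⌋≤ : ∀ n → 0 < n → 2 ^ ⌊log₂ n ⌋ ≤ n
2^⌊log₂⌋≤ n n>0 = go n n ≤-refl n>0
  where
  double : ∀ n → 2 * ⌊ n /2⌋ ≤ n
  double zero          = z≤n
  double (suc zero)    = z≤n
  double (suc (suc n)) = ≤-trans (≤-reflexive (lemma ⌊ n /2⌋)) (s≤s (s≤s (double n)))
    where lemma : ∀ x → 2 * suc x ≡ 2 + 2 * x
          lemma = solve-∀
  2^pred : ∀ k → 2 ^ k ≤ 2 * 2 ^ (k ∸ 1)
  2^pred zero    = s≤s z≤n
  2^pred (suc k) = ≤-refl
  go : ∀ fuel n → n ≤ fuel → 0 < n → 2 ^ ⌊log₂ n ⌋ ≤ n
  go (suc fuel) (suc zero) h _ = ≤-refl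
  go (suc fuel) (suc (suc n)) h _ = begin
    2 ^ ⌊log₂ suc (suc n) ⌋             ≤⟨ 2^pred ⌊log₂ suc (suc n) ⌋ ⟩
    2 * 2 ^ (⌊log₂ suc (suc n) ⌋ ∸ 1)   ≡⟨ cong (λ k → 2 * 2 ^ k) (⌊log₂⌊n/2⌋⌋≡⌊log₂n⌋∸1 (suc (suc n))) ⟨
    2 * 2 ^ ⌊log₂ suc ⌊ n /2⌋ ⌋         ≤⟨ *-monoʳ-≤ 2 (go fuel (suc ⌊ n /2⌋) (≤-trans (s≤s (⌊n/2⌋≤n n)) (≤-pred h)) z<s) ⟩
    2 * suc ⌊ n /2⌋                     ≤⟨ double (suc (suc n)) ⟩
    suc (suc n) ∎
    where open ≤-Reasoning

<2^⌊log₂⌋ : ∀ n → n < 2 ^ suc ⌊log₂ n ⌋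
<2^⌊log₂⌋ n = ≰⇒> (λ h → 1+n≰n (≤-trans (≤-reflexive (sym (⌊log₂[2^n]⌋≡n (suc ⌊log₂ n ⌋)))) (⌊log₂⌋-mono-≤ h)))

exp-beats-square : ∀ c → ∃ λ J → 0 < J × ∀ j → J ≤ j → c * (suc j * suc j) < 2 ^ (j ∸ 1)
exp-beats-square c = J , z<s , λ j h → subst (λ i → c * (suc i * suc i) < 2 ^ (i ∸ 1)) (m+[n∸m]≡n h) (go (j ∸ J))
  where
  open ≤-Reasoning
  -- With `c < 2 ^ c` and `suc J ≤ 2 ^ (5 + c)` the left side is at most `2 ^ (10 + 3 * c)`. From
  -- there on, passing to the next `j` at most doubles the left side.
  J = suc (15 + 4 * c)
  base : c * (suc J * suc J) < 2 ^ (J ∸ 1)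
  base = begin-strict
    c * (suc J * suc J)             ≤⟨ *-mono-≤ (<⇒≤ (n<2^n c)) (*-mono-≤ lin lin) ⟩
    2 ^ c * (2 ^ (5 + c) * 2 ^ (5 + c)) ≡⟨ cong (2 ^ c *_) (sym (^-distribˡ-+-* 2 (5 + c) (5 + c))) ⟩
    2 ^ c * 2 ^ ((5 + c) + (5 + c)) ≡⟨ sym (^-distribˡ-+-* 2 c _) ⟩
    2 ^ (c + ((5 + c) + (5 + c)))   <⟨ ^-monoʳ-< 2 (s≤s (s≤s z≤n)) (≤-trans (m≤m+n _ (4 + c)) (≤-reflexive (expo c))) ⟩
    2 ^ (15 + 4 * c) ∎
    where
    expo : ∀ c → suc (c + ((5 + c) + (5 + c))) + (4 + c) ≡ 15 + 4 * c
    expo = solve-∀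
    lin : suc J ≤ 2 ^ (5 + c)
    lin = begin
      suc J                  ≤⟨ m≤m+n _ (15 + 28 * c) ⟩
      suc J + (15 + 28 * c)  ≡⟨ lin′ c ⟩
      32 * suc c             ≤⟨ *-monoʳ-≤ 32 (n<2^n c) ⟩
      32 * 2 ^ c             ≡⟨ ^-distribˡ-+-* 2 5 c ⟨
      2 ^ (5 + c) ∎
      where lin′ : ∀ c → suc (suc (15 + 4 * c)) + (15 + 28 * c) ≡ 32 * suc c
            lin′ = solve-∀
  go : ∀ i → c * (suc (J + i) * suc (J + i)) < 2 ^ ((J + i) ∸ 1)
  go zero = subst (λ i → c * (suc i * suc i) < 2 ^ (i ∸ 1)) (sym (+-identityʳ J)) base
  go (suc i) = begin-strict
    c * (suc (J + suc i) * suc (J + suc i)) ≤⟨ *-monoʳ-≤ c (≤-trans (m≤m+n _ _) (≤-reflexive square)) ⟩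
    c * (2 * (suc (J + i) * suc (J + i)))   ≡⟨ swap c (suc (J + i) * suc (J + i)) ⟩
    2 * (c * (suc (J + i) * suc (J + i)))   <⟨ *-monoʳ-< 2 (go i) ⟩
    2 * 2 ^ (15 + 4 * c + i)                ≡⟨ cong (2 ^_) (sym (+-suc (15 + 4 * c) i)) ⟩
    2 ^ ((J + suc i) ∸ 1) ∎
    where
    swap : ∀ c x → c * (2 * x) ≡ 2 * (c * x)
    swap = solve-∀
    square′ : ∀ y → (4 + y) * (4 + y) + (2 + y * y + 4 * y) ≡ 2 * ((3 + y) * (3 + y))
    square′ = solve-∀
    J≡ : ∀ c i → 2 + (14 + (4 * c + i)) ≡ suc (15 + 4 * c) + i
    J≡ = solve-∀
    y = 14 + (4 * c + i)
    square : suc (J + suc i) * suc (J + suc i) + (2 + y * y + 4 * y) ≡ 2 * (suc (J + i) * suc (J + i))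
    square = trans (cong (λ k → suc k * suc k + (2 + y * y + 4 * y)) (trans (+-suc J i) (cong suc (sym (J≡ c i)))))
                   (trans (square′ y) (cong (λ k → 2 * (suc k * suc k)) (J≡ c i)))

-- `m` vertices are chosen at density `μ / n`, and the steps amount to `r` doublings. `scale` treats
-- the expected sizes `(μ ^ d / n) ^ i` of obstacle families, where the second index encodes
-- `i ≤ 3`. `slow` keeps the chosen set much sparser than the density behind the weights. `fits` and
-- `sparse` concern sizes `s` that would violate the theorem with the constant `q`.
record Params (d c C q n : ℕ) : Set where
  field
    j m μ r : ℕ
    j>0    : 0 < j
    m≡     : m ≡ 2 ^ suc j * r
    scale  : ∀ i i′ → i + i′ ≡ 3 → c * μ ^ (i * d) ≤ m * n ^ i
    slow   : c * m ≤ μ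
    m>0    : 0 < m
    μ≤n    : μ ≤ n
    fits   : ∀ s → q * s ^ d < n * ⌊log₂ n ⌋ → suc ⌊log₂ n ⌋ * s < r
    sparse : ∀ s → q * s ^ d < n * ⌊log₂ n ⌋ → 4 * (2 ^ suc d * (C * s ^ d)) ≤ n * j

-- With n about 2 ^ (12 d² j): μ = n^(1/d + 1/(3d²)), m = n^(1/d + 1/(6d²)), and 2 ^ j = n^(1/(12d²)).
params : ∀ d c C → 2 ≤ d → 0 < C → ∃ λ q → 0 < q × ∃ λ N → 0 < N × ∀ n → N ≤ n → Params d c C q n
params d@(suc (suc e)) c C (s≤s (s≤s _)) C>0 = q , q>0 , N , m^n>0 2 (J′ * L) , λ n n≥N → build n n≥N
  where
  open import Data.Nat.DivMod using (_/_; _%_; m≡m%n+[m/n]*n; m%n<n; m/n*n≤m; /-monoˡ-≤; m*n/n≡m)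
  open ≤-Reasoning
  L = 12 * d * d
  -- Since `⌊log₂ n ⌋ ≤ 2 * L * j`, this is the factor for which `q * s ^ d < n * ⌊log₂ n ⌋` gives
  -- `sparse`.
  q = 2 * L * (4 * (2 ^ suc d * C))
  q>0 : 0 < q
  q>0 = *-mono-≤ {1} {2 * L} {1} (s≤s z≤n) (*-mono-≤ {1} {4} {1} (s≤s z≤n) (*-mono-≤ {1} (m^n>0 2 (suc d)) C>0))
  J = proj₁ (exp-beats-square (2 ^ L * (L * L)))
  -- The summand `c` yields `c ≤ j`, so the constant is absorbed by `2 ^ (2 * j)`.
  J′ = J + c
  N = 2 ^ (J′ * L)
  build : ∀ n → N ≤ n → Params d c C q n
  build n n≥N = record
    { j = j ; m = m ; μ = μ ; r = r ; j>0 = j>0 ; m≡ = refl ; scale = scale ; slow = slow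
    ; m>0 = *-mono-≤ {1} (m^n>0 2 (suc j)) (m^n>0 2 (12 * d * j + (j ∸ 1))) ; μ≤n = μ≤n ; fits = fits ; sparse = sparse }
    where
    ℓ = ⌊log₂ n ⌋
    j = ℓ / L
    μ = 2 ^ (2 * j * (6 * d + 2))
    r = 2 ^ (12 * d * j + (j ∸ 1))
    m = 2 ^ suc j * r
    n>0 : 0 < n
    n>0 = ≤-trans (m^n>0 2 (J′ * L)) n≥N
    j≥J′ : J′ ≤ j
    j≥J′ = begin
      J′                           ≡⟨ m*n/n≡m J′ L ⟨
      J′ * L / L                   ≡⟨ cong (_/ L) (⌊log₂[2^n]⌋≡n (J′ * L)) ⟨
      ⌊log₂ 2 ^ (J′ * L) ⌋ / L     ≤⟨ /-monoˡ-≤ L (⌊log₂⌋-mono-≤ n≥N) ⟩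
      ℓ / L ∎
    j≥J : J ≤ j
    j≥J = ≤-trans (m≤m+n J c) j≥J′
    j>0 : 0 < j
    j>0 = ≤-trans (proj₁ (proj₂ (exp-beats-square (2 ^ L * (L * L))))) j≥J
    c≤ : c ≤ 2 ^ (2 * j)
    c≤ = begin
      c ≤⟨ ≤-trans (m≤n+m c J) j≥J′ ⟩ j ≤⟨ <⇒≤ (n<2^n j) ⟩ 2 ^ j ≤⟨ ^-monoʳ-≤ 2 (m≤m+n j (j + 0)) ⟩ 2 ^ (2 * j) ∎
    n≥ : 2 ^ (j * L) ≤ n
    n≥ = ≤-trans (^-monoʳ-≤ 2 (m/n*n≤m ℓ L)) (2^⌊log₂⌋≤ n n>0)
    ℓ< : suc ℓ ≤ suc j * L
    ℓ< = begin-strict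
      ℓ               ≡⟨ m≡m%n+[m/n]*n ℓ L ⟩
      ℓ % L + j * L   <⟨ +-monoˡ-< (j * L) (m%n<n ℓ L) ⟩
      L + j * L ∎
    m≡2^ : m ≡ 2 ^ (2 * j + 12 * d * j)
    m≡2^ = trans (sym (^-distribˡ-+-* 2 (suc j) _)) (cong (2 ^_) (trans (sh j (12 * d * j) (j ∸ 1))
             (cong (λ k → j + k + 12 * d * j) (trans (m+[n∸m]≡n j>0) (sym (+-identityʳ j))))))
      where sh : ∀ a b c → suc a + (b + c) ≡ a + (1 + c) + b
            sh = solve-∀
    scale : ∀ i i′ → i + i′ ≡ 3 → c * μ ^ (i * d) ≤ m * n ^ i
    -- `μ ^ (i * d)` exceeds `(2 ^ (j * L)) ^ i` by the factor `2 ^ (4 * d * j * i)`. As `i ≤ 3`,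
    -- this is at most `2 ^ (12 * d * j)`, whence the exponent in `r` and `m`.
    scale i i′ e₃ = begin
      c * μ ^ (i * d)                                          ≤⟨ *-monoˡ-≤ (μ ^ (i * d)) c≤ ⟩
      2 ^ (2 * j) * μ ^ (i * d)                                ≡⟨ cong (2 ^ (2 * j) *_) (^-*-assoc 2 (2 * j * (6 * d + 2)) (i * d)) ⟩
      2 ^ (2 * j) * 2 ^ (2 * j * (6 * d + 2) * (i * d))        ≡⟨ ^-distribˡ-+-* 2 (2 * j) _ ⟨
      2 ^ (2 * j + 2 * j * (6 * d + 2) * (i * d))              ≤⟨ ^-monoʳ-≤ 2 (≤-trans (m≤m+n _ (4 * d * j * i′)) (≤-reflexive (trans (ex i i′ j d) (cong (λ k → 2 * j + 4 * k * d * j + j * (12 * d * d) * i) e₃)))) ⟩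
      2 ^ (2 * j + 12 * d * j + j * (12 * d * d) * i)                  ≡⟨ ^-distribˡ-+-* 2 (2 * j + 12 * d * j) _ ⟩
      2 ^ (2 * j + 12 * d * j) * 2 ^ (j * L * i)               ≡⟨ cong₂ _*_ (sym m≡2^) (sym (^-*-assoc 2 (j * L) i)) ⟩
      m * (2 ^ (j * L)) ^ i                                    ≤⟨ *-monoʳ-≤ m (^-monoˡ-≤ i n≥) ⟩
      m * n ^ i ∎
      where ex : ∀ i i′ j d → 2 * j + 2 * j * (6 * d + 2) * (i * d) + 4 * d * j * i′ ≡ 2 * j + 4 * (i + i′) * d * j + j * (12 * d * d) * i
            ex = solve-∀
    slow : c * m ≤ μ
    slow = begin
      c * m                                    ≤⟨ *-mono-≤ c≤ (≤-reflexive m≡2^) ⟩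
      2 ^ (2 * j) * 2 ^ (2 * j + 12 * d * j)   ≡⟨ ^-distribˡ-+-* 2 (2 * j) _ ⟨
      2 ^ (2 * j + (2 * j + 12 * d * j))       ≡⟨ cong (2 ^_) (ex j d) ⟩
      μ ∎
      where ex : ∀ j d → 2 * j + (2 * j + 12 * d * j) ≡ 2 * j * (6 * d + 2)
            ex = solve-∀
    μ≤n : μ ≤ n
    μ≤n = ≤-trans (^-monoʳ-≤ 2 (≤-trans (m≤m+n (2 * j * (6 * d + 2)) ((20 + 36 * e + 12 * e * e) * j)) (≤-reflexive (ex j e)))) n≥
      where ex : ∀ j e → 2 * j * (6 * (2 + e) + 2) + (20 + 36 * e + 12 * e * e) * j ≡ j * (12 * (2 + e) * (2 + e))
            ex = solve-∀
    ℓ≤2Lj : ℓ ≤ 2 * L * j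
    ℓ≤2Lj = begin
      ℓ             ≤⟨ <⇒≤ ℓ< ⟩
      L + j * L     ≤⟨ +-monoˡ-≤ (j * L) (≤-trans (≤-reflexive (sym (*-identityˡ L))) (*-monoˡ-≤ L j>0)) ⟩
      j * L + j * L ≡⟨ ex j L ⟩
      2 * L * j ∎
      where ex : ∀ j L → j * L + j * L ≡ 2 * L * j
            ex = solve-∀
    sparse : ∀ s → q * s ^ d < n * ℓ → 4 * (2 ^ suc d * (C * s ^ d)) ≤ n * j
    sparse s h = *-cancelˡ-≤ (2 * L) (begin
      2 * L * (4 * (2 ^ suc d * (C * s ^ d))) ≡⟨ ex (2 * L) (2 ^ suc d) C (s ^ d) ⟩
      q * s ^ d       ≤⟨ <⇒≤ h ⟩
      n * ℓ           ≤⟨ *-monoʳ-≤ n ℓ≤2Lj ⟩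
      n * (2 * L * j) ≡⟨ ex′ n (2 * L) j ⟩
      2 * L * (n * j) ∎)
      where ex : ∀ a b c x → a * (4 * (b * (c * x))) ≡ a * (4 * (b * c)) * x
            ex = solve-∀
            ex′ : ∀ n a j → n * (a * j) ≡ a * (n * j)
            ex′ = solve-∀
    fits : ∀ s → q * s ^ d < n * ℓ → suc ℓ * s < r
    -- In the `d`-th powers, `n` cancels against `2 ^ (j * L)` up to a factor `2 ^ L`. What is left
    -- of `r ^ d` is `(2 ^ (j ∸ 1)) ^ d`, which beats the remaining powers of the logarithm.
    fits s h = ≰⇒> (λ r≤ → <⇒≱ big (begin
        (2 ^ (j ∸ 1)) ^ d ≤⟨ *-cancelˡ-≤ (2 ^ (j * L)) {{m^n≢0 2 (j * L)}} (chain r≤) ⟩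
        a ^ suc d * 2 ^ L ≤⟨ *-mono-≤ pow₁ pow₂ ⟩
        (a * a) ^ d * (2 ^ L) ^ d ≡⟨ ^-distribʳ-* (a * a) (2 ^ L) d ⟨
        (a * a * 2 ^ L) ^ d ∎))
      where
      a = suc j * L
      big : (a * a * 2 ^ L) ^ d < (2 ^ (j ∸ 1)) ^ d
      big = ^-monoˡ-< d (subst (_< 2 ^ (j ∸ 1)) (ex (2 ^ L) L (suc j)) (proj₂ (proj₂ (exp-beats-square (2 ^ L * (L * L)))) j j≥J))
        where ex : ∀ p L k → p * (L * L) * (k * k) ≡ k * L * (k * L) * p
              ex = solve-∀
      a≥1 : 1 ≤ a
      a≥1 = ≤-trans (s≤s z≤n) ℓ<
      pow₁ : a ^ suc d ≤ (a * a) ^ d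
      pow₁ = begin
        a * a ^ d      ≤⟨ *-monoˡ-≤ (a ^ d) (≤-trans (≤-reflexive (sym (*-identityʳ a))) (*-monoʳ-≤ a (m^n>0 a {{>-nonZero a≥1}} (suc e)))) ⟩
        a ^ d * a ^ d  ≡⟨ ^-distribʳ-* a a d ⟨
        (a * a) ^ d ∎
      pow₂ : 2 ^ L ≤ (2 ^ L) ^ d
      pow₂ = ≤-trans (≤-reflexive (sym (*-identityʳ (2 ^ L)))) (*-monoʳ-≤ (2 ^ L) (m^n>0 (2 ^ L) {{m^n≢0 2 L}} (suc e)))
      chain : r ≤ suc ℓ * s → 2 ^ (j * L) * (2 ^ (j ∸ 1)) ^ d ≤ 2 ^ (j * L) * (a ^ suc d * 2 ^ L)
      chain r≤ = begin
        2 ^ (j * L) * (2 ^ (j ∸ 1)) ^ d ≡⟨ cong (2 ^ (j * L) *_) (^-*-assoc 2 (j ∸ 1) d) ⟩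
        2 ^ (j * L) * 2 ^ ((j ∸ 1) * d) ≡⟨ ^-distribˡ-+-* 2 (j * L) _ ⟨
        2 ^ (j * L + (j ∸ 1) * d)       ≡⟨ cong (2 ^_) (ex j d (j ∸ 1)) ⟩
        2 ^ ((12 * d * j + (j ∸ 1)) * d) ≡⟨ ^-*-assoc 2 (12 * d * j + (j ∸ 1)) d ⟨
        r ^ d                           ≤⟨ ^-monoˡ-≤ d r≤ ⟩
        (suc ℓ * s) ^ d                 ≡⟨ ^-distribʳ-* (suc ℓ) s d ⟩
        suc ℓ ^ d * s ^ d               ≤⟨ *-monoʳ-≤ (suc ℓ ^ d) (≤-trans (≤-trans (≤-reflexive (sym (*-identityˡ _))) (*-monoˡ-≤ (s ^ d) q>0)) (<⇒≤ h)) ⟩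
        suc ℓ ^ d * (n * ℓ)             ≤⟨ *-mono-≤ (^-monoˡ-≤ d ℓ<) (*-mono-≤ (≤-trans (<⇒≤ (<2^⌊log₂⌋ n)) (^-monoʳ-≤ 2 ℓ<)) (<⇒≤ ℓ<)) ⟩
        a ^ d * (2 ^ a * a)             ≡⟨ cong (λ p → a ^ d * (p * a)) (^-distribˡ-+-* 2 L (j * L)) ⟩
        a ^ d * (2 ^ L * 2 ^ (j * L) * a) ≡⟨ ex′ (a ^ d) (2 ^ L) (2 ^ (j * L)) a ⟩
        2 ^ (j * L) * (a ^ suc d * 2 ^ L) ∎
        where
        ex : ∀ j d i → j * (12 * d * d) + i * d ≡ (12 * d * j + i) * d
        ex = solve-∀
        ex′ : ∀ x p q a → x * (p * q * a) ≡ q * (a * x * p)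
        ex′ = solve-∀

-- Compound growth

bernoulli : ∀ Q k → (Q + k) * Q ^ k ≤ Q * suc Q ^ k
bernoulli Q zero    = ≤-reflexive (cong (_* 1) (+-identityʳ Q))
bernoulli Q (suc k) = begin
  (Q + suc k) * (Q * Q ^ k)         ≤⟨ m≤m+n _ (k * Q ^ k) ⟩
  (Q + suc k) * (Q * Q ^ k) + k * Q ^ k ≡⟨ ex Q k (Q ^ k) ⟩
  suc Q * ((Q + k) * Q ^ k)         ≤⟨ *-monoʳ-≤ (suc Q) (bernoulli Q k) ⟩
  suc Q * (Q * suc Q ^ k)           ≡⟨ ex′ (suc Q) Q (suc Q ^ k) ⟩
  Q * (suc Q * suc Q ^ k) ∎
  where
  open ≤-Reasoning
  ex : ∀ Q k p → (Q + (1 + k)) * (Q * p) + k * p ≡ (1 + Q) * ((Q + k) * p)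
  ex = solve-∀
  ex′ : ∀ a b c → a * (b * c) ≡ b * (a * c)
  ex′ = solve-∀

doubling : ∀ Q → 0 < Q → 2 * Q ^ Q ≤ suc Q ^ Q
doubling Q Q>0 = *-cancelˡ-≤ Q {{>-nonZero Q>0}} (≤-trans (≤-reflexive (ex Q (Q ^ Q))) (bernoulli Q Q))
  where ex : ∀ Q p → Q * (2 * p) ≡ (Q + Q) * p
        ex = solve-∀

-- By Bernoulli's inequality `Q` steps with growth factor `1 + 1 / Q` at least double a quantity, so
-- `Q * r` of them produce `2 ^ r`.
growth-bound : ∀ Q r Z x → 0 < Q → suc Q ^ (Q * r) ≤ Q ^ (Q * r) * Z → Z ≤ 2 ^ x → r ≤ x
growth-bound Q r Z x Q>0 grow Z≤ = ≮⇒≥ (λ x<r → <⇒≱ (^-monoʳ-< 2 (s≤s (s≤s z≤n)) x<r)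
  (*-cancelˡ-≤ (Q ^ (Q * r)) {{m^n≢0 Q (Q * r) {{>-nonZero Q>0}}}} (begin
    Q ^ (Q * r) * 2 ^ r     ≡⟨ *-comm (Q ^ (Q * r)) (2 ^ r) ⟩
    2 ^ r * Q ^ (Q * r)     ≡⟨ cong (2 ^ r *_) (^-*-assoc Q Q r) ⟨
    2 ^ r * (Q ^ Q) ^ r     ≡⟨ distrib r ⟨
    (2 * Q ^ Q) ^ r         ≤⟨ ^-monoˡ-≤ r (doubling Q Q>0) ⟩
    (suc Q ^ Q) ^ r         ≡⟨ ^-*-assoc (suc Q) Q r ⟩
    suc Q ^ (Q * r)         ≤⟨ grow ⟩
    Q ^ (Q * r) * Z         ≤⟨ *-monoʳ-≤ (Q ^ (Q * r)) Z≤ ⟩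
    Q ^ (Q * r) * 2 ^ x ∎)))
  where
  open ≤-Reasoning
  distrib : ∀ r → (2 * Q ^ Q) ^ r ≡ 2 ^ r * (Q ^ Q) ^ r
  distrib zero    = refl
  distrib (suc r) = trans (cong (2 * Q ^ Q *_) (distrib r)) (ex (Q ^ Q) (2 ^ r) ((Q ^ Q) ^ r))
    where ex : ∀ p a b → 2 * p * (a * b) ≡ 2 * a * (p * b)
          ex = solve-∀

-- At density μ / n a Sparse family has expected size at most a constant fraction of m.
record Sparse {n} (d c : ℕ) (Os : List (Subset n)) : Set where
  constructor mkSparse
  field
    i i′ z z′ : ℕ
    i+i′  : i + i′ ≡ 3
    z≡    : z ≡ z′ + i
    z≤    : z ≤ i * d
    sizes : ∀ O → O ∈ᴸ Os → ∣ O ∣ ≡ z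
    few   : length Os ≤ c * n ^ z′

-- Expected numbers of obstacles

module _ {n d c C q : ℕ} (d≥2 : 2 ≤ d) (P : Params d c C q n) (c≥4 : 4 ≤ c) where
  open Params P
  open ≤-Reasoning

  private
    -- Bounds the size of every obstacle: a pair of edges has at most `2 + 2 * d` vertices,
    -- triangles and sparse families at most `3 * d`.
    K = 2 + (d + (d + d))

    μ>0 : 0 < μ
    μ>0 = ≤-trans (*-mono-≤ {1} {c} (≤-trans (s≤s z≤n) c≥4) m>0) slow

    n>0 : 0 < n
    n>0 = ≤-trans μ>0 μ≤n

  i*d≤ : ∀ {i i′} → i + i′ ≡ 3 → i * d ≤ d + (d + d)
  i*d≤ {i} {i′} e = ≤-trans (*-monoˡ-≤ d (m≤m+n i i′)) (≤-reflexive (trans (cong (_* d) e) (cong (λ x → d + (d + x)) (+-identityʳ d))))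

  light : ∀ a i i′ l → i + i′ ≡ 3 → 4 * a ≤ c → l ≤ a * (μ ^ (i * d) * n ^ (K ∸ i)) → 4 * l ≤ m * n ^ K
  light a i i′ l e a≤ l≤ = begin
    4 * l                                ≤⟨ *-monoʳ-≤ 4 l≤ ⟩
    4 * (a * (μ ^ (i * d) * n ^ (K ∸ i))) ≡⟨ ex a (μ ^ (i * d)) (n ^ (K ∸ i)) ⟩
    4 * a * μ ^ (i * d) * n ^ (K ∸ i)    ≤⟨ *-monoˡ-≤ (n ^ (K ∸ i)) (≤-trans (*-monoˡ-≤ (μ ^ (i * d)) a≤) (scale i i′ e)) ⟩
    m * n ^ i * n ^ (K ∸ i)              ≡⟨ *-assoc m (n ^ i) _ ⟩
    m * (n ^ i * n ^ (K ∸ i))            ≡⟨ cong (m *_) (trans (sym (^-distribˡ-+-* n i (K ∸ i))) (cong (n ^_) (m+[n∸m]≡n i≤K))) ⟩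
    m * n ^ K ∎
    where
    ex : ∀ a x y → 4 * (a * (x * y)) ≡ 4 * a * x * y
    ex = solve-∀
    i≤K : i ≤ K
    i≤K = ≤-trans (≤-trans (m≤m+n i i′) (≤-reflexive e)) (s≤s (s≤s (≤-trans (≤-trans (s≤s z≤n) d≥2) (m≤m+n d (d + d)))))

  sparse-small : ∀ {a} {Os : List (Subset n)} → Sparse d a Os → ∀ O → O ∈ᴸ Os → ∣ O ∣ ≤ K
  sparse-small S O m = ≤-trans (≤-reflexive (sizes O m)) (≤-trans z≤ (≤-trans (i*d≤ {i} {i′} i+i′) (m≤n+m _ 2)))
    where open Sparse S

  -- At density `μ / n`, `n ^ z′` obstacles of size `z` have expected number `μ ^ z / n ^ i`, which
  -- `z ≤ i * d` bounds by `(μ ^ d / n) ^ i`; `scale` compares this with `m`.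
  sparse-light : ∀ {a} {Os : List (Subset n)} → 4 * a ≤ c → Sparse d a Os →
                 4 * ∑ Os (λ O → μ ^ ∣ O ∣ * n ^ (K ∸ ∣ O ∣)) ≤ m * n ^ K
  sparse-light {a} {Os} a≤ S = light a i i′ _ i+i′ a≤ (begin
    ∑ Os (λ O → μ ^ ∣ O ∣ * n ^ (K ∸ ∣ O ∣)) ≤⟨ ∑-mono∈ Os (λ O m → ≤-reflexive (cong (λ k → μ ^ k * n ^ (K ∸ k)) (sizes O m))) ⟩
    ∑ Os (λ O → μ ^ z * n ^ (K ∸ z))         ≡⟨ ∑-const Os _ ⟩
    length Os * (μ ^ z * n ^ (K ∸ z))        ≤⟨ *-mono-≤ few (*-monoˡ-≤ (n ^ (K ∸ z)) (^-monoʳ-≤ μ {{>-nonZero μ>0}} z≤)) ⟩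
    a * n ^ z′ * (μ ^ (i * d) * n ^ (K ∸ z)) ≡⟨ ex a (n ^ z′) (μ ^ (i * d)) (n ^ (K ∸ z)) ⟩
    a * (μ ^ (i * d) * (n ^ z′ * n ^ (K ∸ z))) ≡⟨ cong (λ x → a * (μ ^ (i * d) * x)) (trans (sym (^-distribˡ-+-* n z′ (K ∸ z))) (cong (n ^_) exponent)) ⟩
    a * (μ ^ (i * d) * n ^ (K ∸ i)) ∎)
    where
    open Sparse S
    ex : ∀ a x p y → a * x * (p * y) ≡ a * (p * (x * y))
    ex = solve-∀
    exponent : z′ + (K ∸ z) ≡ K ∸ i
    exponent = +-cancelˡ-≡ i _ _ (trans (trans (sym (+-assoc i z′ _)) (trans (cong (_+ (K ∸ z)) (trans (+-comm i z′) (sym z≡)))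
      (m+[n∸m]≡n (≤-trans z≤ (≤-trans (i*d≤ {i} {i′} i+i′) (m≤n+m _ 2))))))
      (sym (m+[n∸m]≡n (≤-trans (m≤n+m i z′) (≤-trans (≤-reflexive (sym z≡)) (≤-trans z≤ (≤-trans (i*d≤ {i} {i′} i+i′) (m≤n+m _ 2))))))))

  module _ (E : Subset n → Bool) (size : ∀ f → E f ≡ true → ∣ f ∣ ≡ suc d)
           (codegree : ∀ D → ∣ D ∣ ≡ d → ∑ (vecs n) (λ f → ⟦ E f ∧ sub D f ⟧) ≤ C) where
    open Cycles {d = d} {C} E size codegree using (pairs; pairs-load; triangles; triangles-size; triangles-length)

    -- About `n ^ (2 * d ∸ j)` pairs share `j` vertices, which gives `μ ^ (2 + 2 * d ∸ j) / n ^ 2`.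
    -- For `j ≥ 2` this is at most `(μ ^ d / n) ^ 2`, so `i = 2`.
    pairs-light : 4 * (2 ^ suc d * C * C) ≤ c → 4 * ∑ pairs (λ O → μ ^ ∣ O ∣ * n ^ (K ∸ ∣ O ∣)) ≤ m * n ^ K
    pairs-light a≤ = light (2 ^ suc d * C * C) 2 1 _ refl a≤ (begin
      ∑ pairs (λ O → μ ^ ∣ O ∣ * n ^ (K ∸ ∣ O ∣)) ≤⟨ pairs-load (λ k → μ ^ k * n ^ (K ∸ k)) (μ ^ (2 * d) * n ^ (d + d)) each ⟩
      2 ^ suc d * (C * (μ ^ (2 * d) * n ^ (d + d))) * (C * n ^ d) ≡⟨ ex (2 ^ suc d) C (μ ^ (2 * d)) (n ^ (d + d)) (n ^ d) ⟩
      2 ^ suc d * C * C * (μ ^ (2 * d) * (n ^ d * n ^ (d + d))) ≡⟨ cong (λ x → 2 ^ suc d * C * C * (μ ^ (2 * d) * x)) (sym (^-distribˡ-+-* n d (d + d))) ⟩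
      2 ^ suc d * C * C * (μ ^ (2 * d) * n ^ (d + (d + d))) ∎)
      where
      ex : ∀ p C u x y → p * (C * (u * x)) * (C * y) ≡ p * C * C * (u * (y * x))
      ex = solve-∀
      each : ∀ i j → j + i ≡ d → 2 ≤ j → n ^ i * (μ ^ (2 + (d + d) ∸ j) * n ^ (K ∸ (2 + (d + d) ∸ j))) ≤ μ ^ (2 * d) * n ^ (d + d)
      each i j e j≥2 = begin
        n ^ i * (μ ^ z * n ^ (K ∸ z)) ≤⟨ *-monoʳ-≤ (n ^ i) (*-monoˡ-≤ (n ^ (K ∸ z)) (^-monoʳ-≤ μ {{>-nonZero μ>0}} z≤)) ⟩
        n ^ i * (μ ^ (2 * d) * n ^ (K ∸ z)) ≡⟨ ex′ (n ^ i) (μ ^ (2 * d)) (n ^ (K ∸ z)) ⟩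
        μ ^ (2 * d) * (n ^ i * n ^ (K ∸ z)) ≡⟨ cong (μ ^ (2 * d) *_) (trans (sym (^-distribˡ-+-* n i (K ∸ z))) (cong (n ^_) exponent)) ⟩
        μ ^ (2 * d) * n ^ (d + d) ∎
        where
        ex′ : ∀ a b c → a * (b * c) ≡ b * (a * c)
        ex′ = solve-∀
        z = 2 + (d + d) ∸ j
        z≡ : z ≡ 2 + (d + i)
        z≡ = trans (cong (_∸ j) (trans (cong (λ x → 2 + (d + x)) (sym e)) (ex″ d i j))) (m+n∸m≡n j (2 + (d + i)))
          where ex″ : ∀ d i j → 2 + (d + (j + i)) ≡ j + (2 + (d + i))
                ex″ = solve-∀
        z≤ : z ≤ 2 * d
        z≤ = begin
          z ≡⟨ z≡ ⟩ 2 + (d + i) ≤⟨ +-monoˡ-≤ (d + i) j≥2 ⟩ j + (d + i) ≡⟨ ex″ j d i ⟩ d + ((j + i) + 0) ≡⟨ cong (λ x → d + (x + 0)) e ⟩ 2 * d ∎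
          where ex″ : ∀ j d i → j + (d + i) ≡ d + ((j + i) + 0)
                ex″ = solve-∀
        exponent : i + (K ∸ z) ≡ d + d
        exponent = trans (cong (λ x → i + (K ∸ x)) z≡) (trans (cong (i +_) ([m+n]∸[m+o]≡n∸o d (d + d) i))
                     (m+[n∸m]≡n (≤-trans (m≤n+m i j) (≤-trans (≤-reflexive e) (m≤m+n d d)))))

    -- About `n ^ (3 * d ∸ 3)` triangles of size `3 * d` give the order `(μ ^ d / n) ^ 3`, so
    -- `i = 3`, the largest value that `scale` admits.
    triangles-sparse : Sparse d (2 ^ suc d * (2 ^ (2 + (d + d)) * C * C) * C) triangles
    triangles-sparse = mkSparse 3 0 (d + (d + d)) ((d ∸ 2) + (suc (d ∸ 2) + d)) refl eq (≤-reflexive (cong (λ x → d + (d + x)) (sym (+-identityʳ d))))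
        triangles-size (≤-trans (triangles-length (d ∸ 2) (sym (m+[n∸m]≡n d≥2))) (≤-reflexive (begin-equality
          2 ^ suc d * (2 ^ (2 + (d + d)) * (C * n ^ e) * (C * n ^ suc e)) * (C * n ^ d)
            ≡⟨ ex (2 ^ suc d) (2 ^ (2 + (d + d))) C (n ^ e) (n ^ suc e) (n ^ d) ⟩
          2 ^ suc d * (2 ^ (2 + (d + d)) * C * C) * C * (n ^ e * (n ^ suc e * n ^ d))
            ≡⟨ cong (2 ^ suc d * (2 ^ (2 + (d + d)) * C * C) * C *_) (sym (trans (^-distribˡ-+-* n e (suc e + d)) (cong (n ^ e *_) (^-distribˡ-+-* n (suc e) d)))) ⟩
          2 ^ suc d * (2 ^ (2 + (d + d)) * C * C) * C * n ^ (e + (suc e + d)) ∎)))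
      where
      e = d ∸ 2
      ex : ∀ a b C x y z → a * (b * (C * x) * (C * y)) * (C * z) ≡ a * (b * C * C) * C * (x * (y * z))
      ex = solve-∀
      eq : d + (d + d) ≡ e + (suc e + d) + 3
      eq = subst (λ k → k + (k + d) ≡ e + (suc e + d) + 3) (m+[n∸m]≡n d≥2) (ex′ e d)
        where ex′ : ∀ e d → (2 + e) + ((2 + e) + d) ≡ e + ((1 + e) + d) + 3
              ex′ = solve-∀

-- One summand for each demand: 9 makes `m` small against `μ`, `8 * K` keeps the potential within
-- twice its initial bound, and the others are four times the constants of the obstacle families,
-- each of which may use a quarter of the bound.
constant : ℕ → ℕ → ℕ → ℕ
constant d c C = 9 + (8 * (2 + (d + (d + d))) + (4 * c + (4 * (2 ^ suc d * C * C) + 4 * (2 ^ suc d * (2 ^ (2 + (d + d)) * C * C) * C))))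

-- The choice of the vertices

module Process {n d c C q : ℕ} (d≥2 : 2 ≤ d) (P : Params d (constant d c C) C q n)
  (E : Subset n → Bool) (size : ∀ f → E f ≡ true → ∣ f ∣ ≡ suc d)
  (codegree : ∀ D → ∣ D ∣ ≡ d → ∑ (vecs n) (λ f → ⟦ E f ∧ sub D f ⟧) ≤ C)
  (Os₁ Os₂ : List (Subset n)) (S₁ : Sparse d c Os₁) (S₂ : Sparse d c Os₂)
  (s : ℕ) (s-small : q * s ^ d < n * ⌊log₂ n ⌋) where

  open Params P
  open Growth E
  open Cycles {d = d} {C} E size codegree hiding (linear; triangle-free)
  private module Cyc = Cycles {d = d} {C} E size codegree

  K = 2 + (d + (d + d))

  Os = Os₁ ++ (Os₂ ++ (pairs ++ triangles))

  open Potential {n} K μ Os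

  c₁ c₂ c₃ : ℕ
  c₁ = 4 * c
  c₂ = 4 * (2 ^ suc d * C * C)
  c₃ = 4 * (2 ^ suc d * (2 ^ (2 + (d + d)) * C * C) * C)

  ≥4 : 4 ≤ constant d c C
  ≥4 = s≤s (s≤s (s≤s (s≤s z≤n)))

  small : ∀ O → O ∈ᴸ Os → ∣ O ∣ ≤ K
  small O m with ∈-++⁻ Os₁ m
  ... | inj₁ h = sparse-small d≥2 P ≥4 S₁ O h
  ... | inj₂ m′ with ∈-++⁻ Os₂ m′
  ... | inj₁ h = sparse-small d≥2 P ≥4 S₂ O h
  ... | inj₂ m″ with ∈-++⁻ pairs m″
  ... | inj₁ h = ≤-trans (pairs-small O h) (s≤s (s≤s (+-monoʳ-≤ d (m≤m+n d d))))
  ... | inj₂ h = ≤-trans (≤-reflexive (triangles-size O h)) (m≤n+m _ 2)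

  B : ℕ
  B = m * n ^ K

  load : Φ ∅ ≤ B
  load = *-cancelˡ-≤ 4 (begin
    4 * Φ ∅ ≡⟨ cong (4 *_) (∑-cong Os (λ O → cong (λ p → term ∣ p ∣) (whole O))) ⟩
    4 * ∑ Os w ≡⟨ cong (4 *_) (trans (∑-++ Os₁ _ w) (cong (∑ Os₁ w +_) (trans (∑-++ Os₂ _ w) (cong (∑ Os₂ w +_) (∑-++ pairs triangles w))))) ⟩
    4 * (∑ Os₁ w + (∑ Os₂ w + (∑ pairs w + ∑ triangles w))) ≡⟨ ex (∑ Os₁ w) (∑ Os₂ w) (∑ pairs w) (∑ triangles w) ⟩
    4 * ∑ Os₁ w + (4 * ∑ Os₂ w + (4 * ∑ pairs w + 4 * ∑ triangles w))
      ≤⟨ +-mono-≤ (sparse-light d≥2 P ≥4 c₁≤ S₁) (+-mono-≤ (sparse-light d≥2 P ≥4 c₁≤ S₂)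
           (+-mono-≤ (pairs-light d≥2 P ≥4 E size codegree c₂≤)
                     (sparse-light d≥2 P ≥4 c₃≤ (triangles-sparse d≥2 P ≥4 E size codegree)))) ⟩
    B + (B + (B + B)) ≡⟨ ex′ B ⟩
    4 * B ∎)
    where
    open ≤-Reasoning
    w : Subset n → ℕ
    w O = term ∣ O ∣
    whole : ∀ (O : Subset n) → O ∖ ∅ ≡ O
    whole O = ⊑-antisym (λ i → proj₁ ∘ ∖-∋ O ∅) (λ i x → ∋-∖ O ∅ x (∉∅ i))
    ex : ∀ a b c d → 4 * (a + (b + (c + d))) ≡ 4 * a + (4 * b + (4 * c + 4 * d))
    ex = solve-∀
    ex′ : ∀ B → B + (B + (B + B)) ≡ 4 * B
    ex′ = solve-∀
    rest : ∀ {x} → x ≤ c₁ + (c₂ + c₃) → x ≤ constant d c C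
    rest h = ≤-trans h (≤-trans (m≤n+m _ (8 * K)) (m≤n+m _ 9))
    c₁≤ : c₁ ≤ constant d c C
    c₁≤ = rest (m≤m+n c₁ (c₂ + c₃))
    c₂≤ : c₂ ≤ constant d c C
    c₂≤ = rest (≤-trans (m≤m+n c₂ c₃) (m≤n+m _ c₁))
    c₃≤ : c₃ ≤ constant d c C
    c₃≤ = rest (≤-trans (m≤n+m c₃ c₂) (m≤n+m _ c₁))

  8K≤ : 8 * K ≤ constant d c C
  8K≤ = ≤-trans (m≤m+n (8 * K) _) (m≤n+m _ 9)

  Q : ℕ
  Q = 2 ^ suc j

  -- With fractions, `ΦM` reads `Φ M ≤ B * (1 + 8 * K * t / μ)` and `grown` reads
  -- `Z M ≥ (1 + 1 / Q) ^ t`.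
  record State (t : ℕ) : Set where
    field
      M     : Subset n
      ∣M∣   : ∣ M ∣ ≡ t
      free  : Free M
      ΦM    : μ * Φ M ≤ μ * B + 8 * K * t * B
      grown : suc Q ^ t ≤ Q ^ t * Z M

  module _ (no-big : ∀ M → Free M → ∀ I → I ⊑ M → ind I ≡ true → ∣ I ∣ ≤ s) where
    open ≤-Reasoning

    μ>0 : 0 < μ
    μ>0 = ≤-trans (*-mono-≤ {1} {constant d c C} (s≤s z≤n) m>0) slow

    n>0 : 0 < n
    n>0 = ≤-trans μ>0 μ≤n

    initial : (∀ O → O ∈ᴸ Os → 0 < ∣ O ∣) → State 0
    initial nonempty = record
      { M = ∅ ; ∣M∣ = ∣∅∣ n
      ; free = λ O m h → <⇒≱ (nonempty O m) (≤-trans (∣⊑∣ O ∅ h) (≤-reflexive (∣∅∣ n)))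
      ; ΦM = ≤-trans (*-monoʳ-≤ μ load) (m≤m+n _ _)
      ; grown = ≤-trans (≤-trans (≤-reflexive (sym (⟦⟧-true {A ∅ ∅} (true-∧ (⊑⇒sub {n} ∅ ∅ (λ i x → x)) (ind-intro ∅ (λ f e h →
          <⇒≱ (subst (0 <_) (sym (size f e)) z<s) (≤-trans (∣⊑∣ f ∅ h) (≤-reflexive (∣∅∣ n)))))))))
          (∑-∈ (λ I → ⟦ A ∅ I ⟧) (∈-vecs ∅))) (≤-reflexive (sym (+-identityʳ _))) }

    advance : ∀ {t} → t < m → State t → State (suc t)
    -- The demand on `X M v` is the premise of `Z-grows`, whose `suc (suc d)` is the present
    -- `suc d`. The bound `2 * B` holds throughout because `8 * K * t ≤ μ`.
    advance {t} t<m st = result (extend small M (2 * B) (λ v → 2 ^ suc d * X M v) (j * Z M) free Φ≤2B M-small B-small X-small)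
      where
      open State st
      tm : 8 * K * t ≤ μ
      tm = ≤-trans (*-mono-≤ 8K≤ (<⇒≤ t<m)) slow
      Φ≤2B : Φ M ≤ 2 * B
      Φ≤2B = *-cancelˡ-≤ μ {{>-nonZero μ>0}} (≤-trans ΦM (≤-trans (+-monoʳ-≤ (μ * B) (*-monoˡ-≤ B tm)) (≤-reflexive (ex μ B))))
        where ex : ∀ μ B → μ * B + μ * B ≡ μ * (2 * B)
              ex = solve-∀
      9m≤ : 9 * m ≤ μ
      9m≤ = ≤-trans (*-monoˡ-≤ m (m≤m+n 9 (8 * K + (c₁ + (c₂ + c₃))))) slow
      M-small : 4 * ∣ M ∣ < n
      M-small = begin-strict
        4 * ∣ M ∣ ≡⟨ cong (4 *_) ∣M∣ ⟩
        4 * t <⟨ *-monoʳ-< 4 t<m ⟩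
        4 * m ≤⟨ *-monoˡ-≤ m (m≤m+n 4 5) ⟩
        9 * m ≤⟨ 9m≤ ⟩ μ ≤⟨ μ≤n ⟩ n ∎
      B-small : 4 * (2 * B) < n * term 1
      B-small = begin-strict
        4 * (2 * (m * n ^ K)) ≡⟨ ex m (n ^ K) ⟩
        8 * m * n ^ K <⟨ *-monoˡ-< (n ^ K) {{m^n≢0 n K {{>-nonZero n>0}}}} (≤-trans (+-monoˡ-≤ (8 * m) m>0) 9m≤) ⟩
        μ * n ^ K ≡⟨ ex′ μ n (n ^ (1 + (d + (d + d)))) ⟩
        n * (μ * 1 * n ^ (1 + (d + (d + d)))) ∎
        where ex : ∀ m x → 4 * (2 * (m * x)) ≡ 8 * m * x
              ex = solve-∀
              ex′ : ∀ μ n x → μ * (n * x) ≡ n * (μ * 1 * x)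
              ex′ = solve-∀
      X-small : 4 * ∑ (fins n) (λ v → 2 ^ suc d * X M v) < n * suc (j * Z M)
      X-small = begin-strict
        4 * ∑ (fins n) (λ v → 2 ^ suc d * X M v) ≡⟨ cong (4 *_) (∑-* (fins n) (2 ^ suc d) (X M)) ⟩
        4 * (2 ^ suc d * ∑ (fins n) (X M)) ≤⟨ *-monoʳ-≤ 4 (*-monoʳ-≤ (2 ^ suc d)
           (∑-X {d} {C} {s ^ d} size codegree M (λ I I⊑M i → ^-monoˡ-≤ d (no-big M free I I⊑M i)))) ⟩
        4 * (2 ^ suc d * (C * s ^ d * Z M)) ≡⟨ ex (2 ^ suc d) (C * s ^ d) (Z M) ⟩
        4 * (2 ^ suc d * (C * s ^ d)) * Z M ≤⟨ *-monoˡ-≤ (Z M) (Params.sparse P s s-small) ⟩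
        n * j * Z M ≡⟨ *-assoc n j (Z M) ⟩
        n * (j * Z M) <⟨ *-monoʳ-< n {{>-nonZero n>0}} (n<1+n (j * Z M)) ⟩
        n * suc (j * Z M) ∎
        where ex : ∀ a b z → 4 * (a * (b * z)) ≡ 4 * (a * b) * z
              ex = solve-∀
      result : (∃ λ v → ¬ M ∋ v × 2 ^ suc d * X M v ≤ j * Z M × Free (add v M) × μ * Φ (add v M) ≤ μ * Φ M + 4 * K * (2 * B)) →
               State (suc t)
      result (v , v∉M , X≤ , free′ , Φ′) = record
        { M = add v M ; ∣M∣ = trans (∣add∣ v M v∉M) (cong suc ∣M∣) ; free = free′
        ; ΦM = ≤-trans Φ′ (≤-trans (+-monoˡ-≤ (4 * K * (2 * B)) ΦM) (≤-reflexive (ex μ B K t)))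
        ; grown = begin
            suc Q * suc Q ^ t ≤⟨ *-monoʳ-≤ (suc Q) grown ⟩
            suc Q * (Q ^ t * Z M) ≡⟨ swap (suc Q) (Q ^ t) (Z M) ⟩
            Q ^ t * (suc Q * Z M) ≤⟨ *-monoʳ-≤ (Q ^ t) (grow (d ∸ 1) (m+[n∸m]≡n (≤-trans (s≤s z≤n) d≥2))) ⟩
            Q ^ t * (Q * Z (add v M)) ≡⟨ swap′ (Q ^ t) Q (Z (add v M)) ⟩
            Q * Q ^ t * Z (add v M) ∎ }
        where
        ex : ∀ μ B K t → μ * B + 8 * K * t * B + 4 * K * (2 * B) ≡ μ * B + 8 * K * (1 + t) * B
        ex = solve-∀
        swap : ∀ a b c → a * (b * c) ≡ b * (a * c)
        swap = solve-∀
        swap′ : ∀ a b c → a * (b * c) ≡ b * a * c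
        swap′ = solve-∀
        lin : Linear (add v M)
        lin = Cyc.linear (add v M) (λ O m → free′ O (∈-++⁺ʳ Os₁ (∈-++⁺ʳ Os₂ (∈-++⁺ˡ m))))
        tri : TriangleFree (add v M)
        tri = Cyc.triangle-free (add v M) lin (λ O m → free′ O (∈-++⁺ʳ Os₁ (∈-++⁺ʳ Os₂ (∈-++⁺ʳ pairs m))))
        grow : ∀ e → suc e ≡ d → suc Q * Z M ≤ Q * Z (add v M)
        grow e refl = Step.Z-grows size j M v v∉M lin tri j>0 X≤

    run : (∀ O → O ∈ᴸ Os → 0 < ∣ O ∣) → ∀ t → t ≤ m → State t
    run nonempty zero    _   = initial nonempty
    run nonempty (suc t) t<m = advance t<m (run nonempty t (<⇒≤ t<m))

    -- After `m = Q * r` steps `Z M` has doubled `r` times, but it counts sets with at most `s`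
    -- elements, of which there are at most `suc n ^ s`.
    contradictory : (∀ O → O ∈ᴸ Os → 0 < ∣ O ∣) → ⊥
    contradictory nonempty = <⇒≱ (fits s s-small) (growth-bound Q r (Z M) (suc ⌊log₂ n ⌋ * s) (m^n>0 2 (suc j))
      (subst (λ k → suc Q ^ k ≤ Q ^ k * Z M) m≡ grown) (begin
        Z M ≤⟨ ∑-mono (vecs n) (λ I → ⟦⟧-mono (λ h → ≤ᵇ-intro (no-big M free I (sub⇒⊑ I M (proj₁ (∧-true h))) (proj₂ (∧-true {sub I M} h))))) ⟩
        ∑ (vecs n) (λ I → ⟦ ∣ I ∣ ≤ᵇ s ⟧) ≤⟨ count-small n s ⟩
        suc n ^ s ≤⟨ ^-monoˡ-≤ s (<2^⌊log₂⌋ n) ⟩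
        (2 ^ suc ⌊log₂ n ⌋) ^ s ≡⟨ ^-*-assoc 2 (suc ⌊log₂ n ⌋) s ⟩
        2 ^ (suc ⌊log₂ n ⌋ * s) ∎))
      where open State (run nonempty m ≤-refl)

-- The ordered field ℝ

module Field (R : RealField) where
  open RealField R public
    renaming ( Carrier to ℝ; _+_ to infixl 6 _⊕_; _*_ to infixl 7 _⊗_; -_ to infix 8 ⊖_; 0# to 𝟘; 1# to 𝟙; _<_ to infix 4 _≺_
             ; +-assoc to ⊕-assoc; +-comm to ⊕-comm; +-identity to ⊕-identity; +-inverse to ⊕-inverse
             ; *-assoc to ⊗-assoc; *-comm to ⊗-comm; *-identity to ⊗-identity; distrib to ⊗-distrib
             ; *-inverse to ⊗-inverse; <-irrefl to ≺-irrefl; <-trans to ≺-trans; <-trichotomy to ≺-trichotomy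
             ; +-mono-< to ⊕-mono-≺; *-pos to ⊗-pos; 0≢1 to 𝟘≢𝟙 )

  open import Algebra.Bundles using (CommutativeRing)
  open import Algebra.Solver.Ring.AlmostCommutativeRing using (fromCommutativeRing; _-Raw-AlmostCommutative⟶_)
  open import Data.Integer as ℤ using (ℤ; +_; -[1+_])
  import Data.Integer.Properties as ℤ
  open import Data.Maybe using (Maybe; just; nothing)

  commutativeRing : CommutativeRing _ _
  commutativeRing = record
    { Carrier = ℝ ; _≈_ = _≡_ ; _+_ = _⊕_ ; _*_ = _⊗_ ; -_ = ⊖_ ; 0# = 𝟘 ; 1# = 𝟙
    ; isCommutativeRing = record
      { isRing = record
        { +-isAbelianGroup = record
          { isGroup = record
            { isMonoid = record
              { isSemigroup = record { isMagma = record { isEquivalence = isEquivalence ; ∙-cong = cong₂ _⊕_ } ; assoc = ⊕-assoc }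
              ; identity = ⊕-identity , λ x → trans (⊕-comm x 𝟘) (⊕-identity x) }
            ; inverse = (λ x → trans (⊕-comm (⊖ x) x) (⊕-inverse x)) , ⊕-inverse
            ; ⁻¹-cong = cong ⊖_ }
          ; comm = ⊕-comm }
        ; *-cong = cong₂ _⊗_
        ; *-assoc = ⊗-assoc
        ; *-identity = ⊗-identity , λ x → trans (⊗-comm x 𝟙) (⊗-identity x)
        ; distrib = ⊗-distrib , λ x y z → trans (⊗-comm (y ⊕ z) x) (trans (⊗-distrib x y z) (cong₂ _⊕_ (⊗-comm x y) (⊗-comm x z))) }
      ; *-comm = ⊗-comm } }

  private
    module CR = CommutativeRing commutativeRing
    open import Algebra.Properties.Ring CR.ring using (-‿distribˡ-*; -‿distribʳ-*; -‿+-comm; -‿involutive; -0#≈0#)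

    -- The separate case for 1 makes `con (+ 1)` denote `𝟙` itself and not `𝟙 ⊕ 𝟘`, so that solved
    -- equations match their goals definitionally.
    ι : ℕ → ℝ
    ι zero          = 𝟘
    ι (suc zero)    = 𝟙
    ι (suc (suc n)) = 𝟙 ⊕ ι (suc n)

    ι-suc : ∀ n → ι (suc n) ≡ 𝟙 ⊕ ι n
    ι-suc zero    = sym (CR.+-identityʳ 𝟙)
    ι-suc (suc n) = refl

    ι-+ : ∀ m n → ι (m + n) ≡ ι m ⊕ ι n
    ι-+ zero    n = sym (⊕-identity _)
    ι-+ (suc m) n = trans (ι-suc (m + n)) (trans (cong (𝟙 ⊕_) (ι-+ m n)) (trans (sym (⊕-assoc 𝟙 (ι m) (ι n))) (cong (_⊕ ι n) (sym (ι-suc m)))))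

    ι-* : ∀ m n → ι (m * n) ≡ ι m ⊗ ι n
    ι-* zero    n = sym (CR.zeroˡ (ι n))
    ι-* (suc m) n = trans (ι-+ n (m * n)) (trans (cong₂ _⊕_ (sym (⊗-identity (ι n))) (ι-* m n)) (trans (sym (CR.distribʳ (ι n) 𝟙 (ι m))) (cong (_⊗ ι n) (sym (ι-suc m)))))

    ⟪_⟫ : ℤ → ℝ
    ⟪ + n ⟫      = ι n
    ⟪ -[1+ n ] ⟫ = ⊖ ι (suc n)

    ⟪neg⟫ : ∀ n → ⟪ ℤ.- (+ n) ⟫ ≡ ⊖ ι n
    ⟪neg⟫ zero    = sym -0#≈0#
    ⟪neg⟫ (suc n) = refl

    ⟪⊖⟫ : ∀ m n → ⟪ m ℤ.⊖ n ⟫ ≡ ι m ⊕ ⊖ ι n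
    ⟪⊖⟫ m zero = sym (trans (cong (ι m ⊕_) -0#≈0#) (CR.+-identityʳ (ι m)))
    ⟪⊖⟫ zero (suc n) = sym (⊕-identity _)
    ⟪⊖⟫ (suc m) (suc n) = trans (cong ⟪_⟫ (ℤ.[1+m]⊖[1+n]≡m⊖n m n)) (trans (⟪⊖⟫ m n) (sym (begin
      ι (suc m) ⊕ ⊖ ι (suc n)      ≡⟨ cong₂ (λ x y → x ⊕ ⊖ y) (ι-suc m) (ι-suc n) ⟩
      (𝟙 ⊕ ι m) ⊕ ⊖ (𝟙 ⊕ ι n)      ≡⟨ cong₂ _⊕_ (⊕-comm 𝟙 (ι m)) (sym (-‿+-comm 𝟙 (ι n))) ⟩
      (ι m ⊕ 𝟙) ⊕ (⊖ 𝟙 ⊕ ⊖ ι n)    ≡⟨ ⊕-assoc (ι m) 𝟙 _ ⟩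
      ι m ⊕ (𝟙 ⊕ (⊖ 𝟙 ⊕ ⊖ ι n))    ≡⟨ cong (ι m ⊕_) (trans (sym (⊕-assoc 𝟙 (⊖ 𝟙) _)) (trans (cong (_⊕ ⊖ ι n) (⊕-inverse 𝟙)) (⊕-identity _))) ⟩
      ι m ⊕ ⊖ ι n ∎)))
      where open ≡-Reasoning

    ⟪+⟫ : ∀ a b → ⟪ a ℤ.+ b ⟫ ≡ ⟪ a ⟫ ⊕ ⟪ b ⟫
    ⟪+⟫ (+ m)    (+ n)    = ι-+ m n
    ⟪+⟫ (+ m)    -[1+ n ] = ⟪⊖⟫ m (suc n)
    ⟪+⟫ -[1+ m ] (+ n)    = trans (⟪⊖⟫ n (suc m)) (⊕-comm (ι n) _)
    ⟪+⟫ -[1+ m ] -[1+ n ] = trans (cong ⊖_ (trans (cong ι (sym (cong suc (+-suc m n)))) (ι-+ (suc m) (suc n)))) (sym (-‿+-comm _ _))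

    ⟪*⟫ : ∀ a b → ⟪ a ℤ.* b ⟫ ≡ ⟪ a ⟫ ⊗ ⟪ b ⟫
    ⟪*⟫ (+ m)    (+ n)    = trans (cong ⟪_⟫ (ℤ.+◃n≡+n (m * n))) (ι-* m n)
    ⟪*⟫ (+ m)    -[1+ n ] = trans (cong ⟪_⟫ (ℤ.-◃n≡-n (m * suc n))) (trans (⟪neg⟫ (m * suc n)) (trans (cong ⊖_ (ι-* m (suc n))) (-‿distribʳ-* _ _)))
    ⟪*⟫ -[1+ m ] (+ n)    = trans (cong ⟪_⟫ (ℤ.-◃n≡-n (suc m * n))) (trans (⟪neg⟫ (suc m * n)) (trans (cong ⊖_ (ι-* (suc m) n)) (-‿distribˡ-* _ _)))
    ⟪*⟫ -[1+ m ] -[1+ n ] = trans (ι-* (suc m) (suc n)) (trans (sym (-‿involutive _)) (trans (cong ⊖_ (-‿distribˡ-* _ _)) (-‿distribʳ-* _ _)))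

    ⟪-⟫ : ∀ a → ⟪ ℤ.- a ⟫ ≡ ⊖ ⟪ a ⟫
    ⟪-⟫ (+ n)    = ⟪neg⟫ n
    ⟪-⟫ -[1+ n ] = sym (-‿involutive _)

    coefficients : ℤ.+-*-rawRing -Raw-AlmostCommutative⟶ fromCommutativeRing commutativeRing
    coefficients = record
      { ⟦_⟧ = ⟪_⟫ ; +-homo = ⟪+⟫ ; *-homo = ⟪*⟫ ; -‿homo = ⟪-⟫ ; 0-homo = refl ; 1-homo = refl }

    same? : ∀ a b → Maybe (⟪ a ⟫ ≡ ⟪ b ⟫)
    same? a b with a ℤ.≟ b
    ... | yes e = just (cong ⟪_⟫ e)
    ... | no  _ = nothing

  open import Algebra.Solver.Ring ℤ.+-*-rawRing (fromCommutativeRing commutativeRing) coefficients same? public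
    using (Polynomial; solve; _:=_; _:+_; _:*_; :-_; _:-_; con)

  :0 :1 : ∀ {n} → Polynomial n
  :0 = con (+ 0)
  :1 = con (+ 1)

  infixl 6 _⊝_
  _⊝_ : ℝ → ℝ → ℝ
  x ⊝ y = x ⊕ ⊖ y

  Pos : ℝ → Set
  Pos x = 𝟘 ≺ x

  pos≡ : ∀ {x y} → x ≡ y → Pos x → Pos y
  pos≡ refl p = p

  Pos⇒≢0 : ∀ {x} → Pos x → x ≢ 𝟘
  Pos⇒≢0 p refl = ≺-irrefl 𝟘 p

  Pos-⊕ : ∀ {x y} → Pos x → Pos y → Pos (x ⊕ y)
  Pos-⊕ {x} {y} p q = ≺-trans _ _ _ q (subst (_≺ x ⊕ y) (⊕-identity y) (⊕-mono-≺ 𝟘 x y p))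

  ≺⇒Pos : ∀ {x y} → x ≺ y → Pos (y ⊝ x)
  ≺⇒Pos {x} {y} h = subst (_≺ y ⊝ x) (⊕-inverse x) (⊕-mono-≺ x y (⊖ x) h)

  Pos⇒≺ : ∀ {x y} → Pos (y ⊝ x) → x ≺ y
  Pos⇒≺ {x} {y} h = subst₂ _≺_ (⊕-identity x) (solve 2 (λ x y → y :- x :+ x := y) refl x y) (⊕-mono-≺ 𝟘 (y ⊝ x) x h)

  ≺0⇒Pos : ∀ {x} → x ≺ 𝟘 → Pos (⊖ x)
  ≺0⇒Pos h = pos≡ (⊕-identity _) (≺⇒Pos h)

  Pos⇒≺0 : ∀ {x} → Pos (⊖ x) → x ≺ 𝟘
  Pos⇒≺0 {x} h = Pos⇒≺ (pos≡ (sym (⊕-identity _)) h)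

  sign : ∀ x → Pos x ⊎ (x ≡ 𝟘 ⊎ Pos (⊖ x))
  sign x with ≺-trichotomy 𝟘 x
  ... | inj₁ p        = inj₁ p
  ... | inj₂ (inj₁ e) = inj₂ (inj₁ (sym e))
  ... | inj₂ (inj₂ n) = inj₂ (inj₂ (≺0⇒Pos n))

  Pos-asym : ∀ {x} → Pos x → ¬ Pos (⊖ x)
  Pos-asym p q = ≺-irrefl 𝟘 (pos≡ (⊕-inverse _) (Pos-⊕ p q))

  NN : ℝ → Set
  NN x = Pos x ⊎ x ≡ 𝟘

  NN-⊗ : ∀ {x y} → NN x → NN y → NN (x ⊗ y)
  NN-⊗ (inj₁ p) (inj₁ q) = inj₁ (⊗-pos _ _ p q)
  NN-⊗ {x} {y} (inj₂ refl) _ = inj₂ (solve 1 (λ y → :0 :* y := :0) refl y)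
  NN-⊗ {x} {y} (inj₁ _) (inj₂ refl) = inj₂ (solve 1 (λ y → y :* :0 := :0) refl x)

  Pos-⊕-NN : ∀ {x y} → Pos x → NN y → Pos (x ⊕ y)
  Pos-⊕-NN p (inj₁ q) = Pos-⊕ p q
  Pos-⊕-NN {x} p (inj₂ refl) = pos≡ (sym (trans (⊕-comm x 𝟘) (⊕-identity x))) p

  NN-⊕ : ∀ {x y} → NN x → NN y → NN (x ⊕ y)
  NN-⊕ (inj₁ p) q = inj₁ (Pos-⊕-NN p q)
  NN-⊕ {y = y} (inj₂ refl) q = subst NN (sym (⊕-identity y)) q

  dec-Pos : ∀ x → Pos x ⊎ NN (⊖ x)
  dec-Pos x with sign x
  ... | inj₁ p           = inj₁ p
  ... | inj₂ (inj₁ refl) = inj₂ (inj₂ (solve 0 (:- :0 := :0) refl))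
  ... | inj₂ (inj₂ n)    = inj₂ (inj₁ n)

  NN⇒¬Pos⊖ : ∀ {x} → NN x → ¬ Pos (⊖ x)
  NN⇒¬Pos⊖ (inj₁ p)    = Pos-asym p
  NN⇒¬Pos⊖ (inj₂ refl) = λ q → ≺-irrefl 𝟘 (pos≡ (solve 0 (:- :0 := :0) refl) q)

  Pos-𝟙 : Pos 𝟙
  Pos-𝟙 with sign 𝟙
  ... | inj₁ p        = p
  ... | inj₂ (inj₁ e) = ⊥-elim (𝟘≢𝟙 (sym e))
  ... | inj₂ (inj₂ n) = ⊥-elim (Pos-asym {𝟙} (pos≡ (solve 0 (:- :1 :* :- :1 := :1) refl) (⊗-pos _ _ n n)) n)

  Pos-inverse : ∀ {x} → Pos x → ∃ λ y → Pos y × x ⊗ y ≡ 𝟙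
  Pos-inverse {x} p with ⊗-inverse x (Pos⇒≢0 p)
  ... | y , e with sign y
  ... | inj₁ q = y , q , e
  ... | inj₂ (inj₁ refl) = ⊥-elim (𝟘≢𝟙 (trans (solve 1 (λ x → :0 := x :* :0) refl x) e))
  ... | inj₂ (inj₂ n) = ⊥-elim (Pos-asym Pos-𝟙 (pos≡ (trans (solve 2 (λ x y → x :* :- y := :- (x :* y)) refl x y) (cong ⊖_ e)) (⊗-pos _ _ p n)))

  ≟0 : ∀ x → x ≡ 𝟘 ⊎ x ≢ 𝟘
  ≟0 x with sign x
  ... | inj₁ p        = inj₂ (Pos⇒≢0 p)
  ... | inj₂ (inj₁ e) = inj₁ e
  ... | inj₂ (inj₂ n) = inj₂ (λ { refl → NN⇒¬Pos⊖ (inj₂ refl) n })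

  product-zero : ∀ {x y} → x ≢ 𝟘 → x ⊗ y ≡ 𝟘 → y ≡ 𝟘
  product-zero {x} {y} ne e with ⊗-inverse x ne
  ... | z , xz = begin
    y           ≡⟨ solve 1 (λ y → y := :1 :* y) refl y ⟩
    𝟙 ⊗ y       ≡⟨ cong (_⊗ y) (sym xz) ⟩
    x ⊗ z ⊗ y   ≡⟨ solve 3 (λ x y z → x :* z :* y := z :* (x :* y)) refl x y z ⟩
    z ⊗ (x ⊗ y) ≡⟨ cong (z ⊗_) e ⟩
    z ⊗ 𝟘       ≡⟨ solve 1 (λ z → z :* :0 := :0) refl z ⟩
    𝟘 ∎
    where open ≡-Reasoning

  min : ∀ {x y} → Pos x → Pos y → ∃ λ z → Pos z × NN (x ⊝ z) × NN (y ⊝ z)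
  min {x} {y} p q with dec-Pos (x ⊝ y)
  ... | inj₁ h = y , q , inj₁ h , inj₂ (⊕-inverse y)
  ... | inj₂ h = x , p , inj₂ (⊕-inverse x) , subst NN (solve 2 (λ x y → :- (x :- y) := y :- x) refl x y) h

  -- Positivity of `f` is a premise inside the conclusion, so one `ε` can serve a family in which
  -- only some members are positive.
  near₁ : ∀ f g → ∃ λ ε → Pos ε × (Pos f → ∀ t → Pos t → NN (ε ⊝ t) → Pos (f ⊕ t ⊗ g))
  near₁ f g with dec-Pos (⊖ g) | dec-Pos f
  ... | _ | inj₂ nf = 𝟙 , Pos-𝟙 , λ p → ⊥-elim (NN⇒¬Pos⊖ nf (pos≡ (solve 1 (λ f → f := :- :- f) refl f) p))
  ... | inj₂ g≥0 | inj₁ _ = 𝟙 , Pos-𝟙 , λ p t pt _ → Pos-⊕-NN p (NN-⊗ (inj₁ pt) (subst NN (solve 1 (λ g → :- :- g := g) refl g) g≥0))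
  ... | inj₁ g<0 | inj₁ f>0 with Pos-inverse (Pos-⊕ Pos-𝟙 g<0)
  -- With `ε = f / (1 - g)` one has `f + t g = ε + (ε - t) (- g)`, and both summands are controlled.
  ... | y , y>0 , e = f ⊗ y , ⊗-pos _ _ f>0 y>0 , λ _ t pt le →
    pos≡ (trans (solve 4 (λ f g y t → f :* y :+ (f :* y :- t) :* (:- g) := f :* ((:1 :+ :- g) :* y) :+ t :* g) refl f g y t)
                (cong (_⊕ t ⊗ g) (trans (cong (f ⊗_) e) (solve 1 (λ f → f :* :1 := f) refl f))))
         (Pos-⊕-NN (⊗-pos _ _ f>0 y>0) (NN-⊗ le (inj₁ g<0)))

  near≤ : ∀ n (f g : Fin n → ℝ) → ∃ λ ε → Pos ε × (∀ i → Pos (f i) → ∀ t → Pos t → NN (ε ⊝ t) → Pos (f i ⊕ t ⊗ g i))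
  near≤ zero    f g = 𝟙 , Pos-𝟙 , λ ()
  near≤ (suc n) f g with near₁ (f zero) (g zero) | near≤ n (f ∘ suc) (g ∘ suc)
  ... | ε₁ , p₁ , h₁ | ε₂ , p₂ , h₂ with min p₁ p₂
  ... | ε , p , le₁ , le₂ = ε , p , λ
    { zero    pf t pt le → h₁ pf t pt (subst NN (telescope ε₁) (NN-⊕ le₁ le))
    ; (suc i) pf t pt le → h₂ i pf t pt (subst NN (telescope ε₂) (NN-⊕ le₂ le)) }
    where
    telescope : ∀ a {t} → (a ⊝ ε) ⊕ (ε ⊝ t) ≡ a ⊝ t
    telescope a {t} = solve 3 (λ a e t → (a :- e) :+ (e :- t) := a :- t) refl a ε t

  near : ∀ n (f g : Fin n → ℝ) → ∃ λ ε → Pos ε × (∀ i → Pos (f i) → Pos (f i ⊕ ε ⊗ g i))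
  near n f g with near≤ n f g
  ... | ε , p , h = ε , p , λ i pf → h i pf ε p (inj₂ (⊕-inverse ε))

  sg : Bool → ℝ → ℝ
  sg true  x = x
  sg false x = ⊖ x

  sg-not : ∀ b x → sg (not b) x ≡ ⊖ sg b x
  sg-not true  x = refl
  sg-not false x = solve 1 (λ x → x := :- :- x) refl x

  sg-0 : ∀ b → sg b 𝟘 ≡ 𝟘
  sg-0 true  = refl
  sg-0 false = solve 0 (:- :0 := :0) refl

  sg≡0 : ∀ b {x} → sg b x ≡ 𝟘 → x ≡ 𝟘
  sg≡0 true  e = e
  sg≡0 false {x} e = trans (solve 1 (λ x → x := :- :- x) refl x) (trans (cong ⊖_ e) (sg-0 false))

  sg-move : ∀ b x t y → sg b (x ⊕ t ⊗ y) ≡ sg b x ⊕ t ⊗ sg b y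
  sg-move true  x t y = refl
  sg-move false x t y = solve 3 (λ x t y → :- (x :+ t :* y) := :- x :+ t :* :- y) refl x t y

  sg-⊝ : ∀ b x y → sg b (x ⊝ y) ≡ sg b x ⊝ sg b y
  sg-⊝ true  x y = refl
  sg-⊝ false x y = solve 2 (λ x y → :- (x :- y) := :- x :- :- y) refl x y

  -- Weak excluded middle: the supremum of {0} ∪ {1 | Q} is below 1 only if ¬ Q, and positive only if ¬ ¬ Q.
  wlem : (Q : Set) → ¬ Q ⊎ ¬ ¬ Q
  wlem Q with complete P (𝟘 , inj₁ refl) (𝟙 , upper)
    where
    P : ℝ → Set
    P x = x ≡ 𝟘 ⊎ (x ≡ 𝟙 × Q)
    upper : ∀ x → P x → ¬ 𝟙 ≺ x
    upper x (inj₁ refl)       h = Pos-asym Pos-𝟙 (≺0⇒Pos h)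
    upper x (inj₂ (refl , _)) h = ≺-irrefl 𝟙 h
  ... | s , ub , least with dec-Pos s
  ... | inj₁ s>0 = inj₂ (λ nq → least 𝟘 (λ { x (inj₁ refl) → ≺-irrefl 𝟘 ; x (inj₂ (_ , q)) → ⊥-elim (nq q) }) s>0)
  ... | inj₂ s≤0 = inj₁ (λ q → ub 𝟙 (inj₂ (refl , q)) (Pos⇒≺ (Pos-⊕-NN Pos-𝟙 s≤0)))

-- Shattering and linear algebra

-- Pajor's form of the Sauer–Shelah lemma: a family has as many members as it order-shatters sets.
order-shattered : ∀ {n} → (Vec Bool n → Bool) → Subset n → Bool
order-shattered F []          = F []
order-shattered F (true ∷ Q)  = order-shattered (λ σ → F (true ∷ σ) ∧ F (false ∷ σ)) Q
order-shattered F (false ∷ Q) = order-shattered (λ σ → F (true ∷ σ) ∨ F (false ∷ σ)) Q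

pajor : ∀ {n} (F : Vec Bool n → Bool) → ∑ (vecs n) (λ σ → ⟦ F σ ⟧) ≡ ∑ (vecs n) (λ Q → ⟦ order-shattered F Q ⟧)
pajor {zero} F = refl
pajor {suc n} F = begin
  ∑ (vecs (suc n)) (λ σ → ⟦ F σ ⟧)                                                   ≡⟨ ∑-vecs n _ ⟩
  ∑ (vecs n) (λ σ → ⟦ F (true ∷ σ) ⟧) + ∑ (vecs n) (λ σ → ⟦ F (false ∷ σ) ⟧)         ≡⟨ ∑-+ (vecs n) _ _ ⟨
  ∑ (vecs n) (λ σ → ⟦ F (true ∷ σ) ⟧ + ⟦ F (false ∷ σ) ⟧)
    ≡⟨ ∑-cong (vecs n) (λ σ → meet-join (F (true ∷ σ)) (F (false ∷ σ))) ⟩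
  ∑ (vecs n) (λ σ → ⟦ F (true ∷ σ) ∧ F (false ∷ σ) ⟧ + ⟦ F (true ∷ σ) ∨ F (false ∷ σ) ⟧) ≡⟨ ∑-+ (vecs n) _ _ ⟩
  _ ≡⟨ cong₂ _+_ (pajor (λ σ → F (true ∷ σ) ∧ F (false ∷ σ))) (pajor (λ σ → F (true ∷ σ) ∨ F (false ∷ σ))) ⟩
  _ ≡⟨ ∑-vecs n _ ⟨
  ∑ (vecs (suc n)) (λ Q → ⟦ order-shattered F Q ⟧) ∎
  where
  open ≡-Reasoning
  meet-join : ∀ a b → ⟦ a ⟧ + ⟦ b ⟧ ≡ ⟦ a ∧ b ⟧ + ⟦ a ∨ b ⟧
  meet-join true  true  = refl
  meet-join true  false = refl
  meet-join false true  = refl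
  meet-join false false = refl

-- Order-shattering implies shattering: at a coordinate of `Q` the conjunction offers both values,
-- elsewhere the disjunction offers one of them.
order-shattered-realises : ∀ {n} (F : Vec Bool n → Bool) Q → order-shattered F Q ≡ true → (τ : Vec Bool n) →
  ∃ λ σ → F σ ≡ true × (∀ i → Q ∋ i → lookup σ i ≡ lookup τ i)
order-shattered-realises F [] h [] = [] , h , λ ()
order-shattered-realises F (true ∷ Q) h (b ∷ τ)
  with order-shattered-realises (λ σ → F (true ∷ σ) ∧ F (false ∷ σ)) Q h τ
... | σ , Fσ , agree = b ∷ σ , both b (∧-true Fσ) , λ { zero _ → refl ; (suc i) m → agree i (down m) }
  where both : ∀ b → F (true ∷ σ) ≡ true × F (false ∷ σ) ≡ true → F (b ∷ σ) ≡ true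
        both true  = proj₁
        both false = proj₂
order-shattered-realises F (false ∷ Q) h (b ∷ τ)
  with order-shattered-realises (λ σ → F (true ∷ σ) ∨ F (false ∷ σ)) Q h τ
... | σ , Fσ , agree with F (true ∷ σ) in eq
... | true  = true ∷ σ , eq , λ { zero (mem ()) ; (suc i) m → agree i (down m) }
... | false = false ∷ σ , Fσ , λ { zero (mem ()) ; (suc i) m → agree i (down m) }

sauer : ∀ {n} (F : Vec Bool n → Bool) v → (∀ Q → order-shattered F Q ≡ true → ∣ Q ∣ ≤ v) →
        ∑ (vecs n) (λ σ → ⟦ F σ ⟧) ≤ suc n ^ v
sauer {n} F v h = ≤-trans (≤-reflexive (pajor F))
  (≤-trans (∑-mono (vecs n) (λ Q → ⟦⟧-mono (λ s → ≤ᵇ-intro (h Q s)))) (count-small n v))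

-- Restriction to `D` is injective on `F`. Coordinates in `D` double the bound; at the others the
-- two halves of `F` are disjoint and can be merged.
determined : ∀ {n} (F : Vec Bool n → Bool) (D : Subset n) →
  (∀ σ τ → F σ ≡ true → F τ ≡ true → (∀ i → D ∋ i → lookup σ i ≡ lookup τ i) → σ ≡ τ) →
  ∑ (vecs n) (λ σ → ⟦ F σ ⟧) ≤ 2 ^ ∣ D ∣
determined F [] h = ≤-trans (≤-reflexive (+-identityʳ _)) (⟦⟧≤1 (F []))
determined {suc n} F (true ∷ D) h = begin
  ∑ (vecs (suc n)) (λ σ → ⟦ F σ ⟧) ≡⟨ ∑-vecs n _ ⟩
  ∑ (vecs n) (λ σ → ⟦ F (true ∷ σ) ⟧) + ∑ (vecs n) (λ σ → ⟦ F (false ∷ σ) ⟧) ≤⟨ +-mono-≤ (half true) (half false) ⟩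
  2 ^ ∣ D ∣ + 2 ^ ∣ D ∣ ≡⟨ cong (2 ^ ∣ D ∣ +_) (sym (+-identityʳ _)) ⟩
  2 ^ suc ∣ D ∣ ∎
  where
  open ≤-Reasoning
  half : ∀ b → ∑ (vecs n) (λ σ → ⟦ F (b ∷ σ) ⟧) ≤ 2 ^ ∣ D ∣
  half b = determined (F ∘ (b ∷_)) D (λ σ τ p q a → ∷-injectiveʳ
    (h (b ∷ σ) (b ∷ τ) p q (λ { zero _ → refl ; (suc i) m → a i (down m) })))
determined {suc n} F (false ∷ D) h = begin
  ∑ (vecs (suc n)) (λ σ → ⟦ F σ ⟧) ≡⟨ trans (∑-vecs n _) (sym (∑-+ (vecs n) _ _)) ⟩
  ∑ (vecs n) (λ σ → ⟦ F (true ∷ σ) ⟧ + ⟦ F (false ∷ σ) ⟧) ≤⟨ ∑-mono (vecs n) exclusive ⟩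
  ∑ (vecs n) (λ σ → ⟦ F (true ∷ σ) ∨ F (false ∷ σ) ⟧) ≤⟨ determined (λ σ → F (true ∷ σ) ∨ F (false ∷ σ)) D merged ⟩
  2 ^ ∣ D ∣ ∎
  where
  open ≤-Reasoning
  lift : ∀ {σ τ a b} → (∀ i → D ∋ i → lookup σ i ≡ lookup τ i) → ∀ i → (false ∷ D) ∋ i → lookup (a ∷ σ) i ≡ lookup (b ∷ τ) i
  lift f zero (mem ())
  lift f (suc i) m = f i (down m)
  exclusive : ∀ σ → ⟦ F (true ∷ σ) ⟧ + ⟦ F (false ∷ σ) ⟧ ≤ ⟦ F (true ∷ σ) ∨ F (false ∷ σ) ⟧
  exclusive σ with F (true ∷ σ) in e₁ | F (false ∷ σ) in e₂
  ... | true  | true  = case h (true ∷ σ) (false ∷ σ) e₁ e₂ (lift (λ i _ → refl)) of λ ()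
  ... | true  | false = ≤-refl
  ... | false | b     = ≤-refl
  pick : ∀ σ → F (true ∷ σ) ∨ F (false ∷ σ) ≡ true → ∃ λ b → F (b ∷ σ) ≡ true
  pick σ e with F (true ∷ σ) in e₁
  ... | true  = true , e₁
  ... | false = false , e
  merged : ∀ σ τ → F (true ∷ σ) ∨ F (false ∷ σ) ≡ true → F (true ∷ τ) ∨ F (false ∷ τ) ≡ true →
           (∀ i → D ∋ i → lookup σ i ≡ lookup τ i) → σ ≡ τ
  merged σ τ p q a with pick σ p | pick τ q
  ... | b , Fσ | c , Fτ = ∷-injectiveʳ (h (b ∷ σ) (c ∷ τ) Fσ Fτ (lift a))

length-select : ∀ {A : Set} (P : A → Bool) xs → length (select P xs) ≡ ∑ xs (λ x → ⟦ P x ⟧)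
length-select P xs = trans (sym (trans (∑-const (select P xs) 1) (*-identityʳ _)))
                           (trans (∑-select P xs _) (∑-cong xs (λ x → *-identityʳ _)))

length-complement : ∀ {n} (Q : Subset n) → length (select (λ i → not (lookup Q i)) (fins n)) + ∣ Q ∣ ≡ n
length-complement {n} Q = trans (cong₂ _+_ (length-select _ (fins n)) (sym (∑-∋ Q)))
  (trans (sym (∑-+ (fins n) _ _)) (trans (∑-cong (fins n) (λ i → one (lookup Q i)))
    (trans (∑-const (fins n) 1) (trans (*-identityʳ _) (length-fins n)))))
  where one : ∀ b → ⟦ not b ⟧ + ⟦ b ⟧ ≡ 1
        one true  = refl
        one false = refl

module LinearAlgebra (R : RealField) where
  open Field R
  open Geometry R public

  dot-cong : ∀ {d} {a b x y : Point d} → (∀ k → a k ≡ b k) → (∀ k → x k ≡ y k) → dot a x ≡ dot b y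
  dot-cong {zero}  f g = refl
  dot-cong {suc d} f g = cong₂ _⊕_ (cong₂ _⊗_ (f zero) (g zero)) (dot-cong (f ∘ suc) (g ∘ suc))

  dot-comm : ∀ {d} (a x : Point d) → dot a x ≡ dot x a
  dot-comm {zero}  a x = refl
  dot-comm {suc d} a x = cong₂ _⊕_ (⊗-comm _ _) (dot-comm (a ∘ suc) (x ∘ suc))

  dot-move : ∀ {d} (a x u : Point d) t → dot a (λ k → x k ⊕ t ⊗ u k) ≡ dot a x ⊕ t ⊗ dot a u
  dot-move {zero}  a x u t = solve 1 (λ t → :0 := :0 :+ t :* :0) refl t
  dot-move {suc d} a x u t = trans (cong (a zero ⊗ (x zero ⊕ t ⊗ u zero) ⊕_) (dot-move (a ∘ suc) (x ∘ suc) (u ∘ suc) t))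
    (solve 6 (λ a x t u p q → a :* (x :+ t :* u) :+ (p :+ t :* q) := (a :* x :+ p) :+ t :* (a :* u :+ q)) refl
       (a zero) (x zero) t (u zero) (dot (a ∘ suc) (x ∘ suc)) (dot (a ∘ suc) (u ∘ suc)))

  dot-0 : ∀ {d} (a x : Point d) → (∀ k → a k ≡ 𝟘) → dot a x ≡ 𝟘
  dot-0 {zero}  a x h = refl
  dot-0 {suc d} a x h = trans (cong₂ (λ p q → p ⊗ x zero ⊕ q) (h zero) (dot-0 (a ∘ suc) (x ∘ suc) (h ∘ suc)))
                              (solve 1 (λ x → :0 :* x :+ :0 := :0) refl (x zero))

  dot-⊖ : ∀ {d} (a x : Point d) → dot a (λ k → ⊖ x k) ≡ ⊖ dot a x
  dot-⊖ {zero}  a x = solve 0 (:0 := :- :0) refl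
  dot-⊖ {suc d} a x = trans (cong (a zero ⊗ ⊖ x zero ⊕_) (dot-⊖ (a ∘ suc) (x ∘ suc)))
    (solve 3 (λ a x p → a :* :- x :+ :- p := :- (a :* x :+ p)) refl (a zero) (x zero) (dot (a ∘ suc) (x ∘ suc)))

  dot-⊝ : ∀ {d} (a x y : Point d) → dot a (λ k → x k ⊝ y k) ≡ dot a x ⊝ dot a y
  dot-⊝ a x y = trans (dot-cong (λ _ → refl) (λ k → solve 2 (λ x y → x :- y := x :+ :1 :* :- y) refl (x k) (y k)))
    (trans (dot-move a x (λ k → ⊖ y k) 𝟙) (trans (cong (λ z → dot a x ⊕ 𝟙 ⊗ z) (dot-⊖ a y))
      (solve 2 (λ p q → p :+ :1 :* :- q := p :- q) refl (dot a x) (dot a y))))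

  dot-swap : ∀ {n d} (c : Fin n → ℝ) (A : Fin n → Point d) (x : Point d) →
             dot c (λ i → dot (A i) x) ≡ dot (λ k → dot c (λ i → A i k)) x
  dot-swap {zero}  c A x = sym (dot-0 (λ _ → 𝟘) x (λ _ → refl))
  dot-swap {suc n} c A x = begin
    c zero ⊗ dot (A zero) x ⊕ dot (c ∘ suc) (λ i → dot (A (suc i)) x) ≡⟨ cong (c zero ⊗ dot (A zero) x ⊕_) (dot-swap (c ∘ suc) (A ∘ suc) x) ⟩
    c zero ⊗ dot (A zero) x ⊕ dot B x         ≡⟨ ⊕-comm _ _ ⟩
    dot B x ⊕ c zero ⊗ dot (A zero) x         ≡⟨ cong₂ (λ p q → p ⊕ c zero ⊗ q) (dot-comm B x) (dot-comm (A zero) x) ⟩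
    dot x B ⊕ c zero ⊗ dot x (A zero)         ≡⟨ dot-move x B (A zero) (c zero) ⟨
    dot x (λ k → B k ⊕ c zero ⊗ A zero k)     ≡⟨ dot-comm x _ ⟩
    dot (λ k → B k ⊕ c zero ⊗ A zero k) x     ≡⟨ dot-cong {x = x} (λ k → ⊕-comm (B k) (c zero ⊗ A zero k)) (λ _ → refl) ⟩
    dot (λ k → c zero ⊗ A zero k ⊕ B k) x ∎
    where
    open ≡-Reasoning
    B : Point _
    B k = dot (c ∘ suc) (λ i → A (suc i) k)

  dot-NN : ∀ {d} (a x : Point d) → (∀ k → NN (a k ⊗ x k)) → NN (dot a x)
  dot-NN {zero}  a x h = inj₂ refl
  dot-NN {suc d} a x h = NN-⊕ (h zero) (dot-NN (a ∘ suc) (x ∘ suc) (h ∘ suc))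

  dot-Pos : ∀ {d} (a x : Point d) → (∀ k → NN (a k ⊗ x k)) → ∀ k → Pos (a k ⊗ x k) → Pos (dot a x)
  dot-Pos a x h zero    p = Pos-⊕-NN p (dot-NN (a ∘ suc) (x ∘ suc) (h ∘ suc))
  dot-Pos a x h (suc k) p = pos≡ (⊕-comm _ _) (Pos-⊕-NN (dot-Pos (a ∘ suc) (x ∘ suc) (h ∘ suc) k p) (h zero))

  unit : ∀ {d} → Fin d → Point d
  unit zero    zero    = 𝟙
  unit zero    (suc k) = 𝟘
  unit (suc i) zero    = 𝟘
  unit (suc i) (suc k) = unit i k

  dot-unit : ∀ {d} (i : Fin d) x → dot (unit i) x ≡ x i
  dot-unit zero    x = trans (cong (𝟙 ⊗ x zero ⊕_) (dot-0 _ (x ∘ suc) (λ _ → refl))) (solve 1 (λ x → :1 :* x :+ :0 := x) refl (x zero))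
  dot-unit (suc i) x = trans (cong (𝟘 ⊗ x zero ⊕_) (dot-unit i (x ∘ suc))) (solve 2 (λ x y → :0 :* x :+ y := y) refl (x zero) (x (suc i)))

  pivot : ∀ {m} (rows : List (Point (suc m))) → (∀ r → r ∈ᴸ rows → r zero ≡ 𝟘) ⊎
          ∃ λ pre → ∃ λ r → ∃ λ post → rows ≡ pre ++ r ∷ post × r zero ≢ 𝟘
  pivot [] = inj₁ (λ _ ())
  pivot (r ∷ rows) with ≟0 (r zero)
  ... | inj₂ ne = inj₂ ([] , r , rows , refl , ne)
  ... | inj₁ e with pivot rows
  ... | inj₁ h = inj₁ (λ { _ (here refl) → e ; q (there m) → h q m })
  ... | inj₂ (pre , q , post , refl , ne) = inj₂ (r ∷ pre , q , post , refl , ne)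

  -- Gaussian elimination of the first unknown. If it occurs in no row, the first unit vector is a
  -- solution.
  kernel : ∀ {m} (rows : List (Point m)) → length rows < m →
           ∃ λ u → (∃ λ k → u k ≢ 𝟘) × (∀ r → r ∈ᴸ rows → dot r u ≡ 𝟘)
  kernel {suc m} rows lt with pivot rows
  ... | inj₁ h = unit zero , (zero , λ e → 𝟘≢𝟙 (sym e)) , λ r k → trans (dot-comm r (unit zero)) (trans (dot-unit zero r) (h r k))
  ... | inj₂ (pre , r , post , refl , ne) with ⊗-inverse (r zero) ne
  ... | z , r0z with kernel (map (λ q k → q (suc k) ⊕ ⊖ (q zero ⊗ z) ⊗ r (suc k)) (pre ++ post)) shorter
    where
    shorter : length (map (λ (q : Point (suc m)) k → q (suc k) ⊕ ⊖ (q zero ⊗ z) ⊗ r (suc k)) (pre ++ post)) < m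
    shorter = ≤-pred (subst (_< suc m) (trans (length-++ pre) (trans (+-suc (length pre) (length post))
                (cong suc (trans (sym (length-++ pre)) (sym (length-map _ (pre ++ post))))))) lt)
  ... | u′ , (k , u≢0) , sol = u , (suc k , u≢0) , solved
    where
    δ : ℝ
    δ = dot (r ∘ suc) u′
    u : Point (suc m)
    u zero    = ⊖ (z ⊗ δ)
    u (suc k) = u′ k
    others : ∀ q → q ∈ᴸ pre ++ post → dot q u ≡ 𝟘
    others q h = trans
      (trans (solve 4 (λ a z D p → a :* :- (z :* D) :+ p := p :+ :- (a :* z) :* D) refl (q zero) z δ (dot (q ∘ suc) u′))
        (sym (trans (dot-comm (λ k → q (suc k) ⊕ ⊖ (q zero ⊗ z) ⊗ r (suc k)) u′)
          (trans (dot-move u′ (q ∘ suc) (r ∘ suc) _) (cong₂ (λ x y → x ⊕ ⊖ (q zero ⊗ z) ⊗ y) (dot-comm u′ _) (dot-comm u′ _))))))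
      (sol _ (∈-map⁺ (λ (q : Point (suc m)) k → q (suc k) ⊕ ⊖ (q zero ⊗ z) ⊗ r (suc k)) h))
    solved : ∀ q → q ∈ᴸ pre ++ r ∷ post → dot q u ≡ 𝟘
    solved q h with ∈-++⁻ pre h
    ... | inj₁ a = others q (∈-++⁺ˡ a)
    ... | inj₂ (there a) = others q (∈-++⁺ʳ pre a)
    ... | inj₂ (here refl) = trans (solve 3 (λ a z D → a :* :- (z :* D) :+ D := D :- (a :* z) :* D) refl (r zero) z δ)
                               (trans (cong (λ x → δ ⊝ x ⊗ δ) r0z) (solve 1 (λ D → D :- :1 :* D := :0) refl δ))

  -- The values of the hyperplanes in Q at a point of P satisfy an affine relation, so their signs cannot be arbitrary.
  no-shatter : ∀ {n d} (H : Fin n → Hyperplane d) (P : Point d → Set) (Ks : List (Fin d)) →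
    (∀ (w : Point d) → (∀ k → k ∈ᴸ Ks → w k ≡ 𝟘) → ∀ x y → P x → P y → dot w x ≡ dot w y) →
    ∀ Q → length Ks < ∣ Q ∣ → ¬ (∀ (τ : Vec Bool n) → ∃ λ x → P x × (∀ i → Q ∋ i → Pos (sg (lookup τ i) (value (H i) x))))
  no-shatter {n} {d} H P Ks sep Q lt shatter = Pos-asym Dx>0 (subst Pos (cong ⊖_ (sym D-const)) Dy<0)
    where
    outside : List (Fin n)
    outside = select (λ i → not (lookup Q i)) (fins n)
    -- A vector `c` orthogonal to the second group is supported on `Q`. Orthogonality to the first
    -- group makes the combination of the normals with coefficients `c` vanish at the coordinates in
    -- `Ks`.
    rows : List (Point n)
    rows = map (λ k i → normal (H i) k) Ks ++ map unit outside
    few : length rows < n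
    few = subst₂ _<_ (sym (trans (length-++ (map (λ k i → normal (H i) k) Ks)) (cong₂ _+_ (length-map _ Ks) (length-map _ outside))))
            (trans (+-comm ∣ Q ∣ _) (length-complement Q)) (+-monoˡ-< (length outside) lt)
    ker = kernel rows few
    c = proj₁ ker
    c≢0 = proj₁ (proj₂ ker)
    sol = proj₂ (proj₂ ker)
    positive : ℝ → Bool
    positive x = [ (λ _ → true) , (λ _ → false) ]′ (dec-Pos x)
    -- On `Q` the values at `x` have the signs of the coefficients `c` and those at `y` the opposite
    -- signs, so `D` is positive at `x` and negative at `y`, although it is constant on `P`.
    τ : Vec Bool n
    τ = tabulate (positive ∘ c)
    τ′ : Vec Bool n
    τ′ = tabulate (not ∘ positive ∘ c)
    x = proj₁ (shatter τ)
    y = proj₁ (shatter τ′)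
    D : Point d → ℝ
    D z = dot c (λ i → value (H i) z)
    c-outside : ∀ i → ¬ Q ∋ i → c i ≡ 𝟘
    c-outside i h = trans (sym (dot-unit i c)) (sol (unit i) (∈-++⁺ʳ (map (λ k i → normal (H i) k) Ks)
      (∈-map⁺ unit (∈-select⁺ (λ i → not (lookup Q i)) (∈-fins i) (cong not (≢true (h ∘ mem)))))))
    D-split : ∀ z → D z ≡ dot (λ k → dot c (λ i → normal (H i) k)) z ⊝ dot c (λ i → offset (H i))
    D-split z = trans (dot-⊝ c (λ i → dot (normal (H i)) z) (λ i → offset (H i)))
                  (cong (_⊝ dot c (λ i → offset (H i))) (dot-swap c (λ i → normal (H i)) z))
    D-const : D x ≡ D y
    D-const = trans (D-split x) (trans (cong (_⊝ dot c (λ i → offset (H i)))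
      (sep _ (λ k m → trans (dot-comm c _) (sol _ (∈-++⁺ˡ (∈-map⁺ (λ k i → normal (H i) k) m)))) x y (proj₁ (proj₂ (shatter τ))) (proj₁ (proj₂ (shatter τ′)))))
      (sym (D-split y)))
    agree : ∀ a v → Pos (sg (positive a) v) → (a ≢ 𝟘 → Pos (a ⊗ v)) × NN (a ⊗ v)
    agree a v p with dec-Pos a
    ... | inj₁ q = (λ _ → ⊗-pos _ _ q p) , inj₁ (⊗-pos _ _ q p)
    ... | inj₂ (inj₁ q) = (λ _ → r) , inj₁ r
      where r = pos≡ (solve 2 (λ a v → :- a :* :- v := a :* v) refl a v) (⊗-pos _ _ q p)
    ... | inj₂ (inj₂ e) = (λ ne → ⊥-elim (ne a≡0)) , inj₂ (trans (cong (_⊗ v) a≡0) (solve 1 (λ v → :0 :* v := :0) refl v))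
      where a≡0 = sg≡0 false e
    all-agree : ∀ (v : Point n) → (∀ i → Q ∋ i → Pos (sg (positive (c i)) (v i))) → Pos (dot c v)
    all-agree v h = dot-Pos c v nonneg (proj₁ c≢0) (proj₁ (agree _ _ (h _ k∈Q)) (proj₂ c≢0))
      where
      k∈Q : Q ∋ proj₁ c≢0
      k∈Q with lookup Q (proj₁ c≢0) in eq
      ... | true  = mem eq
      ... | false = ⊥-elim (proj₂ c≢0 (c-outside _ (λ m → not-both (look m) eq)))
      nonneg : ∀ i → NN (c i ⊗ v i)
      nonneg i with lookup Q i in eq
      ... | true  = proj₂ (agree _ _ (h i (mem eq)))
      ... | false = inj₂ (trans (cong (_⊗ v i) (c-outside i (λ m → not-both (look m) eq))) (solve 1 (λ v → :0 :* v := :0) refl (v i)))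
    Dx>0 : Pos (D x)
    Dx>0 = all-agree _ (λ i m → subst (λ b → Pos (sg b (value (H i) x))) (lookup∘tabulate _ i) (proj₂ (proj₂ (shatter τ)) i m))
    Dy<0 : Pos (⊖ D y)
    Dy<0 = subst Pos (dot-⊖ c _) (all-agree (λ i → ⊖ value (H i) y) (λ i m →
      subst Pos (flip (positive (c i)) _) (subst (λ b → Pos (sg b (value (H i) y))) (lookup∘tabulate _ i) (proj₂ (proj₂ (shatter τ′)) i m))))
      where
      flip : ∀ b v → sg (not b) v ≡ sg b (⊖ v)
      flip true  v = refl
      flip false v = solve 1 (λ v → v := :- :- v) refl v

-- Cells of an arrangement

flip : ∀ {n} → Fin n → Vec Bool n → Vec Bool n
flip i σ = σ [ i ]≔ not (lookup σ i)

flip-self : ∀ {n} i (σ : Vec Bool n) → lookup (flip i σ) i ≡ not (lookup σ i)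
flip-self i σ = lookup∘updateAt i σ

flip-other : ∀ {n} i j (σ : Vec Bool n) → j ≢ i → lookup (flip i σ) j ≡ lookup σ j
flip-other i j σ ne = lookup∘updateAt′ j i ne σ

diff : ∀ {n} → Vec Bool n → Vec Bool n → Subset n
diff = zipWith (λ a b → not a ∧ b ∨ a ∧ not b)

diff-∋ : ∀ {n} (σ τ : Vec Bool n) {i} → diff σ τ ∋ i → lookup τ i ≡ not (lookup σ i)
diff-∋ σ τ {i} (mem h) = bool _ _ (trans (sym (lookup-zipWith (λ a b → not a ∧ b ∨ a ∧ not b) i σ τ)) h)
  where bool : ∀ a b → not a ∧ b ∨ a ∧ not b ≡ true → b ≡ not a
        bool true  false _ = refl
        bool false true  _ = refl

∋-diff : ∀ {n} (σ τ : Vec Bool n) {i} → lookup τ i ≢ lookup σ i → diff σ τ ∋ i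
∋-diff σ τ {i} h = mem (trans (lookup-zipWith (λ a b → not a ∧ b ∨ a ∧ not b) i σ τ) (bool _ _ h))
  where bool : ∀ a b → b ≢ a → not a ∧ b ∨ a ∧ not b ≡ true
        bool true  true  h = ⊥-elim (h refl)
        bool true  false h = refl
        bool false true  h = refl
        bool false false h = ⊥-elim (h refl)

not≢ : ∀ {b} → not b ≢ b
not≢ {true}  ()
not≢ {false} ()

bool-cases : ∀ (a b : Bool) → b ≡ a ⊎ b ≡ not a
bool-cases true  true  = inj₁ refl
bool-cases true  false = inj₂ refl
bool-cases false true  = inj₂ refl
bool-cases false false = inj₁ refl

module Arrangement (R : RealField) {n d : ℕ} (H : Fin n → Geometry.Hyperplane R d) where
  open Field R
  open LinearAlgebra R
  open import Relation.Nullary.Decidable using (decidable-stable)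

  private
    crossing-combination : ∀ p q a b w → (a ⊝ b) ⊗ w ≡ 𝟙 → p ⊕ (a ⊗ w) ⊗ (q ⊝ p) ≡ w ⊗ (⊖ b ⊗ p ⊕ a ⊗ q)
    crossing-combination p q a b w inv = begin
      p ⊕ (a ⊗ w) ⊗ (q ⊝ p)                       ≡⟨ solve 4 (λ p q a w → p :+ a :* w :* (q :- p) := :1 :* p :+ a :* w :* (q :- p)) refl p q a w ⟩
      𝟙 ⊗ p ⊕ (a ⊗ w) ⊗ (q ⊝ p)                   ≡⟨ cong (λ o → o ⊗ p ⊕ (a ⊗ w) ⊗ (q ⊝ p)) inv ⟨
      (a ⊝ b) ⊗ w ⊗ p ⊕ (a ⊗ w) ⊗ (q ⊝ p)         ≡⟨ solve 5 (λ p q a b w → (a :- b) :* w :* p :+ (a :* w) :* (q :- p) := w :* (:- b :* p :+ a :* q)) refl p q a b w ⟩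
      w ⊗ (⊖ b ⊗ p ⊕ a ⊗ q) ∎
      where open ≡-Reasoning

    crossing-zero : ∀ a b w → w ⊗ (⊖ b ⊗ a ⊕ a ⊗ b) ≡ 𝟘
    crossing-zero = solve 3 (λ a b w → w :* (:- b :* a :+ a :* b) := :0) refl

    crossing-later : ∀ p q a b → p ⊗ (⊖ b) ⊝ a ⊗ (⊖ q) ≡ ⊖ b ⊗ p ⊕ a ⊗ q
    crossing-later = solve 4 (λ p q a b → p :* :- b :- a :* :- q := :- b :* p :+ a :* q) refl

    exchange : ∀ c b a e → ⊖ (c ⊗ (⊖ b) ⊝ a ⊗ (⊖ e)) ≡ a ⊗ (⊖ e) ⊝ c ⊗ (⊖ b)
    exchange = solve 4 (λ c b a e → :- (c :* :- b :- a :* :- e) := a :* :- e :- c :* :- b) refl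

    difference : ∀ ε c p a q b e → ε ⊗ (c ⊗ p ⊝ a ⊗ q) ≡
      (c ⊗ (⊖ b) ⊝ a ⊗ (⊖ e)) ⊝ (c ⊗ (⊖ (b ⊕ ε ⊗ p)) ⊝ a ⊗ (⊖ (e ⊕ ε ⊗ q)))
    difference = solve 7 (λ ε c p a q b e → ε :* (c :* p :- a :* q) :=
      (c :* :- b :- a :* :- e) :- (c :* :- (b :+ ε :* p) :- a :* :- (e :+ ε :* q))) refl

    recentre : ∀ c a p q → c ⊗ p ≡ (c ⊗ (p ⊝ a) ⊝ a ⊗ (q ⊝ c)) ⊕ a ⊗ q
    recentre = solve 4 (λ c a p q → c :* p := (c :* (p :- a) :- a :* (q :- c)) :+ a :* q) refl

    retreat : ∀ z e x → z ⊕ ⊖ e ⊗ (x ⊝ z) ≡ z ⊕ e ⊗ (z ⊝ x)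
    retreat = solve 3 (λ z e x → z :+ :- e :* (x :- z) := z :+ e :* (z :- x)) refl

    retreated : ∀ z e x → e ⊗ x ⊕ (⊖ z ⊕ e ⊗ ⊖ z) ≡ ⊖ (z ⊕ e ⊗ (z ⊝ x))
    retreated = solve 3 (λ z e x → e :* x :+ (:- z :+ e :* :- z) := :- (z :+ e :* (z :- x))) refl

    ⊖⊖ : ∀ z → z ≡ ⊖ ⊖ z
    ⊖⊖ = solve 1 (λ z → z := :- :- z) refl

    ⊗𝟘 : ∀ a → a ⊗ 𝟘 ≡ 𝟘
    ⊗𝟘 = solve 1 (λ a → a :* :0 := :0) refl

  move : Point d → ℝ → Point d → Point d
  move x t u k = x k ⊕ t ⊗ u k

  to : Point d → Point d → Point d
  to x y k = y k ⊝ x k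

  s : Vec Bool n → Fin n → Point d → ℝ
  s σ i x = sg (lookup σ i) (value (H i) x)

  g : Vec Bool n → Fin n → Point d → ℝ
  g σ i u = sg (lookup σ i) (dot (normal (H i)) u)

  record Cell (σ : Vec Bool n) (x : Point d) : Set where
    constructor inside
    field at : ∀ i → Pos (s σ i x)

  open Cell public

  -- Cells are handled through their sign vectors; `V (flip i σ)`, the existence of a cell across
  -- hyperplane `i`, stands for `i` being a facet of the cell `σ`.
  V : Vec Bool n → Set
  V σ = ∃ λ x → Cell σ x

  value-move : ∀ i x t u → value (H i) (move x t u) ≡ value (H i) x ⊕ t ⊗ dot (normal (H i)) u
  value-move i x t u = trans (cong (_⊝ offset (H i)) (dot-move (normal (H i)) x u t))
    (solve 4 (λ a b t u → (a :+ t :* u) :- b := a :- b :+ t :* u) refl (dot (normal (H i)) x) (offset (H i)) t (dot (normal (H i)) u))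

  s-move : ∀ σ i x t u → s σ i (move x t u) ≡ s σ i x ⊕ t ⊗ g σ i u
  s-move σ i x t u = trans (cong (sg (lookup σ i)) (value-move i x t u)) (sg-move (lookup σ i) _ t _)

  g-to : ∀ σ i x y → g σ i (to x y) ≡ s σ i y ⊝ s σ i x
  g-to σ i x y = trans (cong (sg (lookup σ i)) (trans (dot-⊝ (normal (H i)) y x)
    (solve 3 (λ a b o → a :- b := (a :- o) :- (b :- o)) refl (dot (normal (H i)) y) (dot (normal (H i)) x) (offset (H i)))))
    (sg-⊝ (lookup σ i) _ _)

  s-toward : ∀ σ i x t y → s σ i (move x t (to x y)) ≡ s σ i x ⊕ t ⊗ (s σ i y ⊝ s σ i x)
  s-toward σ i x t y = trans (s-move σ i x t (to x y)) (cong (λ z → s σ i x ⊕ t ⊗ z) (g-to σ i x y))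

  s-opposite : ∀ σ τ i x → lookup τ i ≡ not (lookup σ i) → s τ i x ≡ ⊖ s σ i x
  s-opposite σ τ i x e = trans (cong (λ b → sg b (value (H i) x)) e) (sg-not (lookup σ i) _)

  s-agree : ∀ σ τ i x → lookup τ i ≡ lookup σ i → s τ i x ≡ s σ i x
  s-agree σ τ i x = cong (λ b → sg b (value (H i) x))

  -- A small step from `z` directly away from `x` ends on no hyperplane: positive signs survive it,
  -- and a hyperplane through `z` is left on the side opposite to `x`.
  nudge : ∀ {σ x} → Cell σ x → ∀ z → ∃ λ ρ → V ρ × (∀ i → Pos (s σ i z) → lookup ρ i ≡ lookup σ i) ×
                                                      (∀ i → NN (⊖ s σ i z) → lookup ρ i ≡ not (lookup σ i))
  nudge {σ} {x} x∈σ z = ρ , (y , inside cell) , kept , flipped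
    where
    near-z = near n (λ i → s σ i z) (λ i → s σ i z ⊝ s σ i x)
    ε = proj₁ near-z
    side : ∀ i → Pos (s σ i z) ⊎ NN (⊖ s σ i z) → Bool
    side i = [ (λ _ → lookup σ i) , (λ _ → not (lookup σ i)) ]′
    ρ : Vec Bool n
    ρ = tabulate (λ i → side i (dec-Pos (s σ i z)))
    y : Point d
    y = move z (⊖ ε) (to z x)
    s-y : ∀ i → s σ i y ≡ s σ i z ⊕ ε ⊗ (s σ i z ⊝ s σ i x)
    s-y i = trans (s-toward σ i z (⊖ ε) x) (retreat (s σ i z) ε (s σ i x))
    lookup-ρ : ∀ i → lookup ρ i ≡ side i (dec-Pos (s σ i z))
    lookup-ρ i = lookup∘tabulate _ i
    cell : ∀ i → Pos (s ρ i y)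
    cell i with dec-Pos (s σ i z) | lookup-ρ i
    ... | inj₁ p | e = pos≡ (trans (sym (s-y i)) (sym (s-agree σ ρ i y e))) (proj₂ (proj₂ near-z) i p)
    ... | inj₂ q | e = pos≡ (trans (retreated (s σ i z) ε (s σ i x))
                              (trans (cong ⊖_ (sym (s-y i))) (sym (s-opposite σ ρ i y e))))
                            (Pos-⊕-NN (⊗-pos _ _ (proj₁ (proj₂ near-z)) (at x∈σ i)) (NN-⊕ q (NN-⊗ (inj₁ (proj₁ (proj₂ near-z))) q)))
    kept : ∀ i → Pos (s σ i z) → lookup ρ i ≡ lookup σ i
    kept i p with dec-Pos (s σ i z) | lookup-ρ i
    ... | inj₁ _ | e = e
    ... | inj₂ q | _ = ⊥-elim (NN⇒¬Pos⊖ q (pos≡ (⊖⊖ (s σ i z)) p))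
    flipped : ∀ i → NN (⊖ s σ i z) → lookup ρ i ≡ not (lookup σ i)
    flipped i q with dec-Pos (s σ i z) | lookup-ρ i
    ... | inj₂ _ | e = e
    ... | inj₁ p | _ = ⊥-elim (NN⇒¬Pos⊖ q (pos≡ (⊖⊖ (s σ i z)) p))

  module _ {σ τ x y} (x∈σ : Cell σ x) (y∈τ : Cell τ y) where

    opposite : ∀ {i} → lookup τ i ≡ not (lookup σ i) → Pos (⊖ s σ i y)
    opposite {i} e = pos≡ (s-opposite σ τ i y e) (at y∈τ i)

    -- The segment from x to y crosses hyperplane i at z.
    crossing : ∀ {i} → lookup τ i ≡ not (lookup σ i) → ∃ λ z → s σ i z ≡ 𝟘 ×
      (∀ j → lookup τ j ≡ lookup σ j → Pos (s σ j z)) ×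
      (∀ j → Pos (s σ j x ⊗ (⊖ s σ i y) ⊝ s σ i x ⊗ (⊖ s σ j y)) → Pos (s σ j z))
    crossing {i} e with Pos-inverse (Pos-⊕ (at x∈σ i) (opposite e))
    ... | w , w>0 , inv = z , z∈i , common , later
      where
      a = s σ i x
      b = s σ i y
      z = move x (a ⊗ w) (to x y)
      s-z : ∀ j → s σ j z ≡ w ⊗ (⊖ b ⊗ s σ j x ⊕ a ⊗ s σ j y)
      s-z j = trans (s-toward σ j x (a ⊗ w) y) (crossing-combination (s σ j x) (s σ j y) a b w inv)
      z∈i : s σ i z ≡ 𝟘
      z∈i = trans (s-z i) (crossing-zero a b w)
      common : ∀ j → lookup τ j ≡ lookup σ j → Pos (s σ j z)
      common j e′ = pos≡ (sym (s-z j)) (⊗-pos _ _ w>0 (Pos-⊕ (⊗-pos _ _ (opposite e) (at x∈σ j))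
                      (⊗-pos _ _ (at x∈σ i) (pos≡ (s-agree σ τ j y e′) (at y∈τ j)))))
      later : ∀ j → Pos (s σ j x ⊗ (⊖ b) ⊝ a ⊗ (⊖ s σ j y)) → Pos (s σ j z)
      later j p = pos≡ (trans (cong (w ⊗_) (crossing-later (s σ j x) (s σ j y) a b)) (sym (s-z j)))
                       (⊗-pos _ _ w>0 p)

    Between : Fin n → Fin n → Set
    Between i j = ∃ λ ρ → V ρ × (∀ k → lookup τ k ≡ lookup σ k → lookup ρ k ≡ lookup σ k) ×
                          lookup ρ i ≡ not (lookup σ i) × lookup ρ j ≡ lookup σ j

    -- The premise on `j` says that the segment meets hyperplane `i` while still on the side of `x`
    -- of hyperplane `j`. A nudge past this meeting point gives the cell.
    between : ∀ {i j} → lookup τ i ≡ not (lookup σ i) →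
              Pos (s σ j x ⊗ (⊖ s σ i y) ⊝ s σ i x ⊗ (⊖ s σ j y)) → Between i j
    between {i} {j} e p =
      let z , z∈i , common , later = crossing e
          ρ , Vρ , kept , flipped = nudge {σ} {x} x∈σ z
      in ρ , Vρ , (λ k e′ → kept k (common k e′)) ,
         flipped i (inj₂ (trans (cong ⊖_ z∈i) (sg-0 false))) , kept j (later j p)

  module _ (distinct : Distinct H) where

    -- Unless the segments from x to all points near y cross H i and H j simultaneously, some cell lies
    -- strictly between; and if they all do, then H i and H j coincide.
    strictly-between : ∀ {σ τ} → V σ → (y∈ : V τ) → ∀ {i j} → i ≢ j → lookup τ i ≡ not (lookup σ i) → lookup τ j ≡ not (lookup σ j) →
      (∀ {x y} (x∈σ : Cell σ x) (y∈τ : Cell τ y) → ¬ Between x∈σ y∈τ i j × ¬ Between x∈σ y∈τ j i) → ⊥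
    strictly-between {σ} {τ} (x , x∈σ) (y , y∈τ) {i} {j} i≢j ei ej none = distinct i j i≢j
      (λ p → mk⇔ (λ on → sg≡0 (lookup σ j) (product-zero (Pos⇒≢0 (at x∈σ i)) (trans (sym (proportional p)) (vanish i on))))
                           (λ on → sg≡0 (lookup σ i) (product-zero (Pos⇒≢0 (at x∈σ j)) (trans (proportional p) (vanish j on)))))
      where
      vanish : ∀ k {p a} → value (H k) p ≡ 𝟘 → a ⊗ s σ k p ≡ 𝟘
      vanish k {p} {a} on = trans (cong (λ v → a ⊗ sg (lookup σ k) v) on) (trans (cong (a ⊗_) (sg-0 (lookup σ k))) (⊗𝟘 a))
      simultaneous : ∀ {y} → Cell τ y → s σ j x ⊗ (⊖ s σ i y) ⊝ s σ i x ⊗ (⊖ s σ j y) ≡ 𝟘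
      simultaneous {y} y∈τ with sign (s σ j x ⊗ (⊖ s σ i y) ⊝ s σ i x ⊗ (⊖ s σ j y))
      ... | inj₁ p        = ⊥-elim (proj₁ (none x∈σ y∈τ) (between x∈σ y∈τ ei p))
      ... | inj₂ (inj₁ e) = e
      ... | inj₂ (inj₂ p) = ⊥-elim (proj₂ (none x∈σ y∈τ) (between x∈σ y∈τ ej
                              (pos≡ (exchange (s σ j x) (s σ i y) (s σ i x) (s σ j y)) p)))
      -- The expression in `simultaneous` is affine in `y` and vanishes both at `y` and at a nearby
      -- point in direction `u` of the same cell, so its linear part vanishes. The two hyperplanes
      -- then have proportional equations.
      parallel : ∀ u → s σ j x ⊗ g σ i u ⊝ s σ i x ⊗ g σ j u ≡ 𝟘
      parallel u with near n (λ k → s τ k y) (λ k → g τ k u)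
      ... | ε , ε>0 , h = product-zero (Pos⇒≢0 ε>0) (begin
        ε ⊗ (c ⊗ p ⊝ a ⊗ q)
          ≡⟨ difference ε c p a q b e ⟩
        (c ⊗ (⊖ b) ⊝ a ⊗ (⊖ e)) ⊝ (c ⊗ (⊖ (b ⊕ ε ⊗ p)) ⊝ a ⊗ (⊖ (e ⊕ ε ⊗ q)))
          ≡⟨ cong₂ _⊝_ (simultaneous y∈τ) (trans (sym (cong₂ (λ b′ e′ → c ⊗ (⊖ b′) ⊝ a ⊗ (⊖ e′)) (s-move σ i y ε u) (s-move σ j y ε u)))
               (simultaneous (inside (λ k → pos≡ (sym (s-move τ k y ε u)) (h k (at y∈τ k)))))) ⟩
        𝟘 ⊝ 𝟘 ≡⟨ ⊕-inverse 𝟘 ⟩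
        𝟘 ∎)
        where
        open ≡-Reasoning
        a = s σ i x
        c = s σ j x
        b = s σ i y
        e = s σ j y
        p = g σ i u
        q = g σ j u
      proportional : ∀ p → s σ j x ⊗ s σ i p ≡ s σ i x ⊗ s σ j p
      proportional p = begin
        c ⊗ s σ i p ≡⟨ recentre c a (s σ i p) (s σ j p) ⟩
        (c ⊗ (s σ i p ⊝ a) ⊝ a ⊗ (s σ j p ⊝ c)) ⊕ a ⊗ s σ j p
          ≡⟨ cong (_⊕ a ⊗ s σ j p) (trans (sym (cong₂ (λ p q → c ⊗ p ⊝ a ⊗ q) (g-to σ i x p) (g-to σ j x p))) (parallel (to x p))) ⟩
        𝟘 ⊕ a ⊗ s σ j p ≡⟨ ⊕-identity _ ⟩
        a ⊗ s σ j p ∎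
        where
        open ≡-Reasoning
        a = s σ i x
        c = s σ j x

    -- As long as `τ` differs from `σ` in two places, a cell strictly between them differs in fewer
    -- but still in some; a single difference would be a facet. `strictly-between` only refutes, so
    -- the induction runs under a double negation, which the decidable equality of sign vectors
    -- removes.
    agree⇒≡ : ∀ {σ τ} → V σ → V τ → (∀ i → V (flip i σ) → lookup τ i ≡ lookup σ i) → τ ≡ σ
    agree⇒≡ {σ} {τ} Vσ Vτ facets = decidable-stable (τ ≟ˢ σ) (go n τ Vτ facets (∣p∣≤n (diff σ τ)))
      where
      go : ∀ m τ → V τ → (∀ i → V (flip i σ) → lookup τ i ≡ lookup σ i) → ∣ diff σ τ ∣ ≤ m → ¬ τ ≢ σ
      go m τ Vτ facets le τ≢σ with ∣ diff σ τ ∣ in eq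
      ... | zero = τ≢σ (subset-ext (λ i → [ id , (λ e → ⊥-elim (∣∣≡0 (diff σ τ) eq i (∋-diff σ τ (λ e′ → not≢ (trans (sym e) e′))))) ]′
                     (bool-cases (lookup σ i) (lookup τ i))))
      ... | suc zero with some (diff σ τ) (≤-reflexive (sym eq))
      ... | i , i∈ = not≢ (trans (sym (diff-∋ σ τ i∈)) (facets i (subst V τ≡flip Vτ)))
        where
        τ≡flip : τ ≡ flip i σ
        τ≡flip = subset-ext same
          where
          same : ∀ k → lookup τ k ≡ lookup (flip i σ) k
          same k with k Data.Fin.≟ i
          ... | yes refl = trans (diff-∋ σ τ i∈) (sym (flip-self i σ))
          ... | no ne with bool-cases (lookup σ k) (lookup τ k)
          ... | inj₁ e = trans e (sym (flip-other i k σ ne))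
          ... | inj₂ e = ⊥-elim (1+n≰n (≤-trans (card≥2 (diff σ τ) (ne ∘ sym) i∈ (∋-diff σ τ (λ e′ → not≢ (trans (sym e) e′)))) (≤-reflexive eq)))
      go (suc m) τ Vτ facets le τ≢σ | suc (suc k) with two (diff σ τ) (subst (2 ≤_) (sym eq) (s≤s (s≤s z≤n)))
      ... | i , j , i≢j , i∈ , j∈ = strictly-between Vσ Vτ i≢j (diff-∋ σ τ i∈) (diff-∋ σ τ j∈)
              (λ x∈σ y∈τ → smaller {x∈σ = x∈σ} {y∈τ} i∈ j∈ , smaller {x∈σ = x∈σ} {y∈τ} j∈ i∈)
        where
        smaller : ∀ {i j x y} {x∈σ : Cell σ x} {y∈τ : Cell τ y} → diff σ τ ∋ i → diff σ τ ∋ j → ¬ Between x∈σ y∈τ i j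
        smaller {i} {j} i∈ j∈ (ρ , Vρ , common , ρi , ρj) =
          go m ρ Vρ (λ k Vk → common k (facets k Vk)) fewer (λ { refl → not≢ (sym ρi) })
          where
          without-j : diff σ ρ ⊑ del j (diff σ τ)
          without-j k h = ∋-del j (diff σ τ) (λ { refl → not≢ (trans (sym (diff-∋ σ ρ h)) ρj) })
            (∋-diff σ τ (λ e → not≢ (trans (sym (diff-∋ σ ρ h)) (common k e))))
          fewer : ∣ diff σ ρ ∣ ≤ m
          fewer = ≤-pred (≤-trans (s≤s (∣⊑∣ (diff σ ρ) (del j (diff σ τ)) without-j)) (≤-trans (≤-reflexive (trans (∣del∣ j (diff σ τ) j∈) eq)) le))

    -- The cell obtained by nudging `y` agrees with `σ` at the facets, so it is `σ`; a sign that is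
    -- not positive at `y` would have been flipped in it.
    facets⇒cell : ∀ {σ} → V σ → ∀ y → (∀ i → V (flip i σ) → Pos (s σ i y)) → Cell σ y
    facets⇒cell {σ} (x , x∈σ) y h =
      let ρ , Vρ , kept , flipped = nudge x∈σ y
          ρ≡σ = agree⇒≡ {σ} {ρ} (x , x∈σ) Vρ (λ k Vk → kept k (h k Vk))
      in inside (λ i → [ id , (λ q → ⊥-elim (not≢ (trans (sym (flipped i q)) (cong (λ v → lookup v i) ρ≡σ)))) ]′ (dec-Pos (s σ i y)))

    ray : ∀ {σ x} → Cell σ x → ∀ u → (∀ i → V (flip i σ) → NN (g σ i u)) → ∀ t → NN t → Cell σ (move x t u)
    ray {σ} {x} x∈σ u h t t≥0 = facets⇒cell {σ} (x , x∈σ) (move x t u) (λ i Vi → pos≡ (sym (s-move σ i x t u)) (Pos-⊕-NN (at x∈σ i) (NN-⊗ t≥0 (h i Vi))))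

  -- A segment from the cell to its neighbour crosses no hyperplane but `i`, so the crossing point
  -- is strictly on the right side of all others.
  facet : ∀ {σ x i} → Cell σ x → V (flip i σ) → FacetOf H x i
  facet {σ} {x} {i} x∈σ (y , y∈) =
    let z , z∈i , common , _ = crossing x∈σ y∈ (flip-self i σ)
    in z , sg≡0 (lookup σ i) z∈i , λ j ne → same-side {z} (lookup σ j) (at x∈σ j) (common j (flip-other i j σ ne))
    where
    same-side : ∀ {z j} b → Pos (sg b (value (H j) x)) → Pos (sg b (value (H j) z)) → SameStrictSide (H j) x z
    same-side true  p q = inj₁ (p , q)
    same-side false p q = inj₂ (Pos⇒≺0 p , Pos⇒≺0 q)

  independent : ∀ S → (∀ σ → V σ → ¬ (∀ i → V (flip i σ) → S ∋ i)) → Independent H S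
  independent S h x generic facets = h σ (x , x∈σ) (λ i Vi → mem ([]=⇒lookup (facets i (facet x∈σ Vi))))
    where
    side : ∀ i → Pos (value (H i) x) ⊎ NN (⊖ value (H i) x) → Bool
    side i = [ (λ _ → true) , (λ _ → false) ]′
    σ : Vec Bool n
    σ = tabulate (λ i → side i (dec-Pos (value (H i) x)))
    x∈σ : Cell σ x
    x∈σ = inside positive
     where
     positive : ∀ i → Pos (s σ i x)
     positive i with dec-Pos (value (H i) x) | lookup∘tabulate (λ i → side i (dec-Pos (value (H i) x))) i
     ... | inj₁ p        | e = subst (λ b → Pos (sg b (value (H i) x))) (sym e) p
     ... | inj₂ (inj₁ p) | e = subst (λ b → Pos (sg b (value (H i) x))) (sym e) p
     ... | inj₂ (inj₂ p) | _ = ⊥-elim (generic i (sg≡0 false p))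

positive-part : ∀ {A B : Set} → A ⊎ B → Bool
positive-part = [ (λ _ → true) , (λ _ → false) ]′

positive-true : ∀ {A B : Set} (x : A ⊎ B) → positive-part x ≡ true → A
positive-true (inj₁ a) _ = a

true-positive : ∀ {A : Set} (x : A ⊎ ¬ A) → A → positive-part x ≡ true
true-positive (inj₁ _)  _ = refl
true-positive (inj₂ na) a = ⊥-elim (na a)

elements : ∀ {n} → Subset n → List (Fin n)
elements p = select (lookup p) (fins _)

length-elements : ∀ {n} (p : Subset n) → length (elements p) ≡ ∣ p ∣
length-elements {n} p = trans (length-select (lookup p) (fins n)) (∑-∋ p)

∈-elements : ∀ {n} (p : Subset n) {i} → p ∋ i → i ∈ᴸ elements p
∈-elements p {i} (mem h) = ∈-select⁺ (lookup p) (∈-fins i) h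

module _ (R : RealField) where
  open Field R
  open LinearAlgebra R

  dot-ext : ∀ {d} (a x y : Point d) → (∀ k → a k ⊗ x k ≡ a k ⊗ y k) → dot a x ≡ dot a y
  dot-ext {zero}  a x y h = refl
  dot-ext {suc d} a x y h = cong₂ _⊕_ (h zero) (dot-ext (a ∘ suc) (x ∘ suc) (y ∘ suc) (h ∘ suc))

  nonzero? : ∀ {d} (u : Point d) → (∀ k → u k ≡ 𝟘) ⊎ (∃ λ k → u k ≢ 𝟘)
  nonzero? {zero}  u = inj₁ λ ()
  nonzero? {suc d} u with ≟0 (u zero) | nonzero? (u ∘ suc)
  ... | inj₂ ne | _             = inj₂ (zero , ne)
  ... | inj₁ _  | inj₂ (k , ne) = inj₂ (suc k , ne)
  ... | inj₁ e  | inj₁ h        = inj₁ (λ { zero → e ; (suc k) → h k })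

  absolute : ∀ a → ∃ λ m → NN m × NN (m ⊝ a) × NN (m ⊕ a)
  absolute a with dec-Pos a
  ... | inj₁ p = a , inj₁ p , inj₂ (⊕-inverse a) , NN-⊕ (inj₁ p) (inj₁ p)
  ... | inj₂ q = ⊖ a , q , NN-⊕ q q , inj₂ (trans (⊕-comm (⊖ a) a) (⊕-inverse a))

  bounded : ∀ {A : Set} (xs : List A) (f : A → ℝ) → ∃ λ T → Pos T × (∀ x → x ∈ᴸ xs → Pos (T ⊝ f x) × Pos (T ⊕ f x))
  bounded [] f = 𝟙 , Pos-𝟙 , λ _ ()
  bounded (x ∷ xs) f with bounded xs f | absolute (f x)
  ... | T , T>0 , h | m , m≥0 , m- , m+ = T ⊕ m , Pos-⊕-NN T>0 m≥0 , λ
    { _ (here refl) → pos≡ (solve 3 (λ T m a → T :+ (m :- a) := T :+ m :- a) refl T m (f x)) (Pos-⊕-NN T>0 m-)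
                    , pos≡ (solve 3 (λ T m a → T :+ (m :+ a) := T :+ m :+ a) refl T m (f x)) (Pos-⊕-NN T>0 m+)
    ; y (there k) → pos≡ (solve 3 (λ T m a → (T :- a) :+ m := T :+ m :- a) refl T m (f y)) (Pos-⊕-NN (proj₁ (h y k)) m≥0)
                  , pos≡ (solve 3 (λ T m a → (T :+ a) :+ m := T :+ m :+ a) refl T m (f y)) (Pos-⊕-NN (proj₂ (h y k)) m≥0) }

  reach : ∀ x y u w → u ⊗ w ≡ 𝟙 → x ⊕ ((y ⊝ x) ⊗ w) ⊗ u ≡ y
  reach x y u w e = trans (solve 4 (λ x y u w → x :+ ((y :- x) :* w) :* u := x :+ (y :- x) :* (u :* w)) refl x y u w)
    (trans (cong (λ o → x ⊕ (y ⊝ x) ⊗ o) e) (solve 2 (λ x y → x :+ (y :- x) :* :1 := y) refl x y))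

  reach-back : ∀ x T u w → ⊖ u ⊗ w ≡ 𝟙 → x ⊕ ((T ⊕ x) ⊗ w) ⊗ u ≡ ⊖ T
  reach-back x T u w e = trans (solve 4 (λ x T u w → x :+ ((T :+ x) :* w) :* u := x :- (T :+ x) :* (:- u :* w)) refl x T u w)
    (trans (cong (λ o → x ⊝ (T ⊕ x) ⊗ o) e) (solve 2 (λ x T → x :- (T :+ x) :* :1 := :- T) refl x T))

  dehomogenise : ∀ r u o p → u ⊗ r ≡ 𝟙 → ⊖ o ⊗ u ⊕ p ≡ 𝟘 → 𝟘 ⊕ r ⊗ p ⊝ o ≡ 𝟘
  dehomogenise r u o p inv e = trans (solve 3 (λ r p o → :0 :+ r :* p :- o := r :* p :- :1 :* o) refl r p o)
    (trans (cong (λ z → r ⊗ p ⊝ z ⊗ o) (sym inv))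
    (trans (solve 4 (λ r p o z → r :* p :- z :* r :* o := r :* (:- o :* z :+ p)) refl r p o u)
    (trans (cong (r ⊗_) e) (solve 1 (λ r → r :* :0 := :0) refl r))))

-- Facets, walls and simplicial cells

module Cells (R : RealField) {n d′ : ℕ} (H : Fin n → Geometry.Hyperplane R (suc d′)) (distinct : Geometry.Distinct R H)
             (decV : ∀ σ → Arrangement.V R H σ ⊎ ¬ Arrangement.V R H σ) where
  open Field R
  open LinearAlgebra R
  open Arrangement R H

  private
    d = suc d′

  nonempty : Vec Bool n → Bool
  nonempty σ = positive-part (decV σ)

  F : Vec Bool n → Subset n
  F σ = tabulate (λ i → nonempty (flip i σ))

  F-∋ : ∀ σ {i} → F σ ∋ i → V (flip i σ)
  F-∋ σ {i} (mem h) = positive-true (decV (flip i σ)) (trans (sym (lookup∘tabulate _ i)) h)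

  ∋-F : ∀ σ {i} → V (flip i σ) → F σ ∋ i
  ∋-F σ {i} Vi = mem (trans (lookup∘tabulate _ i) (true-positive (decV (flip i σ)) Vi))

  -- The origin stands in for empty cells, so that the box can be taken over all sign vectors.
  rep : Vec Bool n → Point d
  rep σ = [ proj₁ , (λ _ _ → 𝟘) ]′ (decV σ)

  rep∈ : ∀ {σ} → V σ → Cell σ (rep σ)
  rep∈ {σ} Vσ with decV σ
  ... | inj₁ (x , x∈σ) = x∈σ
  ... | inj₂ empty     = ⊥-elim (empty Vσ)

  coordinates : List (Vec Bool n × Fin d)
  coordinates = concatMap (λ σ → map (σ ,_) (fins d)) (vecs n)

  box : ∃ λ T → Pos T × (∀ x → x ∈ᴸ coordinates → Pos (T ⊝ rep (proj₁ x) (proj₂ x)) × Pos (T ⊕ rep (proj₁ x) (proj₂ x)))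
  box = bounded R coordinates (λ x → rep (proj₁ x) (proj₂ x))

  -- Every nonempty cell has a point with all coordinates strictly between - T and T.
  T : ℝ
  T = proj₁ box

  in-box : ∀ σ k → Pos (T ⊝ rep σ k) × Pos (T ⊕ rep σ k)
  in-box σ k = proj₂ (proj₂ box) (σ , k) (∈-bind⁺ (λ σ → map (σ ,_) (fins d)) (∈-vecs σ) (∈-map⁺ (σ ,_) (∈-fins k)))

  W : Fin d → Bool → Vec Bool n → Set
  W k b σ = ∃ λ x → Cell σ x × x k ≡ sg b T

  escape : ∀ {σ} → V σ → ∀ u k → u k ≢ 𝟘 → (∀ i → F σ ∋ i → NN (g σ i u)) → ∃ λ b → W k b σ
  escape {σ} Vσ u k ne h = [ up-case , [ (λ e → ⊥-elim (ne e)) , down-case ]′ ]′ (sign (u k))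
    where
    travel : ∀ t → NN t → Cell σ (move (rep σ) t u)
    travel = ray distinct {σ} {rep σ} (rep∈ Vσ) u (λ i Vi → h i (∋-F σ Vi))
    up-case : Pos (u k) → ∃ λ b → W k b σ
    up-case p = let w , w>0 , inv = Pos-inverse p in
      true , move (rep σ) ((T ⊝ rep σ k) ⊗ w) u , travel _ (inj₁ (⊗-pos _ _ (proj₁ (in-box σ k)) w>0)) , reach R (rep σ k) T (u k) w inv
    down-case : Pos (⊖ u k) → ∃ λ b → W k b σ
    down-case p = let w , w>0 , inv = Pos-inverse p in
      false , move (rep σ) ((T ⊕ rep σ k) ⊗ w) u , travel _ (inj₁ (⊗-pos _ _ (proj₂ (in-box σ k)) w>0)) , reach-back R (rep σ k) T (u k) w inv

  g-⊖ : ∀ σ i u → g σ i (λ k → ⊖ u k) ≡ ⊖ g σ i u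
  g-⊖ σ i u = trans (cong (sg (lookup σ i)) (dot-⊖ (normal (H i)) u)) (sg-⊖ (lookup σ i) _)
    where sg-⊖ : ∀ b x → sg b (⊖ x) ≡ ⊖ sg b x
          sg-⊖ true  x = refl
          sg-⊖ false x = refl

  g-0 : ∀ σ i u → dot (normal (H i)) u ≡ 𝟘 → g σ i u ≡ 𝟘
  g-0 σ i u e = trans (cong (sg (lookup σ i)) e) (sg-0 (lookup σ i))

  orient : ∀ {σ} → V σ → ∀ u k → u k ≢ 𝟘 → ∀ i₀ → (∀ i → F σ ∋ i → i ≢ i₀ → dot (normal (H i)) u ≡ 𝟘) → ∃ λ k → ∃ λ b → W k b σ
  orient {σ} Vσ u k ne i₀ h = [ (λ p → k , escape Vσ u k ne (cases u (inj₁ p) h))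
                              , (λ q → k , escape Vσ (λ k → ⊖ u k) k (λ e → ne (sg≡0 false e))
                                  (cases (λ k → ⊖ u k) (subst NN (sym (g-⊖ σ i₀ u)) q)
                                    (λ i m i≢ → trans (dot-⊖ (normal (H i)) u) (trans (cong ⊖_ (h i m i≢)) (sg-0 false))))) ]′ (dec-Pos (g σ i₀ u))
    where
    cases : ∀ u → NN (g σ i₀ u) → (∀ i → F σ ∋ i → i ≢ i₀ → dot (normal (H i)) u ≡ 𝟘) → ∀ i → F σ ∋ i → NN (g σ i u)
    cases u p h i m with i Data.Fin.≟ i₀
    ... | yes refl = p
    ... | no  i≢   = inj₂ (g-0 σ i u (h i m i≢))

  normals-kernel : ∀ (p : Subset n) → ∣ p ∣ < d → ∃ λ u → (∃ λ k → u k ≢ 𝟘) × (∀ i → p ∋ i → dot (normal (H i)) u ≡ 𝟘)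
  normals-kernel p lt = let u , ne , h = kernel (map (normal ∘ H) (elements p)) (subst (_< d) (sym (trans (length-map _ (elements p)) (length-elements p))) lt)
    in u , ne , λ i m → h _ (∈-map⁺ (normal ∘ H) (∈-elements p m))

  few-facets : ∀ {σ} → V σ → ∣ F σ ∣ < d → ∃ λ u → (∃ λ k → u k ≢ 𝟘) × (∀ j → dot (normal (H j)) u ≡ 𝟘)
  few-facets {σ} Vσ lt = u , nz , λ j → sg≡0 (lookup σ j) ([ (λ p → ⊥-elim (blocked j (λ k → ⊖ u k) (λ i m → trans (dot-⊖ (normal (H i)) u) (trans (cong ⊖_ (h i m)) (sg-0 false)))
                                                             (pos≡ (trans (⊖⊖′ _) (cong ⊖_ (sym (g-⊖ σ j u)))) p)))
                                                         , [ id , (λ p → ⊥-elim (blocked j u h p)) ]′ ]′ (sign (g σ j u)))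
    where
    ker = normals-kernel (F σ) lt
    u = proj₁ ker
    nz = proj₁ (proj₂ ker)
    h = proj₂ (proj₂ ker)
    ⊖⊖′ : ∀ z → z ≡ ⊖ ⊖ z
    ⊖⊖′ = solve 1 (λ z → z := :- :- z) refl
    blocked : ∀ j u → (∀ i → F σ ∋ i → dot (normal (H i)) u ≡ 𝟘) → ¬ Pos (⊖ g σ j u)
    blocked j u h p = Pos⇒≢0 (at cell j) (trans (s-move σ j (rep σ) t u) hits)
      where
      inv = Pos-inverse p
      w = proj₁ inv
      t = s σ j (rep σ) ⊗ w
      cell : Cell σ (move (rep σ) t u)
      cell = ray distinct {σ} {rep σ} (rep∈ Vσ) u (λ i Vi → inj₂ (g-0 σ i u (h i (∋-F σ Vi)))) t (inj₁ (⊗-pos _ _ (at (rep∈ Vσ) j) (proj₁ (proj₂ inv))))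
      hit : ∀ a w q → ⊖ q ⊗ w ≡ 𝟙 → a ⊕ (a ⊗ w) ⊗ q ≡ 𝟘
      hit a w q e = trans (solve 3 (λ a w q → a :+ (a :* w) :* q := a :- a :* (:- q :* w)) refl a w q)
                      (trans (cong (λ o → a ⊝ a ⊗ o) e) (solve 1 (λ a → a :- a :* :1 := :0) refl a))
      hits : s σ j (rep σ) ⊕ t ⊗ g σ j u ≡ 𝟘
      hits = hit (s σ j (rep σ)) w (g σ j u) (proj₂ (proj₂ inv))

  no-wall⇒many-facets : ∀ {σ} → V σ → (∀ k b → ¬ W k b σ) → d < ∣ F σ ∣
  no-wall⇒many-facets {σ} Vσ free = ≰⇒> (λ le → few le (∣ F σ ∣ Data.Nat.≟ 0))
    where
    few : ∣ F σ ∣ ≤ d → Dec (∣ F σ ∣ ≡ 0) → ⊥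
    few le (yes e) = let u , (k , ne) , _ = normals-kernel (F σ) (subst (_< d) (sym e) z<s)
                         b , w = escape Vσ u k ne (λ i m → ⊥-elim (∣∣≡0 (F σ) e i m))
                     in free k b w
    few le (no ne₀) = let i₀ , m₀ = some (F σ) (n≢0⇒n>0 ne₀)
                          u , (k , ne) , h = normals-kernel (del i₀ (F σ)) (subst (_≤ d) (sym (∣del∣ i₀ (F σ) m₀)) le)
                          k′ , b , w = orient Vσ u k ne i₀ (λ i m i≢ → h i (∋-del i₀ (F σ) (i≢ ∘ sym) m))
                      in free k′ b w

  -- A bounded simplicial cell is determined by its signs at d of its facets: it sits at their common point w.
  module Apex (D : Subset n) (∣D∣ : ∣ D ∣ ≡ d) where

    private
      ker = kernel {suc d} (map (λ i → λ { zero → ⊖ offset (H i) ; (suc k) → normal (H i) k }) (elements D))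
                   (subst (_< suc d) (sym (trans (length-map _ (elements D)) (trans (length-elements D) ∣D∣))) (n<1+n d))
      u₀ = proj₁ ker zero
      u : Point d
      u k = proj₁ ker (suc k)

      equation : ∀ i → D ∋ i → ⊖ offset (H i) ⊗ u₀ ⊕ dot (normal (H i)) u ≡ 𝟘
      equation i m = proj₂ (proj₂ ker) _ (∈-map⁺ _ (∈-elements D m))

    record Simplex (σ : Vec Bool n) : Set where
      field
        V-σ   : V σ
        inner : ∀ k b → ¬ W k b σ
        D⊑F   : D ⊑ F σ
        size  : ∣ F σ ∣ ≡ suc d

    module _ {σ} (S : Simplex σ) where
      open Simplex S

      private
        extra : ∃ λ v → F σ ∋ v × ¬ D ∋ v
        extra = bigger-has-more (F σ) D (≤-reflexive (trans (cong suc ∣D∣) (sym size)))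

      v : Fin n
      v = proj₁ extra

      facets : ∀ i → F σ ∋ i → i ≢ v → D ∋ i
      facets i m i≢ with add-∋ v D (subst (_∋ i) (sym whole) m)
        where
        whole : add v D ≡ F σ
        whole = ⊑-∣≡∣ (add v D) (F σ) (add-⊑ v (proj₁ (proj₂ extra)) D⊑F)
                  (≤-reflexive (trans size (sym (trans (∣add∣ v D (proj₂ (proj₂ extra))) (cong suc ∣D∣)))))
      ... | inj₁ e = ⊥-elim (i≢ (sym e))
      ... | inj₂ h = h

      u₀≢0 : u₀ ≢ 𝟘
      u₀≢0 e = let k , ne = direction (proj₁ (proj₂ ker)) ; k′ , b , w = orient V-σ u k ne v flat in inner k′ b w
        where
        direction : (∃ λ k → proj₁ ker k ≢ 𝟘) → ∃ λ k → u k ≢ 𝟘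
        direction (zero  , ne) = ⊥-elim (ne e)
        direction (suc k , ne) = k , ne
        drop : ∀ o p → o ⊗ 𝟘 ⊕ p ≡ 𝟘 → p ≡ 𝟘
        drop o p = trans (solve 2 (λ o p → p := o :* :0 :+ p) refl o p)
        flat : ∀ i → F σ ∋ i → i ≢ v → dot (normal (H i)) u ≡ 𝟘
        flat i m i≢ = drop (⊖ offset (H i)) _ (subst (λ z → ⊖ offset (H i) ⊗ z ⊕ dot (normal (H i)) u ≡ 𝟘) e (equation i (facets i m i≢)))

    Vertex : Point d → Set
    Vertex w = ∀ i → D ∋ i → value (H i) w ≡ 𝟘

    vertex : ∀ {σ} → Simplex σ → ∃ Vertex
    vertex S = (λ k → 𝟘 ⊕ r ⊗ u k) , λ i m → on-plane i (equation i m)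
      where
      r = proj₁ (⊗-inverse u₀ (u₀≢0 S))
      on-plane : ∀ i → ⊖ offset (H i) ⊗ u₀ ⊕ dot (normal (H i)) u ≡ 𝟘 → value (H i) (λ k → 𝟘 ⊕ r ⊗ u k) ≡ 𝟘
      on-plane i e = trans (cong (_⊝ offset (H i)) (trans (dot-move (normal (H i)) (λ _ → 𝟘) u r)
        (cong (_⊕ r ⊗ dot (normal (H i)) u) (trans (dot-comm (normal (H i)) (λ _ → 𝟘)) (dot-0 (λ _ → 𝟘) (normal (H i)) (λ _ → refl))))))
        (dehomogenise R r u₀ (offset (H i)) _ (proj₂ (⊗-inverse u₀ (u₀≢0 S))) e)

    module _ {w : Point d} (vertex-w : Vertex w) where

      s-w : ∀ σ {i} → D ∋ i → s σ i w ≡ 𝟘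
      s-w σ {i} m = trans (cong (sg (lookup σ i)) (vertex-w i m)) (sg-0 (lookup σ i))

      private
        ⊝𝟘 : ∀ a {b} → b ≡ 𝟘 → a ≡ a ⊝ b
        ⊝𝟘 a refl = solve 1 (λ a → a := a :- :0) refl a

      apex-side : ∀ {σ} (S : Simplex σ) → Pos (s σ (v S) w)
      apex-side {σ} S = [ id , (λ q → ⊥-elim (outward q)) ]′ (dec-Pos (s σ (v S) w))
        where
        open Simplex S
        x = rep σ
        outward : ¬ NN (⊖ s σ (v S) w)
        outward q = [ (λ zero-u → Pos⇒≢0 g>0 (g-0 σ (v S) (to w x) (trans (dot-comm (normal (H (v S))) (to w x)) (dot-0 (to w x) (normal (H (v S))) zero-u))))
                    , (λ { (k , ne) → let b , wall = escape V-σ (to w x) k ne rising in inner k b wall }) ]′ (nonzero? R (to w x))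
          where
          g>0 : Pos (g σ (v S) (to w x))
          g>0 = pos≡ (sym (g-to σ (v S) w x)) (Pos-⊕-NN (at (rep∈ V-σ) (v S)) q)
          rising : ∀ i → F σ ∋ i → NN (g σ i (to w x))
          rising i m with i Data.Fin.≟ v S
          ... | yes refl = inj₁ g>0
          ... | no  i≢   = inj₁ (pos≡ (trans (⊝𝟘 _ (s-w σ (facets S i m i≢))) (sym (g-to σ i w x))) (at (rep∈ V-σ) i))

      towards-vertex : ∀ {σ} (S : Simplex σ) y → (∀ i → D ∋ i → Pos (s σ i y)) →
                       ∃ λ ε → Pos ε × (∀ t → Pos t → NN (ε ⊝ t) → Cell σ (move w t (to w y)))
      towards-vertex {σ} S y h = let ε , ε>0 , close = near₁ (s σ (v S) w) (g σ (v S) (to w y)) in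
        ε , ε>0 , λ t t>0 t≤ε → facets⇒cell distinct {σ} (Simplex.V-σ S) (move w t (to w y)) (λ i Vi →
          side t t>0 i (∋-F σ Vi) (close (apex-side S) t t>0 t≤ε) (i Data.Fin.≟ v S))
        where
        scaled : ∀ {a} t b → a ≡ 𝟘 → t ⊗ b ≡ a ⊕ t ⊗ (b ⊝ a)
        scaled t b refl = solve 2 (λ t b → t :* b := :0 :+ t :* (b :- :0)) refl t b
        side : ∀ t → Pos t → ∀ i → F σ ∋ i → Pos (s σ (v S) w ⊕ t ⊗ g σ (v S) (to w y)) → Dec (i ≡ v S) → Pos (s σ i (move w t (to w y)))
        side t t>0 i m p (yes refl) = pos≡ (sym (s-move σ (v S) w t (to w y))) p
        side t t>0 i m p (no i≢) = pos≡ (trans (scaled t (s σ i y) (s-w σ (facets S i m i≢))) (sym (s-toward σ i w t y)))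
                                        (⊗-pos _ _ t>0 (h i (facets S i m i≢)))

      meet : ∀ {σ τ} → Simplex σ → Simplex τ → (∀ i → D ∋ i → lookup σ i ≡ lookup τ i) → σ ≡ τ
      meet {σ} {τ} S S′ agree =
        let ε₁ , p₁ , c₁ = towards-vertex S (rep τ) (λ i m → pos≡ (s-agree σ τ i (rep τ) (agree′ i m)) (at (rep∈ (Simplex.V-σ S′)) i))
            ε₂ , p₂ , c₂ = towards-vertex S′ (rep τ) (λ i m → at (rep∈ (Simplex.V-σ S′)) i)
            t , t>0 , le₁ , le₂ = min p₁ p₂
        in subset-ext (λ i → same-sign (lookup σ i) (lookup τ i) (at (c₁ t t>0 le₁) i) (at (c₂ t t>0 le₂) i))
        where
        agree′ : ∀ i → D ∋ i → lookup τ i ≡ lookup σ i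
        agree′ i m = sym (agree i m)
        same-sign : ∀ a b {z} → Pos (sg a z) → Pos (sg b z) → a ≡ b
        same-sign true  true  _ _ = refl
        same-sign false false _ _ = refl
        same-sign true  false p q = ⊥-elim (Pos-asym p q)
        same-sign false true  p q = ⊥-elim (Pos-asym q p)

    simplex-determined : ∀ {σ τ} → Simplex σ → Simplex τ → (∀ i → D ∋ i → lookup σ i ≡ lookup τ i) → σ ≡ τ
    simplex-determined S S′ agree = let w , vw = vertex S in meet {w} vw S S′ agree

  count-by-shatter : ∀ (P : Point d → Set) (dec : ∀ σ → (∃ λ x → Cell σ x × P x) ⊎ ¬ (∃ λ x → Cell σ x × P x)) (Ks : List (Fin d)) →
    (∀ (w : Point d) → (∀ k → k ∈ᴸ Ks → w k ≡ 𝟘) → ∀ x y → P x → P y → dot w x ≡ dot w y) →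
    ∑ (vecs n) (λ σ → ⟦ positive-part (dec σ) ⟧) ≤ suc n ^ length Ks
  count-by-shatter P dec Ks sep = sauer _ (length Ks) (λ Q sh → ≮⇒≥ (λ lt → no-shatter H P Ks sep Q lt (λ τ →
    let σ , Fσ , agree = order-shattered-realises _ Q sh τ
        x , x∈σ , Px = positive-true (dec σ) Fσ
    in x , Px , λ i m → subst (λ b → Pos (sg b (value (H i) x))) (agree i m) (at x∈σ i))))

  count-cells : ∑ (vecs n) (λ σ → ⟦ nonempty σ ⟧) ≤ suc n ^ d
  count-cells = begin
    ∑ (vecs n) (λ σ → ⟦ nonempty σ ⟧) ≤⟨ ∑-mono (vecs n) (λ σ → ⟦⟧-mono (λ h → true-positive (dec σ) (let x , c = positive-true (decV σ) h in x , c , tt))) ⟩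
    ∑ (vecs n) (λ σ → ⟦ positive-part (dec σ) ⟧)
      ≤⟨ count-by-shatter (λ _ → ⊤) dec (fins d) (λ w h x y _ _ → trans (dot-0 w x (λ k → h k (∈-fins k))) (sym (dot-0 w y (λ k → h k (∈-fins k))))) ⟩
    suc n ^ length (fins d) ≡⟨ cong (suc n ^_) (length-fins d) ⟩
    suc n ^ d ∎
    where
    open ≤-Reasoning
    dec : ∀ σ → (∃ λ x → Cell σ x × ⊤) ⊎ ¬ (∃ λ x → Cell σ x × ⊤)
    dec σ = [ (λ { (x , c) → inj₁ (x , c , tt) }) , (λ ne → inj₂ (λ { (x , c , _) → ne (x , c) })) ]′ (decV σ)

  module Walls (decW : ∀ k b σ → W k b σ ⊎ ¬ W k b σ) where

    count-wall : ∀ k b → ∑ (vecs n) (λ σ → ⟦ positive-part (decW k b σ) ⟧) ≤ suc n ^ d′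
    count-wall k b = subst (λ e → ∑ (vecs n) (λ σ → ⟦ positive-part (decW k b σ) ⟧) ≤ suc n ^ e) e
      (count-by-shatter (λ x → x k ≡ sg b T) (decW k b) Ks (λ w h x y px py → dot-ext R w x y (λ j → pointwise w h x y px py j)))
      where
      only = add k ∅
      Ks = select (λ i → not (lookup only i)) (fins d)
      e : length Ks ≡ d′
      e = +-cancelʳ-≡ 1 (length Ks) d′ (trans (trans (cong (length Ks +_) (sym (trans (∣add∣ k ∅ (∉∅ k)) (cong suc (∣∅∣ d))))) (length-complement only)) (+-comm 1 d′))
      pointwise : ∀ (w : Point d) → (∀ k → k ∈ᴸ Ks → w k ≡ 𝟘) → ∀ x y → x k ≡ sg b T → y k ≡ sg b T → ∀ j → w j ⊗ x j ≡ w j ⊗ y j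
      pointwise w h x y px py j with k Data.Fin.≟ j
      ... | yes refl = cong (w k ⊗_) (trans px (sym py))
      ... | no  k≢j  = trans (cong (_⊗ x j) wj) (trans (solve 2 (λ a b → :0 :* a := :0 :* b) refl (x j) (y j)) (cong (_⊗ y j) (sym wj)))
        where
        wj : w j ≡ 𝟘
        wj = h j (∈-select⁺ (λ i → not (lookup only i)) (∈-fins j) (cong not (≢true (λ e → [ k≢j , ∉∅ j ]′ (add-∋ k ∅ (mem e))))))

    hits : Vec Bool n → ℕ
    hits σ = ∑ (fins d) (λ k → ⟦ positive-part (decW k true σ) ⟧ + ⟦ positive-part (decW k false σ) ⟧)

    walled : Vec Bool n → Bool
    walled σ = 1 ≤ᵇ hits σ

    not-walled : ∀ σ → walled σ ≡ false → ∀ k b → ¬ W k b σ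
    not-walled σ e k b wall = not-both (≤ᵇ-intro (≤-trans (hit b wall) (∑-∈ (λ k → ⟦ positive-part (decW k true σ) ⟧ + ⟦ positive-part (decW k false σ) ⟧) (∈-fins k)))) e
      where
      hit : ∀ b → W k b σ → 1 ≤ ⟦ positive-part (decW k true σ) ⟧ + ⟦ positive-part (decW k false σ) ⟧
      hit true  wall = ≤-trans (≤-reflexive (sym (⟦⟧-true (true-positive (decW k true σ) wall)))) (m≤m+n _ _)
      hit false wall = ≤-trans (≤-reflexive (sym (⟦⟧-true (true-positive (decW k false σ) wall)))) (m≤n+m _ _)

    count-walled : ∑ (vecs n) (λ σ → ⟦ walled σ ⟧) ≤ d * (2 * suc n ^ d′)
    count-walled = begin
      ∑ (vecs n) (λ σ → ⟦ walled σ ⟧) ≤⟨ ∑-mono (vecs n) (λ σ → below (hits σ)) ⟩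
      ∑ (vecs n) hits ≡⟨ ∑-swap (vecs n) (fins d) _ ⟩
      ∑ (fins d) (λ k → ∑ (vecs n) (λ σ → ⟦ positive-part (decW k true σ) ⟧ + ⟦ positive-part (decW k false σ) ⟧))
        ≤⟨ ∑-mono (fins d) (λ k → ≤-trans (≤-reflexive (∑-+ (vecs n) _ _)) (≤-trans (+-mono-≤ (count-wall k true) (count-wall k false))
             (≤-reflexive (cong (suc n ^ d′ +_) (sym (+-identityʳ _)))))) ⟩
      ∑ (fins d) (λ k → 2 * suc n ^ d′) ≡⟨ trans (∑-const (fins d) _) (cong (_* (2 * suc n ^ d′)) (length-fins d)) ⟩
      d * (2 * suc n ^ d′) ∎
      where
      open ≤-Reasoning
      below : ∀ h → ⟦ 1 ≤ᵇ h ⟧ ≤ h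
      below zero    = z≤n
      below (suc h) = s≤s z≤n

-- If every normal is orthogonal to u, the arrangement is a product along u, and the coordinate k with u k ≠ 0 can be dropped.
module Projection (R : RealField) {n d : ℕ} (H : Fin n → Geometry.Hyperplane R (suc d)) where
  open Field R
  open LinearAlgebra R
  open Arrangement R H using (move)
  open import Data.Vec.Functional using (insertAt)
  open import Data.Vec.Functional.Properties using (insertAt-lookup; insertAt-punchIn)
  open import Data.Fin.Properties using (punchIn-punchOut)

  private
    split-step : ∀ a b c p → a ⊕ (b ⊗ c ⊕ p) ≡ b ⊗ c ⊕ (a ⊕ p)
    split-step = solve 4 (λ a b c p → a :+ (b :* c :+ p) := b :* c :+ (a :+ p)) refl

    +𝟘 : ∀ a → a ⊕ 𝟘 ≡ a
    +𝟘 = solve 1 (λ a → a :+ :0 := a) refl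

    𝟘-term : ∀ a p → a ⊗ 𝟘 ⊕ p ≡ p
    𝟘-term = solve 2 (λ a p → a :* :0 :+ p := p) refl

    level : ∀ x r u → u ⊗ r ≡ 𝟙 → x ⊕ ⊖ (x ⊗ r) ⊗ u ≡ 𝟘
    level x r u e = trans (solve 3 (λ x r u → x :+ :- (x :* r) :* u := x :- x :* (u :* r)) refl x r u)
      (trans (cong (λ o → x ⊝ x ⊗ o) e) (solve 1 (λ x → x :- x :* :1 := :0) refl x))

    flat-step : ∀ v t → v ⊕ t ⊗ 𝟘 ≡ v
    flat-step = solve 2 (λ v t → v :+ t :* :0 := v) refl

  dot-split : ∀ {d} (k : Fin (suc d)) (a x : Point (suc d)) → dot a x ≡ a k ⊗ x k ⊕ dot (a ∘ punchIn k) (x ∘ punchIn k)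
  dot-split         zero    a x = refl
  dot-split {suc d} (suc k) a x = trans (cong (a zero ⊗ x zero ⊕_) (dot-split k (a ∘ suc) (x ∘ suc)))
                                        (split-step _ (a (suc k)) (x (suc k)) _)

  module _ (u : Point (suc d)) (k : Fin (suc d)) (u≢0 : u k ≢ 𝟘) (flat : ∀ j → dot (normal (H j)) u ≡ 𝟘) where

    private
      nz : ∀ j → ¬ (∀ i → normal (H j) (punchIn k i) ≡ 𝟘)
      nz j h = nonzero (H j) all
        where
        at-k : normal (H j) k ≡ 𝟘
        at-k = product-zero u≢0 (trans (⊗-comm _ _) (trans (sym (trans (cong (normal (H j) k ⊗ u k ⊕_) (dot-0 _ (u ∘ punchIn k) h)) (+𝟘 _)))
                 (trans (sym (dot-split k (normal (H j)) u)) (flat j))))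
        all : ∀ i → normal (H j) i ≡ 𝟘
        all i with k Data.Fin.≟ i
        ... | yes refl = at-k
        ... | no  k≢i  = subst (λ i → normal (H j) i ≡ 𝟘) (punchIn-punchOut k≢i) (h (punchOut k≢i))

    H′ : Fin n → Hyperplane d
    H′ j = hyp (normal (H j) ∘ punchIn k) (offset (H j)) (nz j)

    lift : Point d → Point (suc d)
    lift y = insertAt y k 𝟘

    value-lift : ∀ j y → value (H j) (lift y) ≡ value (H′ j) y
    value-lift j y = cong (_⊝ offset (H j)) (trans (dot-split k (normal (H j)) (lift y))
      (trans (cong₂ (λ a b → normal (H j) k ⊗ a ⊕ b) (insertAt-lookup y k 𝟘)
        (dot-cong {a = normal (H j) ∘ punchIn k} (λ _ → refl) (insertAt-punchIn y k 𝟘))) (𝟘-term _ _)))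

    project : Point (suc d) → Point d
    project x i = move x (⊖ (x k ⊗ proj₁ (⊗-inverse (u k) u≢0))) u (punchIn k i)

    value-project : ∀ j x → value (H′ j) (project x) ≡ value (H j) x
    value-project j x = cong (_⊝ offset (H j)) (sym (begin
      dot a x                             ≡⟨ flat-step (dot a x) t ⟨
      dot a x ⊕ t ⊗ 𝟘                     ≡⟨ cong (λ z → dot a x ⊕ t ⊗ z) (flat j) ⟨
      dot a x ⊕ t ⊗ dot a u               ≡⟨ dot-move a x u t ⟨
      dot a (move x t u)                  ≡⟨ dot-split k a (move x t u) ⟩
      a k ⊗ move x t u k ⊕ dot (a ∘ punchIn k) (project x)
        ≡⟨ cong (λ z → a k ⊗ z ⊕ dot (a ∘ punchIn k) (project x)) (level (x k) (proj₁ (⊗-inverse (u k) u≢0)) (u k) (proj₂ (⊗-inverse (u k) u≢0))) ⟩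
      a k ⊗ 𝟘 ⊕ dot (a ∘ punchIn k) (project x) ≡⟨ 𝟘-term _ _ ⟩
      dot (a ∘ punchIn k) (project x) ∎))
      where
      open ≡-Reasoning
      a = normal (H j)
      t = ⊖ (x k ⊗ proj₁ (⊗-inverse (u k) u≢0))

    on-project : ∀ j x → On (H′ j) (project x) → On (H j) x
    on-project j x = trans (sym (value-project j x))

    project-on : ∀ j x → On (H j) x → On (H′ j) (project x)
    project-on j x = trans (value-project j x)

    distinct′ : Distinct H → Distinct H′
    distinct′ distinct i j i≢j same = distinct i j i≢j (λ x → mk⇔
      (λ on → on-project j x (Equivalence.to (same (project x)) (project-on i x on)))
      (λ on → on-project i x (Equivalence.from (same (project x)) (project-on j x on))))

    independent′ : ∀ S → Independent H′ S → Independent H S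
    independent′ S ind x generic facets = ind (project x) (λ j → generic j ∘ on-project j x) (λ i f → facets i (facet′ i f))
      where
      sides : ∀ j y → SameStrictSide (H′ j) (project x) y → SameStrictSide (H j) x (lift y)
      sides j y = subst₂ (λ a b → ((𝟘 ≺ a) × (𝟘 ≺ b)) ⊎ ((a ≺ 𝟘) × (b ≺ 𝟘))) (value-project j x) (sym (value-lift j y))
      facet′ : ∀ i → FacetOf H′ (project x) i → FacetOf H x i
      facet′ i (y , on , same) = lift y , trans (value-lift i y) on , λ j ne → sides j y (same j ne)

module Family {n : ℕ} (F : Vec Bool n → Subset n) (P : Vec Bool n → Bool) (k : ℕ) where

  piece : ∀ p → Dec (k ≤ ∣ p ∣) → List (Subset n)
  piece p (yes h) = proj₁ (trim k p h) ∷ []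
  piece p (no  _) = []

  pieces : Vec Bool n → List (Subset n)
  pieces σ = if P σ then piece (F σ) (k ≤? ∣ F σ ∣) else []

  family : List (Subset n)
  family = concatMap pieces (vecs n)

  size : ∀ O → O ∈ᴸ family → ∣ O ∣ ≡ k
  size O m with ∈-bind⁻ pieces (vecs n) m
  ... | σ , _ , m′ with P σ | k ≤? ∣ F σ ∣
  size O m | σ , _ , here refl | true | yes h = proj₂ (proj₂ (trim k (F σ) h))

  length-family : length family ≤ ∑ (vecs n) (λ σ → ⟦ P σ ⟧)
  length-family = begin
    length family                                 ≡⟨ trans (∑-const family 1) (*-identityʳ _) ⟨
    ∑ family (λ _ → 1)                            ≡⟨ ∑-concatMap pieces (vecs n) _ ⟩
    ∑ (vecs n) (λ σ → ∑ (pieces σ) (λ _ → 1))     ≤⟨ ∑-mono (vecs n) at-most-one ⟩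
    ∑ (vecs n) (λ σ → ⟦ P σ ⟧) ∎
    where
    open ≤-Reasoning
    at-most-one : ∀ σ → ∑ (pieces σ) (λ _ → 1) ≤ ⟦ P σ ⟧
    at-most-one σ with P σ | k ≤? ∣ F σ ∣
    ... | true  | yes _ = ≤-refl
    ... | true  | no  _ = z≤n
    ... | false | _     = z≤n

  covers : ∀ σ → P σ ≡ true → k ≤ ∣ F σ ∣ → ∃ λ O → O ∈ᴸ family × O ⊑ F σ
  covers σ Pσ h = let O , m , s = in-piece in O , ∈-bind⁺ pieces (∈-vecs σ) (subst (λ b → O ∈ᴸ (if b then piece (F σ) (k ≤? ∣ F σ ∣) else [])) (sym Pσ) m) , s
    where
    in-piece : ∃ λ O → O ∈ᴸ piece (F σ) (k ≤? ∣ F σ ∣) × O ⊑ F σ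
    in-piece with k ≤? ∣ F σ ∣
    ... | yes h′ = proj₁ (trim k (F σ) h′) , here refl , proj₁ (proj₂ (trim k (F σ) h′))
    ... | no  nh = ⊥-elim (nh h)

same : ∀ {n} → Subset n → Subset n → Bool
same p q = does (p ≟ˢ q)

same⇒≡ : ∀ {n} (p q : Subset n) → same p q ≡ true → p ≡ q
same⇒≡ p q h with p ≟ˢ q
... | yes e = e

same-refl : ∀ {n} (p : Subset n) → same p p ≡ true
same-refl p with p ≟ˢ p
... | yes _ = refl
... | no ne = ⊥-elim (ne refl)

∑-same : ∀ {n} (p : Subset n) (h : Subset n → ℕ) → ∑ (vecs n) (λ q → ⟦ same p q ⟧ * h q) ≤ h p
∑-same {n} p h = begin
  ∑ (vecs n) (λ q → ⟦ same p q ⟧ * h q)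
    ≤⟨ ∑-mono (vecs n) (λ q → when (same p q) (λ e → ≤-reflexive (trans (cong h (sym (same⇒≡ p q e))) (sym (trans (cong (h p *_) (⟦⟧-true e)) (*-identityʳ _)))))) ⟩
  ∑ (vecs n) (λ q → h p * ⟦ same p q ⟧)    ≡⟨ ∑-* (vecs n) (h p) _ ⟩
  h p * ∑ (vecs n) (λ q → ⟦ same p q ⟧)
    ≤⟨ *-monoʳ-≤ (h p) (≤-trans (determined (same p) ∅ (λ σ τ e e′ _ → trans (sym (same⇒≡ p σ e)) (same⇒≡ p τ e′))) (≤-reflexive (cong (2 ^_) (∣∅∣ n)))) ⟩
  h p * 1                                  ≡⟨ *-identityʳ _ ⟩
  h p ∎
  where open ≤-Reasoning

∑-witness : ∀ {A : Set} xs (f : A → ℕ) → 1 ≤ ∑ xs f → ∃ λ x → 1 ≤ f x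
∑-witness (x ∷ xs) f h with f x in eq
... | suc k = x , subst (1 ≤_) (sym eq) (s≤s z≤n)
... | zero  = ∑-witness xs f h

find : ∀ {A : Set} (P : A → Bool) xs → (∃ λ x → P x ≡ true) ⊎ (∀ x → x ∈ᴸ xs → P x ≡ false)
find P [] = inj₂ (λ _ ())
find P (x ∷ xs) with P x in eq
... | true  = inj₁ (x , eq)
... | false = map₂ (λ h → λ { _ (here refl) → eq ; y (there m) → h y m }) (find P xs)

¬¬-finite-choice : ∀ {A : Set} (P : A → Set) xs → (∀ x → ¬ ¬ P x) → ¬ ¬ (∀ x → x ∈ᴸ xs → P x)
¬¬-finite-choice P []       h k = k (λ _ ())
¬¬-finite-choice P (x ∷ xs) h k = h x (λ p → ¬¬-finite-choice P xs h (λ q → k (λ { _ (here refl) → p ; y (there m) → q y m })))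

¬¬-em : ∀ {P : Set} → ¬ ¬ (P ⊎ ¬ P)
¬¬-em k = k (inj₂ (λ p → k (inj₁ p)))

below : ∀ h → ⟦ 1 ≤ᵇ h ⟧ ≤ h
below zero    = z≤n
below (suc h) = s≤s z≤n

suc-^≤ : ∀ n k → 0 < n → suc n ^ k ≤ 2 ^ k * n ^ k
suc-^≤ n k n>0 = ≤-trans (^-monoˡ-≤ k (≤-trans (+-monoˡ-≤ n n>0) (≤-reflexive (cong (n +_) (sym (+-identityʳ n))))))
                         (≤-reflexive (^-distribʳ-* 2 n k))

cellConstant : ℕ → ℕ
cellConstant d = d * (2 * 2 ^ d)

module Assembly (R : RealField) {n ρ′ d : ℕ} (ρ≤d : suc ρ′ ≤ d) (n>0 : 0 < n)
  (H : Fin n → Geometry.Hyperplane R (suc ρ′)) (distinct : Geometry.Distinct R H)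
  (decV : ∀ σ → Arrangement.V R H σ ⊎ ¬ Arrangement.V R H σ)
  (decW : ∀ k b σ → Cells.W R H distinct decV k b σ ⊎ ¬ Cells.W R H distinct decV k b σ)
  (many : ∀ σ → Cells.nonempty R H distinct decV σ ≡ true → suc ρ′ ≤ ∣ Cells.F R H distinct decV σ ∣) where

  open Geometry R using (Independent)
  open Arrangement R H using (V; independent)
  open Cells R H distinct decV using (nonempty; F; F-∋; ∋-F; count-cells; no-wall⇒many-facets; module Apex; module Walls)
  open Walls decW

  private
    ρ = suc ρ′
    c = cellConstant d

  P₁ P₂ : Vec Bool n → Bool
  P₁ σ = nonempty σ ∧ walled σ
  P₂ σ = nonempty σ

  module Fam₁ = Family F P₁ ρ
  module Fam₂ (k : ℕ) = Family F P₂ k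

  few-walled : length Fam₁.family ≤ c * n ^ ρ′
  few-walled = begin
    length Fam₁.family                ≤⟨ Fam₁.length-family ⟩
    ∑ (vecs n) (λ σ → ⟦ P₁ σ ⟧)       ≤⟨ ∑-mono (vecs n) (λ σ → ⟦⟧-mono (proj₂ ∘ ∧-true {nonempty σ})) ⟩
    ∑ (vecs n) (λ σ → ⟦ walled σ ⟧)   ≤⟨ count-walled ⟩
    ρ * (2 * suc n ^ ρ′)              ≤⟨ *-mono-≤ ρ≤d (*-monoʳ-≤ 2 (≤-trans (suc-^≤ n ρ′ n>0) (*-monoˡ-≤ (n ^ ρ′) (^-monoʳ-≤ 2 (≤-trans (n≤1+n ρ′) ρ≤d))))) ⟩
    d * (2 * (2 ^ d * n ^ ρ′))        ≡⟨ ex d (2 ^ d) (n ^ ρ′) ⟩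
    c * n ^ ρ′ ∎
    where
    open ≤-Reasoning
    ex : ∀ d p x → d * (2 * (p * x)) ≡ d * (2 * p) * x
    ex = solve-∀

  few-cells : ∀ k → length (Fam₂.family k) ≤ c * n ^ ρ
  few-cells k = begin
    length (Fam₂.family k)            ≤⟨ Fam₂.length-family k ⟩
    ∑ (vecs n) (λ σ → ⟦ nonempty σ ⟧) ≤⟨ count-cells ⟩
    suc n ^ ρ                         ≤⟨ suc-^≤ n ρ n>0 ⟩
    2 ^ ρ * n ^ ρ                     ≤⟨ *-monoˡ-≤ (n ^ ρ) (≤-trans (^-monoʳ-≤ 2 ρ≤d) (≤-trans (≤-reflexive (sym (*-identityˡ (2 ^ d))))
                                           (*-mono-≤ (≤-trans (s≤s z≤n) ρ≤d) (m≤m+n (2 ^ d) _)))) ⟩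
    c * n ^ ρ ∎
    where open ≤-Reasoning

  cell-nonempty : ∀ {σ} → V σ → nonempty σ ≡ true
  cell-nonempty {σ} = true-positive (decV σ)

  -- Cells meeting a wall contain a member of the first family, cells with at least k facets one of the second.
  unobstructed : ∀ k (I M : Subset n) → I ⊑ M → (∀ O → O ∈ᴸ Fam₁.family → ¬ O ⊑ M) → (∀ O → O ∈ᴸ Fam₂.family k → ¬ O ⊑ M) →
    ∀ σ → V σ → F σ ⊑ I → walled σ ≡ false × ∣ F σ ∣ < k × ρ < ∣ F σ ∣
  unobstructed k I M I⊑M free₁ free₂ σ Vσ F⊑I = inner , few , no-wall⇒many-facets Vσ (not-walled σ inner)
    where
    inner : walled σ ≡ false
    inner = ≢true (λ w → let O , m , s = Fam₁.covers σ (true-∧ (cell-nonempty Vσ) w) (many σ (cell-nonempty Vσ))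
                         in free₁ O m (⊑-trans s (⊑-trans F⊑I I⊑M)))
    few : ∣ F σ ∣ < k
    few = ≰⇒> (λ le → let O , m , s = Fam₂.covers k σ (cell-nonempty Vσ) le in free₂ O m (⊑-trans s (⊑-trans F⊑I I⊑M)))

  module _ {q s : ℕ} (d≥2 : 2 ≤ d) (P : Params d (constant d c (2 ^ d)) (2 ^ d) q n)
           (s-small : q * s ^ d < n * ⌊log₂ n ⌋) (at-most : ∀ S → Independent H S → ∣ S ∣ ≤ s) where

    module Run (k : ℕ) (k>0 : 0 < k) (E : Subset n → Bool) (size : ∀ f → E f ≡ true → ∣ f ∣ ≡ suc d)
               (codegree : ∀ D → ∣ D ∣ ≡ d → ∑ (vecs n) (λ f → ⟦ E f ∧ sub D f ⟧) ≤ 2 ^ d)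
               (S₁ : Sparse d c Fam₁.family) (S₂ : Sparse d c (Fam₂.family k))
               (edges : ∀ σ → V σ → walled σ ≡ false → ∣ F σ ∣ < k → ρ < ∣ F σ ∣ → E (F σ) ≡ true) where

      open Process d≥2 P E size codegree Fam₁.family (Fam₂.family k) S₁ S₂ s s-small
      open Growth E using (ind; ind-elim)
      open Cycles {d = d} {2 ^ d} E size codegree using (pairs; pairs-nonempty; triangles; triangles-size)

      all-nonempty : ∀ O → O ∈ᴸ Os → 0 < ∣ O ∣
      all-nonempty O m with ∈-++⁻ Fam₁.family m
      ... | inj₁ h = subst (0 <_) (sym (Fam₁.size O h)) z<s
      ... | inj₂ m′ with ∈-++⁻ (Fam₂.family k) m′
      ... | inj₁ h = subst (0 <_) (sym (Fam₂.size k O h)) k>0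
      ... | inj₂ m″ with ∈-++⁻ pairs m″
      ... | inj₁ h = pairs-nonempty O h
      ... | inj₂ h = subst (0 <_) (sym (triangles-size O h)) (≤-trans (≤-trans (s≤s z≤n) d≥2) (m≤m+n d (d + d)))

      absurd : ⊥
      absurd = contradictory (λ M free I I⊑M i → at-most I (independent I (λ σ Vσ facets →
        let F⊑I = λ j m → facets j (F-∋ σ m)
            inner , few , more = unobstructed k I M I⊑M (λ O m → free O (∈-++⁺ˡ m)) (λ O m → free O (∈-++⁺ʳ Fam₁.family (∈-++⁺ˡ m))) σ Vσ F⊑I
        in ind-elim I (F σ) i (edges σ Vσ inner few more) F⊑I))) all-nonempty

    degenerate : ρ < d → ⊥
    degenerate ρ<d = Run.absurd (suc ρ) z<s (λ _ → false) (λ _ ()) (λ D _ → ∑≤0 (vecs n) (λ _ → refl))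
      (mkSparse 1 2 ρ ρ′ refl (+-comm 1 ρ′) (≤-trans ρ≤d (≤-reflexive (sym (*-identityˡ d)))) Fam₁.size few-walled)
      (mkSparse 1 2 (suc ρ) ρ refl (+-comm 1 ρ) (≤-trans ρ<d (≤-reflexive (sym (*-identityˡ d)))) (Fam₂.size (suc ρ)) (few-cells (suc ρ)))
      (λ σ Vσ _ few more → ⊥-elim (<⇒≱ few more))

    essential : ρ ≡ d → ⊥
    essential refl = Run.absurd (2 + d) z<s E E-size E-codegree
      (mkSparse 1 2 d ρ′ refl (+-comm 1 ρ′) (≤-reflexive (sym (*-identityˡ d))) Fam₁.size few-walled)
      (mkSparse 2 1 (2 + d) d refl (+-comm 2 d) (≤-trans (+-monoˡ-≤ d d≥2) (≤-reflexive (cong (d +_) (sym (+-identityʳ d))))) (Fam₂.size (2 + d)) (few-cells (2 + d)))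
      (λ σ Vσ inner few more → E-intro σ (true-∧ (cell-nonempty Vσ) (true-∧ (cong not inner) (≡ᵇ-intro {∣ F σ ∣} (≤-antisym (≤-pred few) more)))))
      where
      simplicial : Vec Bool n → Bool
      simplicial σ = nonempty σ ∧ (not (walled σ) ∧ (∣ F σ ∣ ≡ᵇ suc d))
      witnesses : Subset n → ℕ
      witnesses f = ∑ (vecs n) (λ σ → ⟦ simplicial σ ⟧ * ⟦ same (F σ) f ⟧)
      E : Subset n → Bool
      E f = 1 ≤ᵇ witnesses f
      E-intro : ∀ σ → simplicial σ ≡ true → E (F σ) ≡ true
      E-intro σ h = ≤ᵇ-intro (≤-trans (≤-reflexive (sym (cong₂ _*_ (⟦⟧-true h) (⟦⟧-true (same-refl (F σ))))))
                                      (∑-∈ (λ τ → ⟦ simplicial τ ⟧ * ⟦ same (F τ) (F σ) ⟧) (∈-vecs σ)))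
      both : ∀ a b → 1 ≤ ⟦ a ⟧ * ⟦ b ⟧ → a ≡ true × b ≡ true
      both true true _ = refl , refl
      E-size : ∀ f → E f ≡ true → ∣ f ∣ ≡ suc d
      E-size f e = let σ , h = ∑-witness (vecs n) _ (≤ᵇ-elim e)
                       a , b = both (simplicial σ) _ h
                   in trans (cong ∣_∣ (sym (same⇒≡ (F σ) f b))) (≡ᵇ-elim {∣ F σ ∣} (proj₂ (∧-true {not (walled σ)} (proj₂ (∧-true {nonempty σ} a)))))
      E-codegree : ∀ D → ∣ D ∣ ≡ d → ∑ (vecs n) (λ f → ⟦ E f ∧ sub D f ⟧) ≤ 2 ^ d
      E-codegree D ∣D∣ = begin
        ∑ (vecs n) (λ f → ⟦ E f ∧ sub D f ⟧)
          ≤⟨ ∑-mono (vecs n) (λ f → ≤-trans (≤-reflexive (trans (∧-⟦⟧ (E f) _) (*-comm ⟦ E f ⟧ _)))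
               (≤-trans (*-monoʳ-≤ ⟦ sub D f ⟧ (below (witnesses f))) (≤-reflexive (sym (∑-* (vecs n) ⟦ sub D f ⟧ _))))) ⟩
        ∑ (vecs n) (λ f → ∑ (vecs n) (λ σ → ⟦ sub D f ⟧ * (⟦ simplicial σ ⟧ * ⟦ same (F σ) f ⟧))) ≡⟨ ∑-swap (vecs n) (vecs n) _ ⟩
        ∑ (vecs n) (λ σ → ∑ (vecs n) (λ f → ⟦ sub D f ⟧ * (⟦ simplicial σ ⟧ * ⟦ same (F σ) f ⟧))) ≤⟨ ∑-mono (vecs n) perσ ⟩
        ∑ (vecs n) (λ σ → ⟦ simplicial σ ∧ sub D (F σ) ⟧)
          ≤⟨ determined _ D (λ σ τ a b agree → Ap.simplex-determined (simplex a) (simplex b) agree) ⟩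
        2 ^ ∣ D ∣ ≡⟨ cong (2 ^_) ∣D∣ ⟩
        2 ^ d ∎
        where
        open ≤-Reasoning
        module Ap = Apex D ∣D∣
        simplex : ∀ {σ} → simplicial σ ∧ sub D (F σ) ≡ true → Ap.Simplex σ
        simplex {σ} h = let a , b = ∧-true {simplicial σ} h
                            a₁ , a₂ = ∧-true {nonempty σ} a
                            a₃ , a₄ = ∧-true {not (walled σ)} a₂
                        in record { V-σ = positive-true (decV σ) a₁ ; inner = not-walled σ (trans (not-not _) (cong not a₃))
                                  ; D⊑F = sub⇒⊑ D (F σ) b ; size = ≡ᵇ-elim {∣ F σ ∣} a₄ }
          where not-not : ∀ b → b ≡ not (not b)
                not-not true  = refl
                not-not false = refl
        ex : ∀ a b c → a * (b * c) ≡ b * (c * a)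
        ex = solve-∀
        perσ : ∀ σ → ∑ (vecs n) (λ f → ⟦ sub D f ⟧ * (⟦ simplicial σ ⟧ * ⟦ same (F σ) f ⟧)) ≤ ⟦ simplicial σ ∧ sub D (F σ) ⟧
        perσ σ = begin
          ∑ (vecs n) (λ f → ⟦ sub D f ⟧ * (⟦ simplicial σ ⟧ * ⟦ same (F σ) f ⟧))
            ≡⟨ ∑-cong (vecs n) (λ f → ex ⟦ sub D f ⟧ ⟦ simplicial σ ⟧ ⟦ same (F σ) f ⟧) ⟩
          ∑ (vecs n) (λ f → ⟦ simplicial σ ⟧ * (⟦ same (F σ) f ⟧ * ⟦ sub D f ⟧)) ≡⟨ ∑-* (vecs n) ⟦ simplicial σ ⟧ _ ⟩
          ⟦ simplicial σ ⟧ * ∑ (vecs n) (λ f → ⟦ same (F σ) f ⟧ * ⟦ sub D f ⟧)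
            ≤⟨ *-monoʳ-≤ ⟦ simplicial σ ⟧ (∑-same (F σ) (λ f → ⟦ sub D f ⟧)) ⟩
          ⟦ simplicial σ ⟧ * ⟦ sub D (F σ) ⟧ ≡⟨ ∧-⟦⟧ (simplicial σ) _ ⟨
          ⟦ simplicial σ ∧ sub D (F σ) ⟧ ∎

    impossible : ⊥
    impossible with m≤n⇒m<n∨m≡n ρ≤d
    ... | inj₁ lt = degenerate lt
    ... | inj₂ eq = essential eq

refute : (R : RealField) {n d q s : ℕ} → 0 < n → 2 ≤ d → Params d (constant d (cellConstant d) (2 ^ d)) (2 ^ d) q n →
  q * s ^ d < n * ⌊log₂ n ⌋ → ∀ ρ → ρ ≤ d → (H : Fin n → Geometry.Hyperplane R ρ) → Geometry.Distinct R H →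
  (∀ S → Geometry.Independent R H S → ∣ S ∣ ≤ s) → ⊥
refute R {suc n} n>0 d≥2 P s-small zero ρ≤d H distinct at-most = Geometry.nonzero {R} (H zero) (λ ())
refute R {n} {d} {q} {s} n>0 d≥2 P s-small (suc ρ′) ρ≤d H distinct at-most =
  ¬¬-finite-choice (λ σ → V σ ⊎ ¬ V σ) (vecs n) (λ σ → ¬¬-em) (λ dec → with-cells (λ σ → dec σ (∈-vecs σ)))
  where
  open Arrangement R H using (V)
  with-cells : (∀ σ → V σ ⊎ ¬ V σ) → ⊥
  with-cells decV = [ project-away , (λ none → ¬¬-finite-choice DecW (fins (suc ρ′)) decide (λ dec → with-walls none (λ k → dec k (∈-fins k)))) ]′
                    (find poor (vecs n))
    where
    open Cells R H distinct decV using (nonempty; F; W; few-facets)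
    poor : Vec Bool n → Bool
    poor σ = nonempty σ ∧ not (suc ρ′ ≤ᵇ ∣ F σ ∣)
    project-away : (∃ λ σ → poor σ ≡ true) → ⊥
    project-away (σ , h) =
      let a , b = ∧-true {nonempty σ} h
          u , (k , ne) , flat = few-facets (positive-true (decV σ) a) (≰⇒> (λ le → case trans (sym b) (cong not (≤ᵇ-intro le)) of λ ()))
          open Projection R H using (H′; distinct′; independent′)
      in refute R n>0 d≥2 P s-small ρ′ (<⇒≤ ρ≤d) (H′ u k ne flat) (distinct′ u k ne flat distinct)
           (λ S i → at-most S (independent′ u k ne flat S i))
    DecW : Fin (suc ρ′) → Set
    DecW k = ∀ σ → σ ∈ᴸ vecs n → (W k true σ ⊎ ¬ W k true σ) × (W k false σ ⊎ ¬ W k false σ)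
    decide : ∀ k → ¬ ¬ DecW k
    decide k = ¬¬-finite-choice _ (vecs n) (λ σ f → ¬¬-em (λ x → ¬¬-em (λ y → f (x , y))))
    with-walls : (∀ σ → σ ∈ᴸ vecs n → poor σ ≡ false) → (∀ k → DecW k) → ⊥
    with-walls none dec = Assembly.impossible R ρ≤d n>0 H distinct decV decW many {q} {s} d≥2 P s-small at-most
      where
      decW : ∀ k b σ → W k b σ ⊎ ¬ W k b σ
      decW k true  σ = proj₁ (dec k σ (∈-vecs σ))
      decW k false σ = proj₂ (dec k σ (∈-vecs σ))
      many : ∀ σ → nonempty σ ≡ true → suc ρ′ ≤ ∣ F σ ∣
      many σ h with suc ρ′ ≤ᵇ ∣ F σ ∣ in eq
      ... | true  = ≤ᵇ-elim eq
      ... | false = ⊥-elim (not-both (true-∧ h (cong not eq)) (none σ (∈-vecs σ)))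

threshold : ∀ (P : ℕ → Set) → (∀ m → Dec (P m)) → ¬ P 0 → ∀ m → P m → ∃ λ s → ¬ P s × P (suc s)
threshold P dec ¬P0 zero    Pm = ⊥-elim (¬P0 Pm)
threshold P dec ¬P0 (suc m) Pm with dec m
... | yes Pm′ = threshold P dec ¬P0 m Pm′
... | no  ¬Pm = m , ¬Pm , Pm

theorem8 : (R : RealField) → (d : ℕ) → 2 ≤ d →
    ∃ λ (p : ℕ) → ∃ λ (q : ℕ) → 0 < p × 0 < q × ∃ λ (N : ℕ) →
    ∀ (n : ℕ) → N ≤ n → (H : Fin n → Geometry.Hyperplane R d) →
    Geometry.Distinct R H →
    ∃ λ (S : Subset n) → Geometry.Independent R H S ×
    p * (n * ⌊log₂ n ⌋) ≤ q * (∣ S ∣ ^ d)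
theorem8 R d d≥2 with params d (constant d (cellConstant d) (2 ^ d)) (2 ^ d) d≥2 (m^n>0 2 d)
... | q , q>0 , N , N>0 , P = 1 , q , z<s , q>0 , 2 + N , main
  where
  open Geometry R using (Hyperplane; Distinct; Independent; Generic; FacetOf)
  main : ∀ n → 2 + N ≤ n → (H : Fin n → Hyperplane d) → Distinct H →
         ∃ λ (S : Subset n) → Independent H S × 1 * (n * ⌊log₂ n ⌋) ≤ q * (∣ S ∣ ^ d)
  main n n≥ H distinct = search (find big (vecs n))
    where
    t = n * ⌊log₂ n ⌋
    n>0 : 0 < n
    n>0 = ≤-trans (s≤s z≤n) n≥
    t>0 : 0 < t
    t>0 = *-mono-≤ n>0 (⌊log₂⌋-mono-≤ {2} {n} (≤-trans (m≤m+n 2 N) n≥))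
    large : ℕ → Set
    large m = t ≤ q * m ^ d
    d>0 : 0 < d
    d>0 = ≤-trans (s≤s z≤n) d≥2
    large-t : large t
    large-t = ≤-trans (≤-trans (≤-reflexive (sym (*-identityʳ t))) (^-monoʳ-≤ t {{>-nonZero t>0}} d>0))
                      (≤-trans (≤-reflexive (sym (*-identityˡ _))) (*-monoˡ-≤ (t ^ d) q>0))
    ¬large-0 : ¬ large 0
    ¬large-0 h = <⇒≱ t>0 (≤-trans h (≤-reflexive (trans (cong (q *_) (0^d d d>0)) (*-zeroʳ q))))
      where 0^d : ∀ d → 0 < d → 0 ^ d ≡ 0
            0^d (suc d) _ = refl
    cut : ∃ λ s → ¬ large s × large (suc s)
    cut = threshold large (λ m → t ≤? q * m ^ d) ¬large-0 t large-t
    s = proj₁ cut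
    stable : ∀ S → ¬ ¬ Independent H S → Independent H S
    stable S h x generic facets = h (λ ind → ind x generic facets)
    dec : ∀ S → Independent H S ⊎ ¬ Independent H S
    dec S = [ inj₂ , inj₁ ∘ stable S ]′ (Field.wlem R (Independent H S))
    big : Subset n → Bool
    big S = positive-part (dec S) ∧ (suc s ≤ᵇ ∣ S ∣)
    search : (∃ λ S → big S ≡ true) ⊎ (∀ S → S ∈ᴸ vecs n → big S ≡ false) →
             ∃ λ (S : Subset n) → Independent H S × 1 * t ≤ q * (∣ S ∣ ^ d)
    search (inj₁ (S , h)) = S , positive-true (dec S) (proj₁ (∧-true h)) ,
      ≤-trans (≤-reflexive (*-identityˡ t)) (≤-trans (proj₂ (proj₂ cut))
        (*-monoʳ-≤ q (^-monoˡ-≤ d (≤ᵇ-elim (proj₂ (∧-true {positive-part (dec S)} h))))))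
    search (inj₂ none) = ⊥-elim (refute R {s = s} n>0 d≥2 (P n (≤-trans (m≤n+m N 2) n≥)) (≰⇒> (proj₁ (proj₂ cut))) d ≤-refl H distinct
      (λ S ind → ≮⇒≥ (λ lt → not-both (true-∧ (true-positive (dec S) ind) (≤ᵇ-intro lt)) (none S (∈-vecs S)))))
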